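{- Let $n, e, f \in \mathbb N$, and let $\mathcal X'_n(q,e)$ be as defined in the context. Then: (a) If $n$ is even then $|\mathcal X^\prime_n(2,e)| \leqslant 2^{(e-2)(e-3)/2}$. (b) If $n$ is odd then $|\mathcal X^\prime_n(2,e)| \leqslant 2^{(e^2-5e+8)/2}$. (c) If $p$ is an odd prime then $|\mathcal X^\prime_n(p^f,e)| \leqslant p^{(e-1)^2}$. (d) If $f>1$ and $n$ is even then $|\mathcal X^\prime_n(2^f,e)| \leqslant 2^{(e-1)(e-2)}$. (e) If $f>1$ and $n$ is odd then $|\mathcal X^\prime_n(2^f,e)| \leqslant 2^{(e-1)^2-\lfloor e/4\rfloor}$.
   Context: For an integer $q\geqslant 2$, $\zeta$ is a primitive complex $q$th root of unity and $\mathcal C_q=\{\zeta^j : j\in\mathbb Z\}$. A $q$-Seidel matrix of order $n$ is an $n\times n$ Hermitean matrix whose diagonal entries are all $0$ and whose off-diagonal entries all lie in $\mathcal C_q$. For a matrix $S$, $\chi_S(x)=\det(xI-S)$. Let $\rho=(1-\zeta)(1-\zeta^{ -1})$. For $q>2$, $\mathcal X'_n(q,e)$ denotes the set of congruence classes of $\chi_S(x)$, where $S$ ranges over $q$-Seidel matrices of order $n$, modulo the ideal $\rho^e\mathbb Z[\zeta+\zeta^{ -1}][x]$. For $q=2$, $\mathcal X'_n(2,e)$ denotes the set of congruence classes of $\chi_S(x)$, $S$ ranging over $2$-Seidel matrices (symmetric, zero diagonal, off-diagonal entries $\pm1$) of order $n$, modulo $2^e\mathbb Z[x]$. -}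

module Defs where

open import Data.Nat as ℕ using (ℕ; zero; suc; _≤_; _∸_)
open import Data.Integer as ℤ using (ℤ; +_; -_; ∣_∣)
open import Data.Integer.Divisibility as ℤD using ()
open import Data.List using (List; []; _∷_; map; replicate; _++_)
open import Data.Fin as Fin using (Fin; punchIn)
open import Data.Bool using (if_then_else_)
open import Data.Product using (Σ; ∃; _×_; _,_)
open import Data.Sum using (_⊎_)
open import Relation.Nullary using (¬_; does)
open import Relation.Binary.PropositionalEquality using (_≡_; _≢_)

-- Generic (univariate) polynomial arithmetic on coefficient lists
-- (lowest degree first), over a carrier with ring operations, and the
-- determinant of a square matrix (cofactor expansion along row 0).

module PolyOps {A : Set} (0# 1# : A) (_⊕_ _⊗_ : A → A → A) (⊖_ : A → A) where

  Pol : Set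
  Pol = List A

  infixl 6 _+P_ _-P_
  infixl 7 _*P_

  _+P_ : Pol → Pol → Pol
  [] +P q = q
  (a ∷ p) +P [] = a ∷ p
  (a ∷ p) +P (b ∷ q) = (a ⊕ b) ∷ (p +P q)

  negP : Pol → Pol
  negP = map ⊖_

  _-P_ : Pol → Pol → Pol
  p -P q = p +P negP q

  scaleP : A → Pol → Pol
  scaleP a = map (a ⊗_)

  _*P_ : Pol → Pol → Pol
  [] *P q = []
  (a ∷ p) *P q = scaleP a q +P (0# ∷ (p *P q))

  constP : A → Pol
  constP a = a ∷ []

  X : Pol
  X = 0# ∷ 1# ∷ []

  coeff : Pol → ℕ → A
  coeff [] k = 0#
  coeff (a ∷ p) zero = a
  coeff (a ∷ p) (suc k) = coeff p k

module Det {A : Set} (0# 1# : A) (_⊕_ _⊗_ : A → A → A) (⊖_ : A → A) where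

  altSum : (n : ℕ) → (Fin n → A) → A
  altSum zero f = 0#
  altSum (suc n) f = f Fin.zero ⊕ (⊖ altSum n (λ j → f (Fin.suc j)))

  det : (n : ℕ) → (Fin n → Fin n → A) → A
  det zero M = 1#
  det (suc n) M =
    altSum (suc n) (λ j → M Fin.zero j ⊗ det n (λ i k → M (Fin.suc i) (punchIn j k)))

module ZP = PolyOps (+ 0) (+ 1) ℤ._+_ ℤ._*_ ℤ.-_

ZPoly : Set
ZPoly = List ℤ

mono : ℕ → ZPoly
mono k = replicate k (+ 0) ++ (+ 1 ∷ [])

powZ : ZPoly → ℕ → ZPoly
powZ a zero = + 1 ∷ []
powZ a (suc e) = ZP._*P_ a (powZ a e)

evalZ : ZPoly → ZPoly → ZPoly
evalZ [] t = []
evalZ (c ∷ cs) t = ZP._+P_ (c ∷ []) (ZP._*P_ t (evalZ cs t))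

-- The ring ℤ[ζ] for ζ a primitive (p^f)-th root of unity (f ≥ 1),
-- realised as ℤ[y]/(Φ_{p^f}(y)), where
--   Φ_{p^f}(y) = Σ_{i<p} y^{i·p^{f-1}}
-- is the (p^f)-th cyclotomic polynomial; ζ corresponds to the class of y.

sumMonos : ℕ → ℕ → ZPoly
sumMonos zero s = []
sumMonos (suc m) s = ZP._+P_ (mono (m ℕ.* s)) (sumMonos m s)

cyclo : (p f : ℕ) → ZPoly
cyclo p f = sumMonos p (p ℕ.^ (f ∸ 1))

module Cyclotomic (p f : ℕ) where

  q : ℕ
  q = p ℕ.^ f

  Φ : ZPoly
  Φ = cyclo p f

  -- elements of ℤ[ζ] are represented by integer polynomials in y = ζ
  Zζ : Set
  Zζ = ZPoly

  _≈ζ_ : Zζ → Zζ → Set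
  a ≈ζ b = ∃ λ (d : ZPoly) → ∀ k → ZP.coeff (ZP._-P_ a b) k ≡ ZP.coeff (ZP._*P_ Φ d) k

  ζ^ : ℕ → Zζ
  ζ^ k = mono k

  ζ⁻¹ : Zζ
  ζ⁻¹ = mono (q ∸ 1)

  conj : Zζ → Zζ
  conj a = evalZ a ζ⁻¹

  ρ : Zζ
  ρ = ZP._*P_ (ZP._-P_ (mono 0) (ζ^ 1)) (ZP._-P_ (mono 0) ζ⁻¹)

  -- θ = ζ + ζ⁻¹, so ℤ[ζ + ζ⁻¹] = { evalZ c θ | c ∈ ℤ[t] }
  θ : Zζ
  θ = ZP._+P_ (ζ^ 1) ζ⁻¹

  InRhoIdeal : ℕ → Zζ → Set
  InRhoIdeal e a = ∃ λ (c : ZPoly) → a ≈ζ ZP._*P_ (powZ ρ e) (evalZ c θ)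

  record Seidel (n : ℕ) : Set where
    field
      mat     : Fin n → Fin n → Zζ
      diag    : ∀ i → mat i i ≈ζ []
      offdiag : ∀ i j → i ≢ j → ∃ λ (k : ℕ) → mat i j ≈ζ ζ^ k
      herm    : ∀ i j → mat j i ≈ζ conj (mat i j)

  module XP = PolyOps {Zζ} [] (+ 1 ∷ []) ZP._+P_ ZP._*P_ ZP.negP

  module XD = Det {XP.Pol} [] (XP.constP (+ 1 ∷ [])) XP._+P_ XP._*P_ XP.negP

  charPoly : ∀ {n} → Seidel n → XP.Pol
  charPoly {n} S = XD.det n (λ i j →
    XP._-P_ (if does (i Fin.≟ j) then XP.X else []) (XP.constP (Seidel.mat S i j)))

  CongMod : ℕ → XP.Pol → XP.Pol → Set
  CongMod e χ ψ = ∀ k → InRhoIdeal e (ZP._-P_ (XP.coeff χ k) (XP.coeff ψ k))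

  -- |X'_n(q,e)| ≤ B : any family of q-Seidel matrices of order n whose
  -- characteristic polynomials are pairwise incongruent has at most B members
  CardX'≤ : (n e B : ℕ) → Set
  CardX'≤ n e B = ∀ (m : ℕ) (S : Fin m → Seidel n) →
    (∀ i j → i ≢ j → ¬ CongMod e (charPoly (S i)) (charPoly (S j))) → m ≤ B

module Two where

  record Seidel (n : ℕ) : Set where
    field
      mat     : Fin n → Fin n → ℤ
      diag    : ∀ i → mat i i ≡ + 0
      offdiag : ∀ i j → i ≢ j → (mat i j ≡ + 1) ⊎ (mat i j ≡ - (+ 1))
      symm    : ∀ i j → mat j i ≡ mat i j

  module ZD = Det {ZPoly} [] (+ 1 ∷ []) ZP._+P_ ZP._*P_ ZP.negP

  charPoly : ∀ {n} → Seidel n → ZPoly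
  charPoly {n} S = ZD.det n (λ i j →
    ZP._-P_ (if does (i Fin.≟ j) then ZP.X else []) (ZP.constP (Seidel.mat S i j)))

  CongMod : ℕ → ZPoly → ZPoly → Set
  CongMod e χ ψ = ∀ k → (+ (2 ℕ.^ e)) ℤD.∣ (ZP.coeff χ k ℤ.- ZP.coeff ψ k)

  CardX'≤ : (n e B : ℕ) → Set
  CardX'≤ n e B = ∀ (m : ℕ) (S : Fin m → Seidel n) →
    (∀ i j → i ≢ j → ¬ CongMod e (charPoly (S i)) (charPoly (S j))) → m ≤ B

{-# OPTIONS --safe #-}
-- Put T = S + I and F(u) = det (I - u T) = Σ a_k u^k, so that χ_S(x) = Σ a_k (x + 1)^(n-k); a₀, a₁, a₂ depend only
-- on n. All entries of T are 1 modulo π = 1 - ζ, so clearing the first row and column gives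
--   a_{k+1} = π^k (π E_{k+1} - E_k + π β_{k+1}),   E = det N,   β = det N′,   N = I + v*v + u B,
-- with v the first row of T and N′ the matrix N bordered by -v. Lifting ζ to an indeterminate, the a_k become real
-- Laurent polynomials, that is, polynomials in ρ = (1 - ζ)(1 - ζ⁻¹), and a real multiple of π^k is a multiple of
-- ρ^⌈k/2⌉. The classes are counted by the base-ρ digits of a_{k+1} / ρ^⌈k/2⌉ (base 2 for q = 2).
--
-- For 2-powers q, the matrices N and N′ are Hermitian with even diagonal. Splitting off hyperbolic planes shows that
-- their determinants vanish modulo (2, π) in odd size, and that E ≡ ± P τ(P) modulo (4, 2π, π²) in even size, with τ
-- the conjugation together with u ↦ -ζ⁻¹ u. In even order n the first fact makes the lowest digits vanish. In odd
-- order the lowest digit of coefficient 2 j + 1 is the j-th coefficient of P modulo (2, π), and the second fact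
-- expresses that coefficient for most j through earlier digits.
module Submission where

open import Algebra.Bundles using (CommutativeRing)
open import Data.Nat.Base as ℕ using (ℕ; zero; suc; _≤_; _<_; _∸_; z≤n; s≤s)
import Data.Nat.Properties as ℕₚ
open import Data.Fin.Base using (Fin; zero; suc; punchIn; toℕ)
open import Data.Fin.Properties using (_≟_)
open import Data.Integer.Base as ℤ using (ℤ; +_; -[1+_])
import Data.Integer.Properties as ℤₚ
open import Data.Product.Base using (_,_; ∃; proj₁; proj₂)
open import Data.Sum.Base using (_⊎_; inj₁; inj₂)
open import Data.Empty using (⊥-elim)
open import Relation.Nullary using (¬_)
open import Relation.Nullary.Decidable using (Dec; yes; no; does)
import Relation.Binary.PropositionalEquality as ≡
open ≡ using (_≡_; _≢_)
open import Defs

-- Inside ℤ[ζ] the argument would need a basis, the real subring and the order of ρ at each element.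
-- In the free ring ℤ[ρ][π]/(π² - ρπ + ρ) all of this is visible in coordinates: conjugation is π ↦
-- ρ - π, an element is real exactly when its π-coordinate vanishes, ρ is regular, and π² = -ζρ.
-- What is used of the cyclotomic ring afterwards is Φ(ζ) = 0 and its consequence p = ρ w(ρ), which
-- makes base-ρ digits 0, ..., p - 1 possible. Digits depend on the chosen lift and not only on the
-- class; this is harmless, because counting asks only that equal digits force congruence. The twist
-- in τ is forced: B is Hermitian only up to π̄/π = -ζ⁻¹. Modulo (2, ρ) the free ring becomes the
-- dual numbers over F₂, where conjugation is trivial and -ζ⁻¹ = 1 + π, so τ(P) = P + π u P′. The
-- derivative is what reveals the coefficients of P in odd degree. The exponents are sums of digit
-- counts: for k ≥ 2 coefficient k + 1 costs e - ⌈k/2⌉ digits, (e - 1)² altogether, and for q = 2 it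
-- costs e - k digits; lowest digits that can be recovered are then subtracted.

module RingPreliminaries where
  open import Level using (0ℓ)
  open import Algebra.Solver.Ring.AlmostCommutativeRing using (fromCommutativeRing; _-Raw-AlmostCommutative⟶_)
  import Data.Maybe.Base as Maybe
  open import Relation.Nullary.Decidable using (dec⇒maybe)

  CRing : Set₁
  CRing = CommutativeRing 0ℓ 0ℓ

  module _ (R : CRing) where
    open CommutativeRing R

    IsZero : Carrier → Set
    IsZero x = x ≈ 0#

    Regular : Carrier → Set
    Regular x = ∀ a → IsZero (x * a) → IsZero a

    TwoTorsionFree : Set
    TwoTorsionFree = ∀ a → IsZero (a + a) → IsZero a

    MutuallyInverse : Carrier → Carrier → Set
    MutuallyInverse x y = x * y ≈ 1#

  -- The solver works with integer coefficients, whose equality is decidable, so numerals and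
  -- cancellation are available in every commutative ring, including quotients whose own equality is
  -- not decided.
  module IntegerMap (R : CRing) where
    open CommutativeRing R
    open import Algebra.Properties.Ring ring
    open import Algebra.Properties.AbelianGroup +-abelianGroup using (⁻¹-∙-comm)
    open import Algebra.Properties.Semiring.Mult.TCOptimised semiring
    open import Relation.Binary.Reasoning.Setoid setoid

    fromℤ : ℤ → Carrier
    fromℤ (+ n)     = n × 1#
    fromℤ (-[1+ n ]) = - (suc n × 1#)

    fromℤ-neg : ∀ i → fromℤ (ℤ.- i) ≈ - fromℤ i
    fromℤ-neg (+ zero)  = sym -0#≈0#
    fromℤ-neg (+ suc n) = refl
    fromℤ-neg -[1+ n ]  = sym (-‿involutive _)

    suc-× : ∀ n → suc n × 1# ≈ 1# + n × 1#
    suc-× n = ×-homo-+ 1# 1 n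

    fromℤ-⊖ : ∀ m n → fromℤ (m ℤ.⊖ n) ≈ m × 1# + - (n × 1#)
    fromℤ-⊖ m zero = sym (trans (+-congˡ -0#≈0#) (+-identityʳ _))
    fromℤ-⊖ zero (suc n) = sym (+-identityˡ _)
    fromℤ-⊖ (suc m) (suc n) = begin
      fromℤ (suc m ℤ.⊖ suc n)                ≡⟨ ≡.cong fromℤ (ℤₚ.[1+m]⊖[1+n]≡m⊖n m n) ⟩
      fromℤ (m ℤ.⊖ n)                        ≈⟨ fromℤ-⊖ m n ⟩
      a + - b                                ≈⟨ +-congʳ (+-identityˡ a) ⟨
      (0# + a) + - b                         ≈⟨ +-congʳ (+-congʳ (-‿inverseʳ 1#)) ⟨
      ((1# + - 1#) + a) + - b                ≈⟨ +-congʳ (+-assoc _ _ _) ⟩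
      (1# + (- 1# + a)) + - b                ≈⟨ +-congʳ (+-congˡ (+-comm _ _)) ⟩
      (1# + (a + - 1#)) + - b                ≈⟨ +-congʳ (+-assoc _ _ _) ⟨
      ((1# + a) + - 1#) + - b                ≈⟨ +-assoc _ _ _ ⟩
      (1# + a) + (- 1# + - b)                ≈⟨ +-congˡ (⁻¹-∙-comm 1# b) ⟩
      (1# + a) + - (1# + b)                  ≈⟨ +-cong (suc-× m) (-‿cong (suc-× n)) ⟨
      suc m × 1# + - (suc n × 1#)            ∎
      where
      a = m × 1#
      b = n × 1#

    fromℤ-+ : ∀ i j → fromℤ (i ℤ.+ j) ≈ fromℤ i + fromℤ j
    fromℤ-+ (+ m) (+ n) = ×-homo-+ 1# m n
    fromℤ-+ (+ m) -[1+ n ] = fromℤ-⊖ m (suc n)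
    fromℤ-+ -[1+ m ] (+ n) = trans (fromℤ-⊖ n (suc m)) (+-comm _ _)
    fromℤ-+ -[1+ m ] -[1+ n ] = begin
      - (suc (suc (m ℕ.+ n)) × 1#)               ≈⟨ -‿cong (suc-× (suc (m ℕ.+ n))) ⟩
      - (1# + (suc m ℕ.+ n) × 1#)                ≈⟨ -‿cong (+-congˡ (×-homo-+ 1# (suc m) n)) ⟩
      - (1# + (suc m × 1# + n × 1#))             ≈⟨ -‿cong (trans (sym (+-assoc _ _ _)) (trans (+-congʳ (+-comm _ _)) (+-assoc _ _ _))) ⟩
      - (suc m × 1# + (1# + n × 1#))             ≈⟨ -‿cong (+-congˡ (suc-× n)) ⟨
      - (suc m × 1# + suc n × 1#)                ≈⟨ ⁻¹-∙-comm _ _ ⟨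
      - (suc m × 1#) + - (suc n × 1#)            ∎

    fromℤ-*⁺ : ∀ n j → fromℤ (+ n ℤ.* j) ≈ n × 1# * fromℤ j
    fromℤ-*⁺ n (+ m) = trans (reflexive (≡.cong fromℤ (≡.sym (ℤₚ.pos-* n m)))) (×1-homo-* n m)
    fromℤ-*⁺ n -[1+ m ] = begin
      fromℤ (+ n ℤ.* -[1+ m ])           ≡⟨ ≡.cong fromℤ (≡.sym (ℤₚ.neg-distribʳ-* (+ n) (+ suc m))) ⟩
      fromℤ (ℤ.- (+ n ℤ.* + suc m))      ≈⟨ fromℤ-neg (+ n ℤ.* + suc m) ⟩
      - fromℤ (+ n ℤ.* + suc m)          ≈⟨ -‿cong (fromℤ-*⁺ n (+ suc m)) ⟩
      - (n × 1# * suc m × 1#)            ≈⟨ -‿distribʳ-* _ _ ⟩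
      n × 1# * - (suc m × 1#)            ∎

    fromℤ-* : ∀ i j → fromℤ (i ℤ.* j) ≈ fromℤ i * fromℤ j
    fromℤ-* (+ n) j = fromℤ-*⁺ n j
    fromℤ-* -[1+ n ] j = begin
      fromℤ (-[1+ n ] ℤ.* j)         ≡⟨ ≡.cong fromℤ (≡.sym (ℤₚ.neg-distribˡ-* (+ suc n) j)) ⟩
      fromℤ (ℤ.- (+ suc n ℤ.* j))    ≈⟨ fromℤ-neg (+ suc n ℤ.* j) ⟩
      - fromℤ (+ suc n ℤ.* j)        ≈⟨ -‿cong (fromℤ-*⁺ (suc n) j) ⟩
      - (suc n × 1# * fromℤ j)       ≈⟨ -‿distribˡ-* _ _ ⟩
      - (suc n × 1#) * fromℤ j       ∎

    morphism : CommutativeRing.rawRing ℤₚ.+-*-commutativeRing -Raw-AlmostCommutative⟶ fromCommutativeRing R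
    morphism = record
      { ⟦_⟧ = fromℤ ; +-homo = fromℤ-+ ; *-homo = fromℤ-* ; -‿homo = fromℤ-neg ; 0-homo = refl ; 1-homo = refl }

  module Solver (R : CRing) where
    open CommutativeRing R using (_≈_; reflexive)
    open IntegerMap R
    open import Algebra.Solver.Ring (CommutativeRing.rawRing ℤₚ.+-*-commutativeRing) (fromCommutativeRing R) morphism
      (λ i j → Maybe.map (λ eq → reflexive (≡.cong fromℤ eq)) (dec⇒maybe (i ℤₚ.≟ j)))
      public

-- Power series over a commutative ring

module PowerSeries where
  open RingPreliminaries
  open import Function.Base using (_∘_)

  module PS (R : CRing) where
    open CommutativeRing R
    open Solver R using (solve; _:=_; _:+_; _:*_; :-_; con)
    open import Relation.Binary.Reasoning.Setoid setoid

    Series : Set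
    Series = ℕ → Carrier

    infix 4 _≋_
    infixl 7 _⊛_
    infixl 6 _⊞_

    _≋_ : Series → Series → Set
    f ≋ g = ∀ k → f k ≈ g k

    _⊛_ : Series → Series → Series
    (f ⊛ g) zero    = f 0 * g 0
    (f ⊛ g) (suc k) = f 0 * g (suc k) + (f ∘ suc ⊛ g) k

    _⊞_ : Series → Series → Series
    (f ⊞ g) k = f k + g k

    lin : Carrier → Carrier → Series
    lin a b zero          = a
    lin a b (suc zero)    = b
    lin a b (suc (suc _)) = 0#

    const : Carrier → Series
    const a zero    = a
    const a (suc _) = 0#

    -- Coefficient `k` sees only pairs of degrees adding up to `k`. This refinement serves wherever
    -- two series agree only up to some degree.
    ⊛-congₖ : ∀ {f f′ g g′} k → (∀ a b → a ℕ.+ b ≡ k → f a * g b ≈ f′ a * g′ b) → (f ⊛ g) k ≈ (f′ ⊛ g′) k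
    ⊛-congₖ zero    h = h 0 0 ≡.refl
    ⊛-congₖ (suc k) h = +-cong (h 0 (suc k) ≡.refl) (⊛-congₖ k (λ a b eq → h (suc a) b (≡.cong suc eq)))

    ⊛-cong : ∀ {f f′ g g′} → f ≋ f′ → g ≋ g′ → f ⊛ g ≋ f′ ⊛ g′
    ⊛-cong p q k = ⊛-congₖ k (λ a b _ → *-cong (p a) (q b))

    -- The product recurses on its left factor; peeling the right factor is the other half of
    -- commutativity.
    ⊛-peelʳ : ∀ f g k → (f ⊛ g) (suc k) ≈ (f ⊛ g ∘ suc) k + f (suc k) * g 0
    ⊛-peelʳ f g zero    = refl
    ⊛-peelʳ f g (suc k) = trans (+-congˡ (⊛-peelʳ (f ∘ suc) g k)) (sym (+-assoc _ _ _))

    ⊛-comm : ∀ f g → f ⊛ g ≋ g ⊛ f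
    ⊛-comm f g zero    = *-comm _ _
    ⊛-comm f g (suc k) = begin
      f 0 * g (suc k) + (f ∘ suc ⊛ g) k   ≈⟨ +-cong (*-comm _ _) (⊛-comm (f ∘ suc) g k) ⟩
      g (suc k) * f 0 + (g ⊛ f ∘ suc) k   ≈⟨ +-comm _ _ ⟩
      (g ⊛ f ∘ suc) k + g (suc k) * f 0   ≈⟨ ⊛-peelʳ g f k ⟨
      (g ⊛ f) (suc k)                     ∎

    ⊛-distribˡ : ∀ f g h → f ⊛ (g ⊞ h) ≋ (f ⊛ g) ⊞ (f ⊛ h)
    ⊛-distribˡ f g h zero    = distribˡ _ _ _
    ⊛-distribˡ f g h (suc k) = begin
      f 0 * (g (suc k) + h (suc k)) + (f ∘ suc ⊛ (g ⊞ h)) k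
        ≈⟨ +-congˡ (⊛-distribˡ (f ∘ suc) g h k) ⟩
      f 0 * (g (suc k) + h (suc k)) + ((f ∘ suc ⊛ g) k + (f ∘ suc ⊛ h) k)
        ≈⟨ solve 5 (λ a b c d e → a :* (b :+ c) :+ (d :+ e) := (a :* b :+ d) :+ (a :* c :+ e)) refl _ _ _ _ _ ⟩
      (f ⊛ g) (suc k) + (f ⊛ h) (suc k) ∎

    ⊛-distribʳ : ∀ f g h → (g ⊞ h) ⊛ f ≋ (g ⊛ f) ⊞ (h ⊛ f)
    ⊛-distribʳ f g h k = trans (⊛-comm (g ⊞ h) f k) (trans (⊛-distribˡ f g h k) (+-cong (⊛-comm f g k) (⊛-comm f h k)))

    ⊛-scaleˡ : ∀ a f g → (λ k → a * f k) ⊛ g ≋ (λ k → a * (f ⊛ g) k)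
    ⊛-scaleˡ a f g zero    = *-assoc _ _ _
    ⊛-scaleˡ a f g (suc k) = trans (+-cong (*-assoc _ _ _) (⊛-scaleˡ a (f ∘ suc) g k)) (sym (distribˡ _ _ _))

    ⊛-zeroˡ : ∀ {f} g → (∀ k → f k ≈ 0#) → ∀ k → (f ⊛ g) k ≈ 0#
    ⊛-zeroˡ g z zero    = trans (*-congʳ (z 0)) (zeroˡ _)
    ⊛-zeroˡ g z (suc k) = trans (+-cong (trans (*-congʳ (z 0)) (zeroˡ _)) (⊛-zeroˡ g (z ∘ suc) k)) (+-identityˡ _)

    ⊛-assoc : ∀ f g h → (f ⊛ g) ⊛ h ≋ f ⊛ (g ⊛ h)
    ⊛-assoc f g h zero    = *-assoc _ _ _
    ⊛-assoc f g h (suc k) = begin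
      f 0 * g 0 * h (suc k) + ((f ⊛ g) ∘ suc ⊛ h) k
        ≈⟨ +-congˡ (⊛-distribʳ h (λ k → f 0 * g (suc k)) (f ∘ suc ⊛ g) k) ⟩
      f 0 * g 0 * h (suc k) + (((λ k → f 0 * g (suc k)) ⊛ h) k + ((f ∘ suc ⊛ g) ⊛ h) k)
        ≈⟨ +-congˡ (+-cong (⊛-scaleˡ (f 0) (g ∘ suc) h k) (⊛-assoc (f ∘ suc) g h k)) ⟩
      f 0 * g 0 * h (suc k) + (f 0 * (g ∘ suc ⊛ h) k + (f ∘ suc ⊛ (g ⊛ h)) k)
        ≈⟨ solve 5 (λ a b c d e → a :* b :* c :+ (a :* d :+ e) := a :* (b :* c :+ d) :+ e) refl _ _ _ _ _ ⟩
      (f ⊛ (g ⊛ h)) (suc k) ∎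

    const-⊛ : ∀ a f k → (const a ⊛ f) k ≈ a * f k
    const-⊛ a f zero    = refl
    const-⊛ a f (suc k) = trans (+-congˡ (⊛-zeroˡ f (λ _ → refl) k)) (+-identityʳ _)

    ⊛-identityˡ : ∀ f → const 1# ⊛ f ≋ f
    ⊛-identityˡ f k = trans (const-⊛ 1# f k) (*-identityˡ _)

    series : CRing
    series = record
      { Carrier = Series ; _≈_ = _≋_ ; _+_ = _⊞_ ; _*_ = _⊛_
      ; -_ = λ f k → - f k ; 0# = λ _ → 0# ; 1# = const 1#
      ; isCommutativeRing = record
        { isRing = record
          { +-isAbelianGroup = record
            { isGroup = record
              { isMonoid = record
                { isSemigroup = record
                  { isMagma = record
                    { isEquivalence = record
                      { refl = λ _ → refl ; sym = λ p k → sym (p k) ; trans = λ p q k → trans (p k) (q k) }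
                    ; ∙-cong = λ p q k → +-cong (p k) (q k) }
                  ; assoc = λ f g h k → +-assoc _ _ _ }
                ; identity = (λ f k → +-identityˡ _) , (λ f k → +-identityʳ _) }
              ; inverse = (λ f k → -‿inverseˡ _) , (λ f k → -‿inverseʳ _)
              ; ⁻¹-cong = λ p k → -‿cong (p k) }
            ; comm = λ f g k → +-comm _ _ }
          ; *-cong = ⊛-cong
          ; *-assoc = ⊛-assoc
          ; *-identity = ⊛-identityˡ , (λ f k → trans (⊛-comm f (const 1#) k) (⊛-identityˡ f k))
          ; distrib = ⊛-distribˡ , ⊛-distribʳ }
        ; *-comm = ⊛-comm } }

    lin-⊛-suc : ∀ a b f k → (lin a b ⊛ f) (suc k) ≈ a * f (suc k) + b * f k
    lin-⊛-suc a b f k = +-congˡ (trans (⊛-cong shift (λ _ → refl) k) (const-⊛ b f k))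
      where
      shift : lin a b ∘ suc ≋ const b
      shift zero    = refl
      shift (suc _) = refl

    -- The n-th approximation is correct in degrees ≤ n.
    module Inverse (f : Series) (y : Carrier) (f₀y : f 0 * y ≈ 1#) where
      approx : ℕ → Series
      approx zero    j = y
      approx (suc n) zero = y
      approx (suc n) (suc j) = - (y * (f ∘ suc ⊛ approx n) j)

      inv : Series
      inv k = approx k k

      approx-stable : ∀ n m j → j ℕ.≤ n → j ℕ.≤ m → approx n j ≈ approx m j
      approx-stable zero    zero    zero    _ _ = refl
      approx-stable zero    (suc m) zero    _ _ = refl
      approx-stable (suc n) zero    zero    _ _ = refl
      approx-stable (suc n) (suc m) zero    _ _ = refl
      approx-stable (suc n) (suc m) (suc j) (s≤s p) (s≤s q) =
        -‿cong (*-congˡ (⊛-congₖ j (λ a b eq → *-congˡ (approx-stable n m b (ℕₚ.≤-trans (bnd a b eq) p) (ℕₚ.≤-trans (bnd a b eq) q)))))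
        where
        bnd : ∀ a b → a ℕ.+ b ≡ j → b ℕ.≤ j
        bnd a b ≡.refl = ℕₚ.m≤n+m b a

      inverseʳ : f ⊛ inv ≋ const 1#
      inverseʳ zero    = f₀y
      inverseʳ (suc k) = begin
        f 0 * - (y * (f ∘ suc ⊛ approx k) k) + (f ∘ suc ⊛ inv) k
          -- By stability the diagonal value `approx b b` may be replaced by `approx k b` for all b
          -- ≤ k, which produces the product that occurs in the recursion.
          ≈⟨ +-congˡ (⊛-congₖ k (λ a b eq → *-congˡ (approx-stable b k b ℕₚ.≤-refl (≡.subst (b ℕ.≤_) eq (ℕₚ.m≤n+m b a))))) ⟩
        f 0 * - (y * c) + c      ≈⟨ solve 3 (λ a b c → a :* :- (b :* c) :+ c := :- (a :* b :* c) :+ c) refl _ _ _ ⟩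
        - (f 0 * y * c) + c      ≈⟨ +-congʳ (-‿cong (*-congʳ f₀y)) ⟩
        - (1# * c) + c           ≈⟨ solve 1 (λ c → :- (con (+ 1) :* c) :+ c := con (+ 0)) refl _ ⟩
        0#                       ∎
        where c = (f ∘ suc ⊛ approx k) k

    -- The substitution u ↦ c u. It occurs with c = π in the reduction of the characteristic series,
    -- and with c = -ζ⁻¹ as part of the twisted conjugation.
    module Rescale (c : Carrier) where
      open import Algebra.Properties.Semiring.Exp semiring using (_^_)

      rescale : Series → Series
      rescale f k = c ^ k * f k

      rescale-⊛ : ∀ f g → rescale (f ⊛ g) ≋ rescale f ⊛ rescale g
      rescale-⊛ f g zero    = solve 2 (λ a b → con (+ 1) :* (a :* b) := con (+ 1) :* a :* (con (+ 1) :* b)) refl _ _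
      rescale-⊛ f g (suc k) = begin
        c ^ suc k * (f 0 * g (suc k) + (f ∘ suc ⊛ g) k)
          ≈⟨ solve 5 (λ c p a b d → c :* p :* (a :* b :+ d) := con (+ 1) :* a :* (c :* p :* b) :+ c :* (p :* d)) refl c (c ^ k) _ _ _ ⟩
        1# * f 0 * (c ^ suc k * g (suc k)) + c * (c ^ k * (f ∘ suc ⊛ g) k)
          ≈⟨ +-congˡ (*-congˡ (rescale-⊛ (f ∘ suc) g k)) ⟩
        1# * f 0 * (c ^ suc k * g (suc k)) + c * (rescale (f ∘ suc) ⊛ rescale g) k
          ≈⟨ +-congˡ (⊛-scaleˡ c (rescale (f ∘ suc)) (rescale g) k) ⟨
        1# * f 0 * (c ^ suc k * g (suc k)) + ((λ k → c * rescale (f ∘ suc) k) ⊛ rescale g) k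
          ≈⟨ +-congˡ (⊛-cong (λ k → sym (*-assoc _ _ _)) (λ _ → refl) k) ⟩
        (rescale f ⊛ rescale g) (suc k) ∎

-- Determinants over a commutative ring

module Determinant where
  open RingPreliminaries
  open import Data.Product.Base using (Σ-syntax)
  open import Data.Vec.Functional using (_∷_; tail; updateAt)
  open import Data.Vec.Functional.Properties using (updateAt-updates; updateAt-minimal)
  open import Function.Base using (_∘_)

  module DeterminantTheory (R : CRing) where
    open CommutativeRing R hiding (zero)
    open import Algebra.Properties.Ring ring using (-0#≈0#)
    open Solver R using (solve; _:=_; _:+_; _:*_; :-_; con)
    open import Relation.Binary.Reasoning.Setoid setoid

    Row : ℕ → Set
    Row n = Fin n → Carrier

    Mat : ℕ → Set
    Mat n = Fin n → Row n

    private module D = Det 0# 1# _+_ _*_ -_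

    opaque
      altSum : ∀ n → Row n → Carrier
      altSum = D.altSum

      altSum-[] : ∀ f → altSum 0 f ≈ 0#
      altSum-[] f = refl

      altSum-∷ : ∀ n (f : Row (suc n)) → altSum (suc n) f ≈ f zero + - altSum n (λ i → f (suc i))
      altSum-∷ n f = refl

      altSum-cong : ∀ n {f g : Row n} → (∀ i → f i ≈ g i) → altSum n f ≈ altSum n g
      altSum-cong zero    p = refl
      altSum-cong (suc n) p = +-cong (p zero) (-‿cong (altSum-cong n (p ∘ suc)))

      altSum-linear : ∀ n a b (f g : Row n) → altSum n (λ i → a * f i + b * g i) ≈ a * altSum n f + b * altSum n g
      altSum-linear zero    a b f g = solve 2 (λ a b → con (+ 0) := a :* con (+ 0) :+ b :* con (+ 0)) refl a b
      altSum-linear (suc n) a b f g = trans (+-congˡ (-‿cong (altSum-linear n a b (f ∘ suc) (g ∘ suc))))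
        (solve 6 (λ a b x y s t → a :* x :+ b :* y :+ :- (a :* s :+ b :* t) := a :* (x :+ :- s) :+ b :* (y :+ :- t)) refl a b _ _ _ _)

      altSum-zero : ∀ n {f : Row n} → (∀ i → f i ≈ 0#) → altSum n f ≈ 0#
      altSum-zero zero    p = refl
      altSum-zero (suc n) p = trans (+-cong (p zero) (trans (-‿cong (altSum-zero n (p ∘ suc))) -0#≈0#)) (+-identityˡ _)

    altSum-head : ∀ n {f : Row (suc n)} → (∀ i → f (suc i) ≈ 0#) → altSum (suc n) f ≈ f zero
    altSum-head n p = trans (altSum-∷ n _) (trans (+-congˡ (trans (-‿cong (altSum-zero n p)) -0#≈0#)) (+-identityʳ _))

    *-altSum : ∀ n a (f : Row n) → a * altSum n f ≈ altSum n (λ i → a * f i)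
    *-altSum n a f = begin
      a * altSum n f                        ≈⟨ solve 2 (λ a s → a :* s := a :* s :+ con (+ 0) :* s) refl a _ ⟩
      a * altSum n f + 0# * altSum n f      ≈⟨ altSum-linear n a 0# f f ⟨
      altSum n (λ i → a * f i + 0# * f i)   ≈⟨ altSum-cong n (λ i → solve 2 (λ a s → a :* s :+ con (+ 0) :* s := a :* s) refl a (f i)) ⟩
      altSum n (λ i → a * f i)              ∎

    opaque
      unfolding altSum

      altSum-swap : ∀ m n (f : Fin m → Fin n → Carrier) →
        altSum m (λ i → altSum n (f i)) ≈ altSum n (λ j → altSum m (λ i → f i j))
      altSum-swap zero    n f = sym (altSum-zero n (λ _ → refl))
      altSum-swap (suc m) n f = begin
        altSum n (f zero) + - altSum m (λ i → altSum n (f (suc i)))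
          ≈⟨ +-congˡ (-‿cong (altSum-swap m n (f ∘ suc))) ⟩
        altSum n (f zero) + - altSum n (λ j → altSum m (λ i → f (suc i) j))
          ≈⟨ solve 2 (λ a b → a :+ :- b := con (+ 1) :* a :+ :- con (+ 1) :* b) refl _ _ ⟩
        1# * altSum n (f zero) + - 1# * altSum n (λ j → altSum m (λ i → f (suc i) j))
          ≈⟨ altSum-linear n _ _ _ _ ⟨
        altSum n (λ j → 1# * f zero j + - 1# * altSum m (λ i → f (suc i) j))
          ≈⟨ altSum-cong n (λ j → solve 2 (λ a b → con (+ 1) :* a :+ :- con (+ 1) :* b := a :+ :- b) refl _ _) ⟩
        altSum n (λ j → altSum (suc m) (λ i → f i j)) ∎

    opaque
      unfolding altSum

      det : ∀ n → Mat n → Carrier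
      det = D.det

      det-unfold : ∀ n M → det n M ≈ D.det n M
      det-unfold n M = refl

      det-[] : ∀ M → det 0 M ≈ 1#
      det-[] M = refl

      det-row : ∀ n (M : Mat (suc n)) → det (suc n) M ≈ altSum (suc n) (λ j → M zero j * det n (λ a b → M (suc a) (punchIn j b)))
      det-row n M = refl

    det-cong : ∀ n {A B : Mat n} → (∀ i j → A i j ≈ B i j) → det n A ≈ det n B
    det-cong zero    p = trans (det-[] _) (sym (det-[] _))
    det-cong (suc n) p = trans (det-row n _) (trans (altSum-cong (suc n) (λ j → *-cong (p zero j) (det-cong n (λ a b → p (suc a) (punchIn j b))))) (sym (det-row n _)))

    -- The first terms of the two expansions coincide. In the others each minor is expanded along
    -- its first column by induction, and the two alternating sums are exchanged.
    det-column : ∀ n (M : Mat (suc n)) →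
      det (suc n) M ≈ altSum (suc n) (λ i → M i zero * det n (λ a b → M (punchIn i a) (suc b)))
    det-column zero    M = trans (det-row 0 M) (altSum-cong 1 (λ { zero → *-congˡ (trans (det-[] _) (sym (det-[] _))) }))
    det-column (suc n) M = trans (trans (det-row _ M) (altSum-∷ _ _)) (trans (+-congˡ (-‿cong (begin
      altSum (suc n) (λ j → x j * det (suc n) (λ a b → M (suc a) (punchIn (suc j) b)))
        ≈⟨ altSum-cong (suc n) (λ j → *-congˡ (det-column n (λ a b → M (suc a) (punchIn (suc j) b)))) ⟩
      altSum (suc n) (λ j → x j * altSum (suc n) (λ i → y i * D i j))
        ≈⟨ altSum-cong (suc n) (λ j → *-altSum (suc n) (x j) _) ⟩
      altSum (suc n) (λ j → altSum (suc n) (λ i → x j * (y i * D i j)))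
        ≈⟨ altSum-swap (suc n) (suc n) _ ⟩
      altSum (suc n) (λ i → altSum (suc n) (λ j → x j * (y i * D i j)))
        ≈⟨ altSum-cong (suc n) (λ i → trans (altSum-cong (suc n) (λ j →
             solve 3 (λ a b c → a :* (b :* c) := b :* (a :* c)) refl (x j) (y i) (D i j))) (sym (*-altSum (suc n) (y i) _))) ⟩
      altSum (suc n) (λ i → y i * altSum (suc n) (λ j → x j * D i j))
        ≈⟨ altSum-cong (suc n) (λ i → *-congˡ (det-row n (λ a b → M (punchIn (suc i) a) (suc b)))) ⟨
      altSum (suc n) (λ i → y i * det (suc n) (λ a b → M (punchIn (suc i) a) (suc b))) ∎))) (sym (altSum-∷ _ _)))
      where
      x y : Fin (suc n) → Carrier
      x j = M zero (suc j)
      y i = M (suc i) zero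
      D : Fin (suc n) → Fin (suc n) → Carrier
      D i j = det n (λ a b → M (suc (punchIn i a)) (suc (punchIn j b)))

    det-transpose : ∀ n (M : Mat n) → det n (λ i j → M j i) ≈ det n M
    det-transpose zero    M = trans (det-[] _) (sym (det-[] _))
    det-transpose (suc n) M = trans (det-row n _) (trans
      (altSum-cong (suc n) (λ i → *-congˡ (det-transpose n (λ a b → M (punchIn i a) (suc b)))))
      (sym (det-column n M)))

    det-linear : ∀ n i b c (A B C : Mat n) → (∀ j → A i j ≈ b * B i j + c * C i j) →
      (∀ k → k ≢ i → ∀ j → A k j ≈ B k j) → (∀ k → k ≢ i → ∀ j → A k j ≈ C k j) →
      det n A ≈ b * det n B + c * det n C
    det-linear (suc n) zero b c A B C p q r = begin
      det (suc n) A
        ≈⟨ det-row n A ⟩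
      altSum (suc n) (λ j → A zero j * det n (λ k l → A (suc k) (punchIn j l)))
        ≈⟨ altSum-cong (suc n) (λ j → begin
            A zero j * det n (λ k l → A (suc k) (punchIn j l))
              ≈⟨ *-congʳ (p j) ⟩
            (b * B zero j + c * C zero j) * det n (λ k l → A (suc k) (punchIn j l))
              ≈⟨ distribʳ _ _ _ ⟩
            b * B zero j * det n (λ k l → A (suc k) (punchIn j l)) + c * C zero j * det n (λ k l → A (suc k) (punchIn j l))
              ≈⟨ +-cong (trans (*-congˡ (det-cong n (λ k l → q (suc k) (λ ()) _))) (*-assoc _ _ _))
                        (trans (*-congˡ (det-cong n (λ k l → r (suc k) (λ ()) _))) (*-assoc _ _ _)) ⟩
            b * (B zero j * det n (λ k l → B (suc k) (punchIn j l))) + c * (C zero j * det n (λ k l → C (suc k) (punchIn j l))) ∎) ⟩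
      altSum (suc n) (λ j → b * (B zero j * det n (λ k l → B (suc k) (punchIn j l))) + c * (C zero j * det n (λ k l → C (suc k) (punchIn j l))))
        ≈⟨ altSum-linear (suc n) b c _ _ ⟩
      b * altSum (suc n) (λ j → B zero j * det n (λ k l → B (suc k) (punchIn j l))) + c * altSum (suc n) (λ j → C zero j * det n (λ k l → C (suc k) (punchIn j l)))
        ≈⟨ +-cong (*-congˡ (det-row n B)) (*-congˡ (det-row n C)) ⟨
      b * det (suc n) B + c * det (suc n) C ∎
    det-linear (suc n) (suc i) b c A B C p q r = begin
      det (suc n) A
        ≈⟨ det-row n A ⟩
      altSum (suc n) (λ j → A zero j * det n (λ k l → A (suc k) (punchIn j l)))
        ≈⟨ altSum-cong (suc n) (λ j → begin
            A zero j * det n (λ k l → A (suc k) (punchIn j l))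
              ≈⟨ *-congˡ (det-linear n i b c _ (λ k l → B (suc k) (punchIn j l)) (λ k l → C (suc k) (punchIn j l)) (λ l → p (punchIn j l))
                   (λ k k≢i l → q (suc k) (λ { ≡.refl → k≢i ≡.refl }) _) (λ k k≢i l → r (suc k) (λ { ≡.refl → k≢i ≡.refl }) _)) ⟩
            A zero j * (b * _ + c * _)
              ≈⟨ solve 5 (λ x b c y z → x :* (b :* y :+ c :* z) := b :* (x :* y) :+ c :* (x :* z)) refl _ b c _ _ ⟩
            b * (A zero j * _) + c * (A zero j * _)
              ≈⟨ +-cong (*-congˡ (*-congʳ (q zero (λ ()) j))) (*-congˡ (*-congʳ (r zero (λ ()) j))) ⟩
            b * (B zero j * det n (λ k l → B (suc k) (punchIn j l))) + c * (C zero j * det n (λ k l → C (suc k) (punchIn j l))) ∎) ⟩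
      altSum (suc n) (λ j → b * (B zero j * det n (λ k l → B (suc k) (punchIn j l))) + c * (C zero j * det n (λ k l → C (suc k) (punchIn j l))))
        ≈⟨ altSum-linear (suc n) b c _ _ ⟩
      b * altSum (suc n) (λ j → B zero j * det n (λ k l → B (suc k) (punchIn j l))) + c * altSum (suc n) (λ j → C zero j * det n (λ k l → C (suc k) (punchIn j l)))
        ≈⟨ +-cong (*-congˡ (det-row n B)) (*-congˡ (det-row n C)) ⟨
      b * det (suc n) B + c * det (suc n) C ∎

    -- In the column expansion the first two terms have equal entries, equal minors and opposite
    -- signs. Every later minor still contains rows 0 and 1, so induction applies.
    det-alternating₀₁ : ∀ n (M : Mat (suc (suc n))) → (∀ j → M zero j ≈ M (suc zero) j) → det (suc (suc n)) M ≈ 0#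
    det-alternating₀₁ n M p = begin
      det (suc (suc n)) M       ≈⟨ trans (det-column (suc n) M) (trans (altSum-∷ _ _) (+-congˡ (-‿cong (altSum-∷ _ _)))) ⟩
      f₀ + - (f₁ + - altSum n f) ≈⟨ +-cong (*-cong (p zero) (det-cong (suc n) rows)) (-‿cong (+-congˡ (-‿cong (altSum-zero n (rest n M p))))) ⟩
      f₁ + - (f₁ + - 0#)        ≈⟨ solve 1 (λ x → x :+ :- (x :+ :- con (+ 0)) := con (+ 0)) refl f₁ ⟩
      0#                        ∎
      where
      f₀ f₁ : Carrier
      f₀ = M zero zero * det (suc n) (λ a b → M (suc a) (suc b))
      f₁ = M (suc zero) zero * det (suc n) (λ a b → M (punchIn (suc zero) a) (suc b))
      f : Fin n → Carrier
      f i = M (suc (suc i)) zero * det (suc n) (λ a b → M (punchIn (suc (suc i)) a) (suc b))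
      rows : ∀ a b → M (suc a) (suc b) ≈ M (punchIn (suc zero) a) (suc b)
      rows zero    b = sym (p (suc b))
      rows (suc a) b = refl
      rest : ∀ n (M : Mat (suc (suc n))) → (∀ j → M zero j ≈ M (suc zero) j) → ∀ i →
        M (suc (suc i)) zero * det (suc n) (λ a b → M (punchIn (suc (suc i)) a) (suc b)) ≈ 0#
      rest (suc n) M p i = trans (*-congˡ (det-alternating₀₁ n _ (λ j → p (suc j)))) (zeroʳ _)

    private
      withRows : ∀ {n} → Row (suc (suc n)) → Row (suc (suc n)) → Mat (suc (suc n)) → Mat (suc (suc n))
      withRows r s M zero          = r
      withRows r s M (suc zero)    = s
      withRows r s M (suc (suc i)) = M (suc (suc i))

      off₀ : ∀ {n} (r r′ s : Row (suc (suc n))) M k → k ≢ zero → ∀ j → withRows r s M k j ≈ withRows r′ s M k j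
      off₀ r r′ s M zero          ne j = ⊥-elim (ne ≡.refl)
      off₀ r r′ s M (suc zero)    ne j = refl
      off₀ r r′ s M (suc (suc i)) ne j = refl

      off₁ : ∀ {n} (r s s′ : Row (suc (suc n))) M k → k ≢ suc zero → ∀ j → withRows r s M k j ≈ withRows r s′ M k j
      off₁ r s s′ M zero          ne j = refl
      off₁ r s s′ M (suc zero)    ne j = ⊥-elim (ne ≡.refl)
      off₁ r s s′ M (suc (suc i)) ne j = refl

    -- Polarisation: with r + s in both rows the determinant vanishes, and bilinearity leaves D r s
    -- + D s r.
    det-swap₀₁ : ∀ n (M : Mat (suc (suc n))) → det _ M ≈ - det _ (withRows (M (suc zero)) (M zero) M)
    det-swap₀₁ n M = begin
      det _ M                   ≈⟨ det-cong _ same ⟩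
      D r s                     ≈⟨ solve 2 (λ x y → x := (con (+ 0) :+ x :+ (y :+ con (+ 0))) :+ :- y) refl _ _ ⟩
      (0# + D r s + (D s r + 0#)) + - D s r
        ≈⟨ +-congʳ (+-cong (+-congʳ (null r)) (+-congˡ (null s))) ⟨
      (D r r + D r s + (D s r + D s s)) + - D s r
        ≈⟨ +-congʳ (+-cong (lin₁ r) (lin₁ s)) ⟨
      (D r t + D s t) + - D s r
        ≈⟨ +-congʳ lin₀ ⟨
      D t t + - D s r           ≈⟨ +-congʳ (null t) ⟩
      0# + - D s r              ≈⟨ +-identityˡ _ ⟩
      - D s r                   ∎
      where
      r s t : Row (suc (suc n))
      r = M zero
      s = M (suc zero)
      t j = r j + s j
      D : Row (suc (suc n)) → Row (suc (suc n)) → Carrier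
      D a b = det (suc (suc n)) (withRows a b M)
      null : ∀ a → D a a ≈ 0#
      null a = det-alternating₀₁ n (withRows a a M) (λ _ → refl)
      ones : ∀ x y → x + y ≈ 1# * x + 1# * y
      ones x y = sym (+-cong (*-identityˡ x) (*-identityˡ y))
      lin₀ : D t t ≈ D r t + D s t
      lin₀ = trans (det-linear _ zero 1# 1# _ (withRows r t M) (withRows s t M) (λ j → ones _ _) (off₀ t r t M) (off₀ t s t M)) (sym (ones _ _))
      lin₁ : ∀ a → D a t ≈ D a r + D a s
      lin₁ a = trans (det-linear _ (suc zero) 1# 1# _ (withRows a r M) (withRows a s M) (λ j → ones _ _) (off₁ a t r M) (off₁ a t s M)) (sym (ones _ _))
      same : ∀ i j → M i j ≈ withRows r s M i j
      same zero          j = refl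
      same (suc zero)    j = refl
      same (suc (suc i)) j = refl

    det-row0-zero : ∀ n (M : Mat (suc n)) → (∀ j → det n (λ a b → M (suc a) (punchIn j b)) ≈ 0#) → det (suc n) M ≈ 0#
    det-row0-zero n M p = trans (det-row n M) (altSum-zero (suc n) (λ j → trans (*-congˡ (p j)) (zeroʳ _)))

    -- If the equal row is further down, a swap moves row 0 to position 1. Every minor along the new
    -- row 0 then contains both equal rows.
    det-alternating₀ : ∀ n (k : Fin n) (M : Mat (suc n)) → (∀ j → M zero j ≈ M (suc k) j) → det (suc n) M ≈ 0#
    det-alternating₀ (suc n) zero    M p = det-alternating₀₁ n M p
    det-alternating₀ (suc n) (suc k) M p = trans (det-swap₀₁ n M) (trans (-‿cong
      (det-row0-zero (suc n) (withRows (M (suc zero)) (M zero) M) (λ j → det-alternating₀ n k _ (λ l → p (punchIn j l))))) -0#≈0#)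

    det-alternating₁ : ∀ n (k : Fin n) (M : Mat (suc (suc n))) → (∀ j → M (suc zero) j ≈ M (suc (suc k)) j) → det _ M ≈ 0#
    det-alternating₁ n k M p = det-row0-zero (suc n) M (λ j → det-alternating₀ n k _ (λ l → p (punchIn j l)))

    module _ {n : ℕ} (Null : Row n → Set) where
      -- Stated for an arbitrary row-additive `f`, because the induction freezes the first row and
      -- what remains is a function of fewer rows than columns, no longer a determinant of its
      -- argument.
      add-null-rows : ∀ m (f : (Fin m → Row n) → Carrier) →
        (∀ {A B} → (∀ i j → A i j ≈ B i j) → f A ≈ f B) →
        (∀ i {A B C} → (∀ j → A i j ≈ B i j + C i j) → (∀ k → k ≢ i → ∀ j → A k j ≈ B k j) → (∀ k → k ≢ i → ∀ j → A k j ≈ C k j) → f A ≈ f B + f C) →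
        (∀ i {A} → Null (A i) → f A ≈ 0#) →
        ∀ A (z : Fin m → Row n) → (∀ i → Null (z i)) → f (λ i j → A i j + z i j) ≈ f A
      add-null-rows zero    f fc f+ f0 A z Nz = fc (λ ())
      add-null-rows (suc m) f fc f+ f0 A z Nz = begin
        f (λ i j → A i j + z i j)
          ≈⟨ f+ zero {C = z zero ∷ rest} (λ j → refl) off off ⟩
        f (A zero ∷ rest) + f (z zero ∷ rest)
          ≈⟨ +-congˡ (f0 zero (Nz zero)) ⟩
        f (A zero ∷ rest) + 0#
          ≈⟨ +-identityʳ _ ⟩
        f (A zero ∷ rest)
          ≈⟨ add-null-rows m (λ B → f (A zero ∷ B))
               (λ p → fc (λ { zero j → refl ; (suc i) j → p i j }))
               (λ i p q r → f+ (suc i) p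
                  (λ { zero _ j → refl ; (suc k) ne j → q k (λ e → ne (≡.cong suc e)) j })
                  (λ { zero _ j → refl ; (suc k) ne j → r k (λ e → ne (≡.cong suc e)) j }))
               (λ i nul → f0 (suc i) nul) (tail A) (tail z) (λ i → Nz (suc i)) ⟩
        f (A zero ∷ tail A)
          ≈⟨ fc (λ { zero j → refl ; (suc i) j → refl }) ⟩
        f A ∎
        where
        rest : Fin m → Row n
        rest i j = A (suc i) j + z (suc i) j
        off : ∀ {r : Row n} k → k ≢ zero → ∀ j → A k j + z k j ≈ (r ∷ rest) k j
        off zero    ne j = ⊥-elim (ne ≡.refl)
        off (suc k) ne j = refl

    private
      unit-linear : ∀ n i {A B C : Mat n} → (∀ j → A i j ≈ B i j + C i j) →
        (∀ k → k ≢ i → ∀ j → A k j ≈ B k j) → (∀ k → k ≢ i → ∀ j → A k j ≈ C k j) → det n A ≈ det n B + det n C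
      unit-linear n i {A} {B} {C} p q r = trans
        (det-linear n i 1# 1# A B C (λ j → trans (p j) (sym (+-cong (*-identityˡ _) (*-identityˡ _)))) q r)
        (+-cong (*-identityˡ _) (*-identityˡ _))

    Vanishes : ∀ n → Fin n → Fin n → Set
    Vanishes n i k = ∀ (M : Mat n) → (∀ j → M i j ≈ M k j) → det n M ≈ 0#

    det-dependent-row : ∀ n i i′ k → i ≢ k → i′ ≢ k → Vanishes n i k → Vanishes n i′ k →
      ∀ (M : Mat n) a b → (∀ j → M k j ≈ a * M i j + b * M i′ j) → det n M ≈ 0#
    det-dependent-row n i i′ k i≢k i′≢k v v′ M a b p = begin
      det n M
        ≈⟨ det-linear n k a b M (B i) (B i′)
             (λ j → trans (p j) (+-cong (*-congˡ (sym (at i j))) (*-congˡ (sym (at i′ j))))) (off i) (off i′) ⟩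
      a * det n (B i) + b * det n (B i′)
        ≈⟨ +-cong (*-congˡ (v (B i) (λ j → trans (sym (off i i i≢k j)) (sym (at i j)))))
                  (*-congˡ (v′ (B i′) (λ j → trans (sym (off i′ i′ i′≢k j)) (sym (at i′ j))))) ⟩
      a * 0# + b * 0#
        ≈⟨ trans (+-cong (zeroʳ _) (zeroʳ _)) (+-identityˡ _) ⟩
      0# ∎
      where
      B : Fin n → Mat n
      B l = updateAt M k (λ _ → M l)
      at : ∀ l j → B l k j ≈ M l j
      at l j = reflexive (≡.cong (λ r → r j) (updateAt-updates k M))
      off : ∀ l m → m ≢ k → ∀ j → M m j ≈ B l m j
      off l m ne j = reflexive (≡.cong (λ r → r j) (≡.sym (updateAt-minimal m k M ne)))

    det-add-row₀ : ∀ n (M : Mat (suc n)) (c : Fin n → Carrier) →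
      det (suc n) (M zero ∷ λ i j → M (suc i) j + c i * M zero j) ≈ det (suc n) M
    det-add-row₀ n M c = trans
      (add-null-rows (λ r → Σ[ a ∈ Carrier ] (∀ j → r j ≈ a * M zero j)) n (λ B → det (suc n) (M zero ∷ B))
        (λ p → det-cong (suc n) (λ { zero j → refl ; (suc i) j → p i j }))
        (λ i p q r → unit-linear (suc n) (suc i) p
           (λ { zero _ j → refl ; (suc k) ne j → q k (λ e → ne (≡.cong suc e)) j })
           (λ { zero _ j → refl ; (suc k) ne j → r k (λ e → ne (≡.cong suc e)) j }))
        (λ { i {A} (a , p) → det-dependent-row (suc n) zero zero (suc i) (λ ()) (λ ()) (det-alternating₀ n i) (det-alternating₀ n i)
               (M zero ∷ A) a 0# (λ j → trans (p j) (sym (trans (+-congˡ (zeroˡ _)) (+-identityʳ _)))) })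
        (tail M) (λ i j → c i * M zero j) (λ i → c i , λ j → refl))
      (det-cong (suc n) (λ { zero j → refl ; (suc i) j → refl }))

    det-add-rows₀₁ : ∀ n (M : Mat (suc (suc n))) (c d : Fin n → Carrier) →
      det _ (M zero ∷ M (suc zero) ∷ λ i j → M (suc (suc i)) j + (c i * M zero j + d i * M (suc zero) j)) ≈ det _ M
    det-add-rows₀₁ n M c d = trans
      (add-null-rows (λ r → Σ[ a ∈ Carrier ] Σ[ b ∈ Carrier ] (∀ j → r j ≈ a * M zero j + b * M (suc zero) j)) n
        (λ B → det _ (M zero ∷ M (suc zero) ∷ B))
        (λ p → det-cong _ (λ { zero j → refl ; (suc zero) j → refl ; (suc (suc i)) j → p i j }))
        (λ i p q r → unit-linear _ (suc (suc i)) p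
           (λ { zero _ j → refl ; (suc zero) _ j → refl ; (suc (suc k)) ne j → q k (λ e → ne (≡.cong (λ i → suc (suc i)) e)) j })
           (λ { zero _ j → refl ; (suc zero) _ j → refl ; (suc (suc k)) ne j → r k (λ e → ne (≡.cong (λ i → suc (suc i)) e)) j }))
        (λ { i {A} (a , b , p) → det-dependent-row _ zero (suc zero) (suc (suc i)) (λ ()) (λ ())
               (det-alternating₀ (suc n) (suc i)) (det-alternating₁ n i) (M zero ∷ M (suc zero) ∷ A) a b p })
        (λ i → M (suc (suc i))) (λ i j → c i * M zero j + d i * M (suc zero) j) (λ i → c i , d i , λ j → refl))
      (det-cong _ (λ { zero j → refl ; (suc zero) j → refl ; (suc (suc i)) j → refl }))

    det-column-head : ∀ n (M : Mat (suc n)) → (∀ i → M (suc i) zero ≈ 0#) →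
      det (suc n) M ≈ M zero zero * det n (λ i j → M (suc i) (suc j))
    det-column-head n M p = trans (det-column n M)
      (altSum-head n {λ i → M i zero * det n (λ a b → M (punchIn i a) (suc b))} (λ i → trans (*-congʳ (p i)) (zeroˡ _)))

    -- Division is avoided: the multipliers `c` are data, given together with the proof that they
    -- clear the first column.
    schur₁ : ∀ n (M : Mat (suc n)) (c : Fin n → Carrier) → (∀ i → M (suc i) zero + c i * M zero zero ≈ 0#) →
      det (suc n) M ≈ M zero zero * det n (λ i j → M (suc i) (suc j) + c i * M zero (suc j))
    schur₁ n M c p = trans (sym (det-add-row₀ n M c)) (det-column-head n _ p)

    schur₂ : ∀ n (M : Mat (suc (suc n))) (c d : Fin n → Carrier) →
      (∀ i → M (suc (suc i)) zero + (c i * M zero zero + d i * M (suc zero) zero) ≈ 0#) →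
      (∀ i → M (suc (suc i)) (suc zero) + (c i * M zero (suc zero) + d i * M (suc zero) (suc zero)) ≈ 0#) →
      det _ M ≈ (M zero zero * M (suc zero) (suc zero) + - (M (suc zero) zero * M zero (suc zero))) *
        det n (λ i j → M (suc (suc i)) (suc (suc j)) + (c i * M zero (suc (suc j)) + d i * M (suc zero) (suc (suc j))))
    schur₂ n M c d p q = begin
      det _ M            ≈⟨ det-add-rows₀₁ n M c d ⟨
      det _ M′           ≈⟨ trans (det-column (suc n) M′) (trans (altSum-∷ _ _) (+-congˡ (-‿cong (altSum-∷ _ _)))) ⟩
      M zero zero * det (suc n) (λ a b → M′ (suc a) (suc b)) +
        - (M (suc zero) zero * det (suc n) (λ a b → M′ (punchIn (suc zero) a) (suc b)) +
           - altSum n (λ i → M′ (suc (suc i)) zero * det (suc n) (λ a b → M′ (punchIn (suc (suc i)) a) (suc b))))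
        ≈⟨ +-cong (*-congˡ (det-column-head n _ q))
             (-‿cong (+-cong (*-congˡ (det-column-head n _ q))
               (-‿cong (altSum-zero n (λ i → trans (*-congʳ (p i)) (zeroˡ _)))))) ⟩
      M zero zero * (M (suc zero) (suc zero) * N) + - (M (suc zero) zero * (M zero (suc zero) * N) + - 0#)
        ≈⟨ solve 5 (λ a b c d n → a :* (b :* n) :+ :- (c :* (d :* n) :+ :- con (+ 0)) := (a :* b :+ :- (c :* d)) :* n) refl _ _ _ _ _ ⟩
      (M zero zero * M (suc zero) (suc zero) + - (M (suc zero) zero * M zero (suc zero))) * N ∎
      where
      M′ : Mat (suc (suc n))
      M′ = M zero ∷ M (suc zero) ∷ λ i j → M (suc (suc i)) j + (c i * M zero j + d i * M (suc zero) j)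
      N : Carrier
      N = det n (λ i j → M′ (suc (suc i)) (suc (suc j)))

  -- Only the target has to be a ring: the source may be any structure with operations.
  record OperationHom {A : Set} (0A 1A : A) (_⊕_ _⊗_ : A → A → A) (⊖_ : A → A) (R : CRing) : Set where
    open CommutativeRing R
    field
      φ     : A → Carrier
      φ-0   : φ 0A ≈ 0#
      φ-1   : φ 1A ≈ 1#
      φ-+   : ∀ x y → φ (x ⊕ y) ≈ φ x + φ y
      φ-*   : ∀ x y → φ (x ⊗ y) ≈ φ x * φ y
      φ-neg : ∀ x → φ (⊖ x) ≈ - φ x

  module DetHom {A : Set} (0A 1A : A) (_⊕_ _⊗_ : A → A → A) (⊖_ : A → A) (R : CRing) (hom : OperationHom 0A 1A _⊕_ _⊗_ ⊖_ R) where
    open CommutativeRing R hiding (zero)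
    open OperationHom hom
    open DeterminantTheory R
    private module D = Det 0A 1A _⊕_ _⊗_ ⊖_

    φ-altSum : ∀ n (f : Fin n → A) → φ (D.altSum n f) ≈ altSum n (λ i → φ (f i))
    φ-altSum zero    f = trans φ-0 (sym (altSum-[] _))
    φ-altSum (suc n) f = trans (trans (φ-+ _ _) (+-congˡ (trans (φ-neg _) (-‿cong (φ-altSum n (f ∘ suc)))))) (sym (altSum-∷ n _))

    φ-det : ∀ n (M : Fin n → Fin n → A) → φ (D.det n M) ≈ det n (λ i j → φ (M i j))
    φ-det zero    M = trans φ-1 (sym (det-[] _))
    φ-det (suc n) M = trans (φ-altSum (suc n) (λ j → M zero j ⊗ D.det n (λ i k → M (suc i) (punchIn j k)))) (trans (altSum-cong (suc n) (λ j →
      trans (φ-* _ _) (*-congˡ (φ-det n _)))) (sym (det-row n _)))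

-- Hermitian matrices with even diagonal and unit off-diagonal entries

module Hermitian where
  open RingPreliminaries
  open Determinant
  open import Data.Product.Base using (_×_)

  double : ℕ → ℕ
  double zero    = zero
  double (suc m) = suc (suc (double m))

  record IsIdeal (R : CRing) (I : CommutativeRing.Carrier R → Set) : Set where
    open CommutativeRing R
    field
      resp   : ∀ {x y} → x ≈ y → I x → I y
      +-mem  : ∀ {x y} → I x → I y → I (x + y)
      *-mem  : ∀ x {y} → I y → I (x * y)

    neg-mem : ∀ {x} → I x → I (- x)
    neg-mem {x} i = resp (trans (sym (-‿distribˡ-* 1# x)) (-‿cong (*-identityˡ x))) (*-mem (- 1#) i)
      where open import Algebra.Properties.Ring ring using (-‿distribˡ-*)

  -- `𝔞` is the ideal of even elements: it has square zero and contains all traces. `𝔫` is larger,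
  -- and 1 + `𝔫` consists of units. Diagonal entries will lie in `𝔞`, hence are nilpotent and cannot
  -- serve as pivots; this is why 2 × 2 blocks are eliminated.
  record EvenStructure (A : CRing) : Set₁ where
    open CommutativeRing A
    field
      τ        : Carrier → Carrier
      τ-cong   : ∀ {x y} → x ≈ y → τ x ≈ τ y
      τ-1      : τ 1# ≈ 1#
      τ-+      : ∀ x y → τ (x + y) ≈ τ x + τ y
      τ-*      : ∀ x y → τ (x * y) ≈ τ x * τ y
      τ-neg    : ∀ x → τ (- x) ≈ - τ x
      𝔞 𝔫      : Carrier → Set
      𝔞-ideal  : IsIdeal A 𝔞
      𝔫-ideal  : IsIdeal A 𝔫
      𝔞⊆𝔫      : ∀ {x} → 𝔞 x → 𝔫 x
      𝔞²≈0     : ∀ {x y} → 𝔞 x → 𝔞 y → x * y ≈ 0#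
      trace∈𝔞  : ∀ x → 𝔞 (x + τ x)
      invert   : ∀ {x} → 𝔫 (x + - 1#) → ∃ λ y → x * y ≈ 1#

  -- A matrix that is Hermitian for τ, with diagonal in 𝔞 and all other entries 1 modulo 𝔫, is reduced
  -- by splitting off hyperbolic planes: the Schur complement of its leading 2 × 2 block has the same shape.
  module EvenHermitian (A : CRing) (structure : EvenStructure A) where
    open CommutativeRing A hiding (zero)
    open EvenStructure structure
    open Solver A using (solve; _:=_; _:+_; _:*_; :-_; con)
    open import Relation.Binary.Reasoning.Setoid setoid
    open DeterminantTheory A
    private
      module 𝔞 = IsIdeal 𝔞-ideal
      module 𝔫 = IsIdeal 𝔫-ideal

    infix 4 _~1
    _~1 : Carrier → Set
    x ~1 = 𝔫 (x + - 1#)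

    1~1 : 1# ~1
    1~1 = 𝔫.resp (solve 1 (λ x → con (+ 0) :* x := con (+ 1) :+ :- con (+ 1)) refl (1# + τ 1#)) (𝔫.*-mem 0# (𝔞⊆𝔫 (trace∈𝔞 1#)))

    *-~1 : ∀ {x y} → x ~1 → y ~1 → x * y ~1
    *-~1 {x} {y} p q = 𝔫.resp
      (solve 2 (λ x y → x :* (y :+ :- con (+ 1)) :+ (x :+ :- con (+ 1)) := x :* y :+ :- con (+ 1)) refl x y)
      (𝔫.+-mem (𝔫.*-mem x q) p)

    record Even {n} (M : Mat n) : Set where
      field
        herm : ∀ i j → τ (M i j) ≈ M j i
        diag : ∀ i → 𝔞 (M i i)
        off  : ∀ i j → i ≢ j → M i j ~1

    module Step {n} {M : Mat (suc (suc n))} (ev : Even M) where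
      open Even ev
      private
        z₁ : Fin (suc (suc n))
        z₁ = suc zero
        a b c c′ : Carrier
        a = M zero zero
        b = M z₁ z₁
        c = M zero z₁
        c′ = M z₁ zero
        x₀ x₁ y₀ y₁ : Fin n → Carrier
        x₀ i = M (suc (suc i)) zero
        x₁ i = M (suc (suc i)) z₁
        y₀ i = M zero (suc (suc i))
        y₁ i = M z₁ (suc (suc i))
        c~1 : c ~1
        c~1 = off zero z₁ (λ ())
        c′~1 : c′ ~1
        c′~1 = off z₁ zero (λ ())
        inv : ∃ λ w → c * c′ * w ≈ 1#
        inv = invert (*-~1 c~1 c′~1)
        w : Carrier
        w = proj₁ inv
        -- As `𝔞` has square zero, the determinant of the pivot block is -c c′, a unit.
        ab≈0 : a * b ≈ 0#
        ab≈0 = 𝔞²≈0 (diag zero) (diag z₁)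
        -- c c′ = c τ(c) is fixed by τ, hence so is its inverse.
        τw : τ w ≈ w
        τw = begin
          τ w                    ≈⟨ *-identityʳ _ ⟨
          τ w * 1#               ≈⟨ *-congˡ (proj₂ inv) ⟨
          τ w * (c * c′ * w)     ≈⟨ solve 4 (λ t c d w → t :* (c :* d :* w) := (d :* c :* t) :* w) refl _ _ _ _ ⟩
          (c′ * c * τ w) * w     ≈⟨ *-congʳ (*-congʳ (*-cong (herm zero z₁) (herm z₁ zero))) ⟨
          (τ c * τ c′ * τ w) * w ≈⟨ *-congʳ (trans (τ-* _ _) (*-congʳ (τ-* _ _))) ⟨
          τ (c * c′ * w) * w     ≈⟨ *-congʳ (trans (τ-cong (proj₂ inv)) τ-1) ⟩
          1# * w                 ≈⟨ *-identityˡ _ ⟩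
          w                      ∎

        -- Cramer's rule for the block with rows (a, c) and (c′, b); `w` is -1 divided by its
        -- determinant.
        α β : Fin n → Carrier
        α i = w * (x₀ i * b + - (x₁ i * c′))
        β i = w * (a * x₁ i + - (c * x₀ i))

      complement : Mat n
      complement i j = M (suc (suc i)) (suc (suc j)) + (α i * y₀ j + β i * y₁ j)

      private
        clear₀ : ∀ i → x₀ i + (α i * a + β i * c′) ≈ 0#
        clear₀ i = begin
          x₀ i + (α i * a + β i * c′)
            ≈⟨ solve 7 (λ w x y a b c d → x :+ (w :* (x :* b :+ :- (y :* d)) :* a :+ w :* (a :* y :+ :- (c :* x)) :* d) :=
                 x :* (con (+ 1) :+ :- (c :* d :* w)) :+ w :* x :* (a :* b)) refl w (x₀ i) (x₁ i) a b c c′ ⟩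
          x₀ i * (1# + - (c * c′ * w)) + w * x₀ i * (a * b)
            ≈⟨ +-cong (*-congˡ (+-congˡ (-‿cong (proj₂ inv)))) (*-congˡ ab≈0) ⟩
          x₀ i * (1# + - 1#) + w * x₀ i * 0#
            ≈⟨ solve 2 (λ x w → x :* (con (+ 1) :+ :- con (+ 1)) :+ w :* x :* con (+ 0) := con (+ 0)) refl (x₀ i) w ⟩
          0# ∎

        clear₁ : ∀ i → x₁ i + (α i * c + β i * b) ≈ 0#
        clear₁ i = begin
          x₁ i + (α i * c + β i * b)
            ≈⟨ solve 7 (λ w x y a b c d → y :+ (w :* (x :* b :+ :- (y :* d)) :* c :+ w :* (a :* y :+ :- (c :* x)) :* b) :=
                 y :* (con (+ 1) :+ :- (c :* d :* w)) :+ w :* y :* (a :* b)) refl w (x₀ i) (x₁ i) a b c c′ ⟩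
          x₁ i * (1# + - (c * c′ * w)) + w * x₁ i * (a * b)
            ≈⟨ +-cong (*-congˡ (+-congˡ (-‿cong (proj₂ inv)))) (*-congˡ ab≈0) ⟩
          x₁ i * (1# + - 1#) + w * x₁ i * 0#
            ≈⟨ solve 2 (λ x w → x :* (con (+ 1) :+ :- con (+ 1)) :+ w :* x :* con (+ 0) := con (+ 0)) refl (x₁ i) w ⟩
          0# ∎

      pivot : Carrier
      pivot = c

      pivot~1 : pivot ~1
      pivot~1 = c~1

      det-complement : det _ M ≈ - (pivot * τ pivot) * det n complement
      det-complement = begin
        det _ M                                    ≈⟨ schur₂ n M α β clear₀ clear₁ ⟩
        (a * b + - (c′ * c)) * det n complement    ≈⟨ *-congʳ (+-cong ab≈0 (-‿cong (*-comm _ _))) ⟩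
        (0# + - (c * c′)) * det n complement       ≈⟨ *-congʳ (trans (+-identityˡ _) (-‿cong (*-congˡ (sym (herm zero z₁))))) ⟩
        - (c * τ c) * det n complement             ∎

      private
        -- The correction is grouped so that τ carries each of the first two terms at (i, j) to its
        -- counterpart at (j, i) and exchanges c r with c′ s. On the diagonal c r + c′ s is then a
        -- trace and lies in `𝔞`; off the diagonal it is 1 + 1 modulo `𝔫`, the trace of 1.
        core : (p q r s : Carrier) → Carrier
        core p q r s = (b * p + a * q) + - (c * r + c′ * s)

        reduced : Mat n
        reduced i j = M (suc (suc i)) (suc (suc j)) + w * core (x₀ i * y₀ j) (x₁ i * y₁ j) (x₀ i * y₁ j) (x₁ i * y₀ j)

        α-* : ∀ x y p → w * (x * b + - (y * c′)) * p ≈ w * (b * (x * p) + - (c′ * (y * p)))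
        α-* x y p = solve 6 (λ w b d x y p → w :* (x :* b :+ :- (y :* d)) :* p := w :* (b :* (x :* p) :+ :- (d :* (y :* p)))) refl w b c′ x y p

        β-* : ∀ x y p → w * (a * y + - (c * x)) * p ≈ w * (a * (y * p) + - (c * (x * p)))
        β-* x y p = solve 6 (λ w a c x y p → w :* (a :* y :+ :- (c :* x)) :* p := w :* (a :* (y :* p) :+ :- (c :* (x :* p)))) refl w a c x y p

        reduce : ∀ i j → complement i j ≈ reduced i j
        reduce i j = +-congˡ (trans (+-cong (α-* (x₀ i) (x₁ i) (y₀ j)) (β-* (x₀ i) (x₁ i) (y₁ j)))
          (solve 5 (λ w p q r s → w :* (p :+ :- s) :+ w :* (q :+ :- r) := w :* ((p :+ q) :+ :- (r :+ s))) refl w _ _ _ _))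

        τ-entries : ∀ i j k l → τ (M i j * M k l) ≈ M l k * M j i
        τ-entries i j k l = trans (τ-* _ _) (trans (*-cong (herm i j) (herm k l)) (*-comm _ _))

        τ-reduced : ∀ i j → τ (reduced i j) ≈ reduced j i
        τ-reduced i j = trans (τ-+ _ _) (+-cong (herm _ _) (trans (τ-* _ _) (*-cong τw (trans (τ-+ _ _) (+-cong
          (trans (τ-+ _ _) (+-cong prod prod))
          (trans (τ-neg _) (-‿cong (trans (τ-+ _ _) (trans (+-cong prod prod) (+-comm _ _))))))))))
          where
          prod : ∀ {k′ l′ k″ l″} → τ (M k′ l′ * (M (suc (suc i)) k″ * M l″ (suc (suc j)))) ≈ M l′ k′ * (M (suc (suc j)) l″ * M k″ (suc (suc i)))
          prod = trans (τ-* _ _) (*-cong (herm _ _) (τ-entries _ _ _ _))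

      complement-even : Even complement
      complement-even = record
        { herm = λ i j → trans (τ-cong (reduce i j)) (trans (τ-reduced i j) (sym (reduce j i)))
        ; diag = λ i → 𝔞.resp (sym (reduce i i))
            (𝔞.+-mem (diag (suc (suc i))) (𝔞.*-mem w (𝔞.+-mem
              (𝔞.+-mem (𝔞.resp (*-comm _ _) (𝔞.*-mem (x₀ i * y₀ i) (diag z₁))) (𝔞.resp (*-comm _ _) (𝔞.*-mem (x₁ i * y₁ i) (diag zero))))
              (𝔞.neg-mem (𝔞.resp (+-congˡ (trans (τ-* _ _) (*-cong (herm zero z₁) (τ-entries _ _ _ _)))) (trace∈𝔞 (c * (x₀ i * y₁ i))))))))
        ; off = λ i j i≢j → 𝔫.resp
            (trans (trans (+-congˡ (*-congˡ (+-congˡ (-‿cong (+-congˡ (+-congˡ (+-congˡ τ-1)))))))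
            (solve 5 (λ m w e r s →
              (m :+ :- con (+ 1)) :+ w :* (e :+ :- ((r :+ :- con (+ 1)) :+ ((s :+ :- con (+ 1)) :+ (con (+ 1) :+ con (+ 1))))) :=
              m :+ w :* (e :+ :- (r :+ s)) :+ :- con (+ 1)) refl _ w _ _ _)) (+-congʳ (sym (reduce i j))))
            (𝔫.+-mem (off _ _ (λ { ≡.refl → i≢j ≡.refl })) (𝔫.*-mem w (𝔫.+-mem
              (𝔫.+-mem (𝔫.resp (*-comm _ _) (𝔫.*-mem (x₀ i * y₀ j) (𝔞⊆𝔫 (diag z₁)))) (𝔫.resp (*-comm _ _) (𝔫.*-mem (x₁ i * y₁ j) (𝔞⊆𝔫 (diag zero)))))
              (𝔫.neg-mem (𝔫.+-mem (*-~1 c~1 (*-~1 (off _ _ (λ ())) (off _ _ (λ ()))))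
                (𝔫.+-mem (*-~1 c′~1 (*-~1 (off _ _ (λ ())) (off _ _ (λ ())))) (𝔞⊆𝔫 (trace∈𝔞 1#))))))))
        }

    sign : ℕ → Carrier
    sign zero    = 1#
    sign (suc m) = - sign m

    -- P is the product of the pivots. Each hyperbolic plane contributes -c τ(c), and the m minus
    -- signs are collected in `sign m`.
    det-even : ∀ m {M : Mat (double m)} → Even M → ∃ λ P → P ~1 × det _ M ≈ sign m * (P * τ P)
    det-even zero {M} ev = 1# , 1~1 , trans (det-[] M) (sym (trans (*-identityˡ _) (trans (*-identityˡ _) τ-1)))
    det-even (suc m) {M} ev = extend (det-even m complement-even)
      where
      open Step ev
      extend : (∃ λ P → P ~1 × det _ complement ≈ sign m * (P * τ P)) → ∃ λ P → P ~1 × det _ M ≈ sign (suc m) * (P * τ P)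
      extend (P , P~1 , eq) = pivot * P , *-~1 pivot~1 P~1 , (begin
        det _ M                                                  ≈⟨ det-complement ⟩
        - (pivot * τ pivot) * det _ complement                   ≈⟨ *-congˡ eq ⟩
        - (pivot * τ pivot) * (sign m * (P * τ P))
          ≈⟨ solve 5 (λ c d s p q → :- (c :* d) :* (s :* (p :* q)) := :- s :* (c :* p :* (d :* q))) refl _ _ _ _ _ ⟩
        - sign m * (pivot * P * (τ pivot * τ P))                 ≈⟨ *-congˡ (*-congˡ (τ-* _ _)) ⟨
        sign (suc m) * (pivot * P * τ (pivot * P))               ∎)

    -- After m planes a single diagonal entry is left, and it lies in `𝔞`.
    det-odd : ∀ m {M : Mat (suc (double m))} → Even M → 𝔞 (det _ M)
    det-odd zero {M} ev = 𝔞.resp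
      (sym (trans (det-row 0 M) (trans (altSum-head 0 (λ ())) (trans (*-congˡ (det-[] _)) (*-identityʳ _))))) (Even.diag ev zero)
    det-odd (suc m) {M} ev = 𝔞.resp (sym det-complement) (𝔞.*-mem _ (det-odd m complement-even))
      where open Step ev

-- The series det (I - uT) and its reduction to the core

module Pencil where
  open RingPreliminaries
  open PowerSeries
  open Determinant
  open import Data.Bool.Base using (if_then_else_)
  open import Data.Vec.Functional using (_∷_)

  module Kronecker (R : CRing) where
    open CommutativeRing R hiding (zero)

    δ : ∀ {n} → Fin n → Fin n → Carrier
    δ i j = if does (i ≟ j) then 1# else 0#

    δ-diag : ∀ {n} (i : Fin n) → δ i i ≈ 1#
    δ-diag zero    = refl
    δ-diag (suc i) = δ-diag i

    δ-off : ∀ {n} (i j : Fin n) → i ≢ j → δ i j ≈ 0#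
    δ-off zero    zero    ne = ⊥-elim (ne ≡.refl)
    δ-off zero    (suc j) ne = refl
    δ-off (suc i) zero    ne = refl
    δ-off (suc i) (suc j) ne = δ-off i j (λ e → ne (≡.cong suc e))

  module CharacteristicSeries (U : CRing) where
    open CommutativeRing U hiding (zero)
    open Kronecker U
    open PS U
    open Solver U using (solve; _:=_; _:+_; _:*_; :-_; con)
    private
      module S = CommutativeRing series
      module DS = DeterminantTheory series
    open DS using (det)

    lin-cong : ∀ {a a′ b b′} → a ≈ a′ → b ≈ b′ → lin a b ≋ lin a′ b′
    lin-cong p q zero          = p
    lin-cong p q (suc zero)    = q
    lin-cong p q (suc (suc k)) = refl

    lin-+const* : ∀ a b c d e → lin a b ⊞ (const c ⊛ lin d e) ≋ lin (a + c * d) (b + c * e)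
    lin-+const* a b c d e zero          = refl
    lin-+const* a b c d e (suc zero)    = +-congˡ (const-⊛ c (lin d e) 1)
    lin-+const* a b c d e (suc (suc k)) = trans (+-congˡ (trans (const-⊛ c (lin d e) (suc (suc k))) (zeroʳ c))) (+-identityˡ _)

    charSeries : ∀ n → (Fin n → Fin n → Carrier) → Series
    charSeries n T = det n (λ i j → lin (δ i j) (- T i j))

    module Core (n : ℕ) (T : Fin (suc n) → Fin (suc n) → Carrier) (B : Fin n → Fin n → Carrier) where
      core : Fin n → Fin n → Series
      core i j = lin (δ i j + T (suc i) zero * T zero (suc j)) (B i j)

      bordered : Fin (suc n) → Fin (suc n) → Series
      bordered zero    zero    = const 0#
      bordered zero    (suc j) = const (- T zero (suc j))
      bordered (suc i) zero    = const (- T (suc i) zero)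
      bordered (suc i) (suc j) = core i j

      coreDet borderedDet : Series
      coreDet     = det n core
      borderedDet = det (suc n) bordered

    module Reduction (π : Carrier) (n : ℕ) (T : Fin (suc n) → Fin (suc n) → Carrier) (B : Fin n → Fin n → Carrier)
      (T₀₀ : T zero zero ≈ 1#) (πB : ∀ i j → π * B i j ≈ T (suc i) zero * T zero (suc j) + - T (suc i) (suc j)) where
      open Rescale π
      open Core n T B public

      private
        X X₁ X₂ᵗ Y Y′ Z : Fin (suc n) → Fin (suc n) → Series
        X i j = lin (δ i j) (- T i j)
        X₁ = X zero ∷ λ i j → X (suc i) j ⊞ (const (- T (suc i) zero) ⊛ X zero j)
        X₂ᵗ = (λ i → X₁ i zero) ∷ λ j i → X₁ i (suc j) ⊞ (const (- T zero (suc j)) ⊛ X₁ i zero)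
        Y zero    zero = lin 1# (- 1#)
        Y zero    (suc j) = rescale (bordered zero (suc j))
        Y (suc i) j       = rescale (bordered (suc i) j)
        Y′ zero    zero    = lin 1# (- 1#)
        Y′ zero    (suc j) = λ _ → 0#
        Y′ (suc i) j       = rescale (bordered (suc i) j)
        Z i j = rescale (bordered i j)

        rescale-const : ∀ a → rescale (const a) ≋ lin a 0#
        rescale-const a zero          = *-identityˡ _
        rescale-const a (suc zero)    = zeroʳ _
        rescale-const a (suc (suc k)) = zeroʳ _

        rescale-lin : ∀ a b → rescale (lin a b) ≋ lin a (π * b)
        rescale-lin a b zero          = *-identityˡ _
        rescale-lin a b (suc zero)    = *-congʳ (*-identityʳ π)
        rescale-lin a b (suc (suc k)) = zeroʳ _

        X₁-suc : ∀ i j → X₁ (suc i) j ≋ lin (δ (suc i) j + - T (suc i) zero * δ zero j) (- T (suc i) j + - T (suc i) zero * - T zero j)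
        X₁-suc i j = lin-+const* _ _ _ _ _

        X₂-entries : ∀ i j → X₂ᵗ j i ≋ Y i j
        X₂-entries zero zero = lin-cong refl (-‿cong T₀₀)
        X₂-entries zero (suc j) = S.trans (lin-+const* _ _ _ _ _) (S.trans (lin-cong
          (solve 1 (λ t → con (+ 0) :+ :- t :* con (+ 1) := :- t) refl _)
          (trans (+-congˡ (*-congˡ (-‿cong T₀₀))) (solve 1 (λ t → :- t :+ :- t :* :- con (+ 1) := con (+ 0)) refl _)))
          (S.sym (rescale-const _)))
        X₂-entries (suc i) zero = S.trans (X₁-suc i zero) (S.trans (lin-cong
          (solve 1 (λ t → con (+ 0) :+ :- t :* con (+ 1) := :- t) refl _)
          (trans (+-congˡ (*-congˡ (-‿cong T₀₀))) (solve 1 (λ t → :- t :+ :- t :* :- con (+ 1) := con (+ 0)) refl _)))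
          (S.sym (rescale-const _)))
        X₂-entries (suc i) (suc j) = S.trans
          (S.+-cong (X₁-suc i (suc j)) (S.*-cong (S.refl {const (- T zero (suc j))}) (S.trans (X₂-entries (suc i) zero) (rescale-const _))))
          (S.trans (lin-+const* _ _ _ _ _) (S.trans (lin-cong
            (solve 3 (λ d s t → (d :+ :- s :* con (+ 0)) :+ :- t :* :- s := d :+ s :* t) refl _ _ _)
            (trans (solve 3 (λ m s t → (:- m :+ :- s :* :- t) :+ :- t :* con (+ 0) := s :* t :+ :- m) refl _ _ _) (sym (πB i j))))
            (S.sym (rescale-lin _ _))))

      private
        rescale-cong-0 : rescale (λ _ → 0#) ≋ (λ _ → 0#)
        rescale-cong-0 k = zeroʳ _
        rescale-1 : rescale (const 1#) ≋ const 1#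
        rescale-1 zero    = *-identityˡ _
        rescale-1 (suc k) = zeroʳ _
        open import Algebra.Properties.Ring ring using (-‿distribʳ-*)
        rescaleHom : OperationHom S.0# S.1# S._+_ S._*_ S.-_ series
        rescaleHom = record
          { φ = rescale ; φ-0 = rescale-cong-0 ; φ-1 = rescale-1 ; φ-+ = λ f g k → distribˡ _ _ _
          ; φ-* = rescale-⊛ ; φ-neg = λ f k → sym (-‿distribʳ-* _ _) }
        module H = DetHom S.0# S.1# S._+_ S._*_ S.-_ series rescaleHom
        rescale-det : ∀ m M → rescale (det m M) S.≈ det m (λ i j → rescale (M i j))
        rescale-det m M = S.trans (λ k → *-congˡ (DS.det-unfold m M k)) (H.φ-det m M)

      -- Subtracting multiples of row 0 and of column 0 turns both borders into the constants -T,
      -- while the inner block becomes the core with u replaced by π u. Constants are fixed by that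
      -- substitution, so everything except the corner 1 - u is rescaled. Additivity in row 0
      -- separates this corner from the bordered determinant, whose corner is 0.
      reduction : charSeries (suc n) T ≋ (lin 1# (- 1#) ⊛ rescale coreDet) ⊞ rescale borderedDet
      reduction = begin
        det (suc n) X                    ≈⟨ DS.det-add-row₀ n X (λ i → const (- T (suc i) zero)) ⟨
        det (suc n) X₁                   ≈⟨ DS.det-transpose (suc n) X₁ ⟨
        det (suc n) (λ i j → X₁ j i)     ≈⟨ DS.det-add-row₀ n (λ i j → X₁ j i) (λ j → const (- T zero (suc j))) ⟨
        det (suc n) X₂ᵗ                  ≈⟨ DS.det-cong (suc n) (λ i j → X₂-entries j i) ⟩
        det (suc n) (λ i j → Y j i)      ≈⟨ DS.det-transpose (suc n) Y ⟩
        det (suc n) Y                    ≈⟨ DS.det-linear (suc n) zero S.1# S.1# Y Y′ Z row₀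
                                              (λ { zero ne → ⊥-elim (ne ≡.refl) ; (suc k) ne j → S.refl })
                                              (λ { zero ne → ⊥-elim (ne ≡.refl) ; (suc k) ne j → S.refl }) ⟩
        S.1# ⊛ det (suc n) Y′ ⊞ S.1# ⊛ det (suc n) Z
                                         ≈⟨ S.+-cong (S.*-identityˡ _) (S.*-identityˡ _) ⟩
        det (suc n) Y′ ⊞ det (suc n) Z   ≈⟨ S.+-cong top (S.sym (rescale-det (suc n) bordered)) ⟩
        (lin 1# (- 1#) ⊛ rescale coreDet) ⊞ rescale borderedDet ∎
        where
        open import Relation.Binary.Reasoning.Setoid S.setoid
        row₀ : ∀ j → Y zero j ≋ (S.1# ⊛ Y′ zero j) ⊞ (S.1# ⊛ Z zero j)
        row₀ zero    = S.sym (S.trans (S.+-cong (S.*-identityˡ _) (S.trans (S.*-identityˡ _) (λ k → trans (*-congˡ (const0 k)) (zeroʳ _)))) (S.+-identityʳ _))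
          where
          const0 : ∀ k → const 0# k ≈ 0#
          const0 zero    = refl
          const0 (suc k) = refl
        row₀ (suc j) = S.sym (S.trans (S.+-cong (S.*-identityˡ _) (S.*-identityˡ _)) (S.+-identityˡ _))
        top : det (suc n) Y′ S.≈ lin 1# (- 1#) ⊛ rescale coreDet
        top = S.trans (DS.det-row n Y′) (S.trans (DS.altSum-head n (λ i → S.zeroˡ (det n _)))
          (S.*-congˡ (S.sym (rescale-det n core))))

      open import Algebra.Properties.Semiring.Exp semiring using (_^_)

      -- coefficient k + 1 divided by π ^ k
      quotient : ℕ → Carrier
      quotient k = π * coreDet (suc k) + - coreDet k + π * borderedDet (suc k)

      charSeries-coeff : ∀ k → charSeries (suc n) T (suc k) ≈ π ^ k * quotient k
      charSeries-coeff k = trans (reduction (suc k)) (trans (+-congʳ (lin-⊛-suc 1# (- 1#) (rescale coreDet) k))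
        (solve 5 (λ p q e f b → (con (+ 1) :* (p :* q :* f) :+ :- con (+ 1) :* (q :* e)) :+ p :* q :* b := q :* ((p :* f :+ :- e) :+ p :* b))
          refl π (π ^ k) (coreDet k) (coreDet (suc k)) (borderedDet (suc k))))

-- Coefficients of degree at most two

module LowCoeffs where
  open RingPreliminaries
  open PowerSeries
  open Determinant
  open Pencil

  -- Eliminating one row lowers the u²-coefficient of every remaining diagonal entry by 1.
  module LowDegree (U : CRing) where
    open CommutativeRing U hiding (zero)
    open Kronecker U
    open PS U
    open CharacteristicSeries U
    open import Algebra.Properties.Ring ring using (-0#≈0#)
    open Solver U using (solve; _:=_; _:+_; _:*_; :-_; con)
    private
      module S = CommutativeRing series
      module DS = DeterminantTheory series
    open DS using (det; Mat)

    quadratic : Carrier → Series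
    quadratic c zero                = 1#
    quadratic c (suc zero)          = - 1#
    quadratic c (suc (suc zero))    = c
    quadratic c (suc (suc (suc _))) = 0#

    low : ℕ → Carrier → Series
    low zero    c = const 1#
    low (suc n) c = quadratic c ⊛ low n (c + - 1#)

    infix 4 _≡₃_
    _≡₃_ : Series → Series → Set
    f ≡₃ g = ∀ k → k ≤ 2 → f k ≈ g k

    ⊛-cong₃ : ∀ {f f′ g g′} → f ≡₃ f′ → g ≡₃ g′ → f ⊛ g ≡₃ f′ ⊛ g′
    ⊛-cong₃ p q k k≤2 = ⊛-congₖ k (λ { a b ≡.refl → *-cong (p a (ℕₚ.≤-trans (ℕₚ.m≤m+n a b) k≤2)) (q b (ℕₚ.≤-trans (ℕₚ.m≤n+m b a) k≤2)) })

    -- The shape modulo u³ that survives elimination. Off the diagonal only products of opposite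
    -- entries are controlled; for T these are T_ij T_ji = 1, whatever the roots of unity are.
    record Normalised {n} (c : Carrier) (N : Mat n) : Set where
      field
        diag : ∀ i → N i i ≡₃ quadratic c
        off₀ : ∀ i j → i ≢ j → N i j 0 ≈ 0#
        off₁ : ∀ i j → i ≢ j → N i j 1 * N j i 1 ≈ 1#

    det-normalised : ∀ n {c} {N : Mat n} → Normalised c N → det n N ≡₃ low n c
    det-normalised zero    {N = N} nm k _ = DS.det-[] N k
    det-normalised (suc n) {c} {N} nm k k≤2 = trans
      (DS.schur₁ n N (λ i → S.- (N (suc i) zero ⊛ inv)) clear k)
      (⊛-cong₃ (diag zero) (det-normalised n complement) k k≤2)
      where
      open Normalised nm
      open Inverse (N zero zero) 1# (trans (*-identityʳ _) (diag zero 0 z≤n))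
      clear : ∀ i → N (suc i) zero ⊞ ((S.- (N (suc i) zero ⊛ inv)) ⊛ N zero zero) ≋ S.0#
      clear i = S.trans (S.+-congˡ {N (suc i) zero} (S.trans (lemma (N (suc i) zero) inv (N zero zero)) (S.-‿cong (S.*-congˡ {N (suc i) zero} inverseʳ))))
        (S.trans (S.+-congˡ {N (suc i) zero} (S.-‿cong (S.*-identityʳ _))) (S.-‿inverseʳ _))
        where
        open Solver series using () renaming (solve to solveₛ; _:=_ to _:=ₛ_; _:*_ to _:*ₛ_; :-_ to :-ₛ_)
        lemma : ∀ f g h → ((S.- (f ⊛ g)) ⊛ h) ≋ S.- (f ⊛ (h ⊛ g))
        lemma = solveₛ 3 (λ f g h → (:-ₛ (f :*ₛ g)) :*ₛ h :=ₛ :-ₛ (f :*ₛ (h :*ₛ g))) (λ {_} → S.refl)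
      N″ : Mat n
      N″ i j = N (suc i) (suc j) ⊞ ((S.- (N (suc i) zero ⊛ inv)) ⊛ N zero (suc j))
      module _ (i j : Fin n) where
        private
          f g : Series
          f = N (suc i) zero
          g = N zero (suc j)
          f₀ : f 0 ≈ 0#
          f₀ = off₀ _ _ (λ ())
          g₀ : g 0 ≈ 0#
          g₀ = off₀ _ _ (λ ())
          h₀ : - (f 0 * 1#) ≈ 0#
          h₀ = trans (-‿cong (trans (*-identityʳ _) f₀)) -0#≈0#
        -- Both border entries have constant term 0, so the correction starts in degree 2, with
        -- coefficient -f₁ g₁. On the diagonal this is -1.
        corr₀ : ((S.- (f ⊛ inv)) ⊛ g) 0 ≈ 0#
        corr₀ = trans (*-congˡ g₀) (zeroʳ _)
        corr₁ : ((S.- (f ⊛ inv)) ⊛ g) 1 ≈ 0#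
        corr₁ = trans (+-cong (trans (*-congʳ h₀) (zeroˡ _)) (trans (*-congˡ g₀) (zeroʳ _))) (+-identityˡ _)
        corr₂ : ((S.- (f ⊛ inv)) ⊛ g) 2 ≈ - (f 1 * g 1)
        corr₂ = trans (+-cong (trans (*-congʳ h₀) (zeroˡ _)) (+-cong (*-congʳ (-‿cong (+-congʳ (trans (*-congʳ f₀) (zeroˡ _))))) (trans (*-congˡ g₀) (zeroʳ _))))
          (solve 2 (λ a b → con (+ 0) :+ (:- (con (+ 0) :+ a :* con (+ 1)) :* b :+ con (+ 0)) := :- (a :* b)) refl _ _)
      complement : Normalised (c + - 1#) N″
      complement = record
        { diag = λ
          { i zero       _ → trans (+-cong (diag (suc i) 0 z≤n) (corr₀ i i)) (+-identityʳ _)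
          ; i (suc zero) _ → trans (+-cong (diag (suc i) 1 (s≤s z≤n)) (corr₁ i i)) (+-identityʳ _)
          ; i (suc (suc zero)) _ → +-cong (diag (suc i) 2 (s≤s (s≤s z≤n))) (trans (corr₂ i i) (-‿cong (off₁ (suc i) zero (λ ()))))
          ; i (suc (suc (suc k))) (s≤s (s≤s ())) }
        ; off₀ = λ i j ne → trans (+-cong (off₀ (suc i) (suc j) (λ { ≡.refl → ne ≡.refl })) (corr₀ i j)) (+-identityʳ _)
        ; off₁ = λ i j ne → trans (*-cong (trans (+-congˡ (corr₁ i j)) (+-identityʳ _)) (trans (+-congˡ (corr₁ j i)) (+-identityʳ _)))
                   (off₁ (suc i) (suc j) (λ { ≡.refl → ne ≡.refl })) }

    -- The right-hand side depends on the order alone, so the coefficients of degree 0, 1 and 2 cost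
    -- no digits.
    charSeries-low : ∀ n (T : Fin n → Fin n → Carrier) → (∀ i → T i i ≈ 1#) → (∀ i j → i ≢ j → T i j * T j i ≈ 1#) →
      charSeries n T ≡₃ low n 0#
    charSeries-low n T diag off = det-normalised n (record
      { diag = λ
        { i zero _ → δ-diag i
        ; i (suc zero) _ → -‿cong (diag i)
        ; i (suc (suc zero)) _ → refl
        ; i (suc (suc (suc k))) (s≤s (s≤s ())) }
      ; off₀ = δ-off
      ; off₁ = λ i j ne → trans (solve 2 (λ a b → :- a :* :- b := a :* b) refl _ _) (off i j ne) })

-- From det (I - uT) to polynomials in 1 + x

module Horner where
  open RingPreliminaries
  open PowerSeries
  open Determinant

  module Homogenisation (B : CRing) where
    open CommutativeRing B hiding (zero)
    open PS B
    open Solver B using (solve; _:=_; _:+_; _:*_; :-_; con)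
    open Solver series using () renaming (solve to solveₛ; _:=_ to _:=ₛ_; _:+_ to _:+ₛ_; _:*_ to _:*ₛ_; :-_ to :-ₛ_; con to conₛ)
    open import Algebra.Properties.Ring ring using (-0#≈0#)
    private
      module S = CommutativeRing series
      module DS = DeterminantTheory series
    open DS using (det; altSum)

    const-* : ∀ a b → const (a * b) ≋ const a ⊛ const b
    const-* a b zero    = refl
    const-* a b (suc k) = sym (trans (const-⊛ a (const b) (suc k)) (zeroʳ _))

    const-+ : ∀ a b → const (a + b) ≋ const a ⊞ const b
    const-+ a b zero    = refl
    const-+ a b (suc k) = sym (+-identityˡ _)

    const-cong : ∀ {a b} → a ≈ b → const a ≋ const b
    const-cong p zero    = p
    const-cong p (suc k) = refl

    -- Σ_{k ≤ n} a k (1 + x)^(n - k)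
    horner : ℕ → Series → Series
    horner zero    a = const (a 0)
    horner (suc n) a = (lin 1# 1# ⊛ horner n a) ⊞ const (a (suc n))

    horner-cong : ∀ n {a b} → a ≋ b → horner n a ≋ horner n b
    horner-cong zero    p = const-cong (p 0)
    horner-cong (suc n) p = S.+-cong (S.*-congˡ {lin 1# 1#} (horner-cong n p)) (const-cong (p (suc n)))

    horner-+ : ∀ n a b → horner n (a ⊞ b) ≋ horner n a ⊞ horner n b
    horner-+ zero    a b = const-+ _ _
    horner-+ (suc n) a b = S.trans (S.+-cong (S.*-congˡ {lin 1# 1#} (horner-+ n a b)) (const-+ _ _))
      (solveₛ 5 (λ y f g c d → y :*ₛ (f :+ₛ g) :+ₛ (c :+ₛ d) :=ₛ (y :*ₛ f :+ₛ c) :+ₛ (y :*ₛ g :+ₛ d)) (λ {_} → S.refl) _ (horner n a) (horner n b) _ _)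

    const-0 : const 0# ≋ S.0#
    const-0 zero    = refl
    const-0 (suc k) = refl

    const-neg : ∀ a → const (- a) ≋ S.- const a
    const-neg a zero    = refl
    const-neg a (suc k) = sym -0#≈0#

    horner-neg : ∀ n a → horner n (S.- a) ≋ S.- horner n a
    horner-neg zero    a = const-neg _
    horner-neg (suc n) a = S.trans (S.+-cong (S.*-congˡ {lin 1# 1#} (horner-neg n a)) (const-neg _))
      (solveₛ 3 (λ y f c → y :*ₛ (:-ₛ f) :+ₛ (:-ₛ c) :=ₛ :-ₛ (y :*ₛ f :+ₛ c)) (λ {_} → S.refl) (lin 1# 1#) (horner n a) (const (a (suc n))))

    horner-0 : ∀ n → horner n S.0# ≋ S.0#
    horner-0 zero    = const-0
    horner-0 (suc n) = S.trans (S.+-cong (S.trans (S.*-congˡ {lin 1# 1#} (horner-0 n)) (S.zeroʳ _)) const-0) (S.+-identityˡ _)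

    horner-altSum : ∀ n m (f : Fin m → Series) → horner n (altSum m f) ≋ altSum m (λ j → horner n (f j))
    horner-altSum n zero    f = S.trans (horner-cong n (DS.altSum-[] f)) (S.trans (horner-0 n) (S.sym (DS.altSum-[] _)))
    horner-altSum n (suc m) f = S.trans (horner-cong n (DS.altSum-∷ m f)) (S.trans (horner-+ n _ _)
      (S.trans (S.+-congˡ {horner n (f zero)} (S.trans (horner-neg n _) (S.-‿cong (horner-altSum n m (λ j → f (suc j)))))) (S.sym (DS.altSum-∷ m _))))

    shifted : Carrier → Carrier → Series
    shifted a b = (const a ⊛ lin 1# 1#) ⊞ const b

    -- Multiplying a series by a + b u multiplies its homogenisation by a (1 + x) + b. The extra
    -- term accounts for the coefficient of degree n + 1 of `g`, which `horner n` does not see; it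
    -- disappears once `det-degree` bounds the degree.
    horner-lin-gen : ∀ a b n g → horner (suc n) (lin a b ⊛ g) ≋ (shifted a b ⊛ horner n g) ⊞ const (a * g (suc n))
    horner-lin-gen a b zero    g = S.trans
      (S.+-cong (S.*-congˡ {lin 1# 1#} (const-* a (g 0))) (S.trans (const-cong (lin-⊛-suc a b g 0)) (S.trans (const-+ _ _) (S.+-congˡ {const (a * g 1)} (const-* b (g 0))))))
      (solveₛ 5 (λ y a b c d → y :*ₛ (a :*ₛ c) :+ₛ (d :+ₛ b :*ₛ c) :=ₛ (a :*ₛ y :+ₛ b) :*ₛ c :+ₛ d) (λ {_} → S.refl)
        (lin 1# 1#) (const a) (const b) (const (g 0)) (const (a * g 1)))
    horner-lin-gen a b (suc n) g = S.trans
      (S.+-cong (S.*-congˡ {lin 1# 1#} (S.trans (horner-lin-gen a b n g) (S.+-congˡ {shifted a b ⊛ horner n g} (const-* a (g (suc n))))))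
        (S.trans (const-cong (lin-⊛-suc a b g (suc n))) (S.trans (const-+ _ _) (S.+-congˡ {const (a * g (suc (suc n)))} (const-* b (g (suc n)))))))
      (solveₛ 6 (λ y a b c d h → y :*ₛ ((a :*ₛ y :+ₛ b) :*ₛ h :+ₛ a :*ₛ c) :+ₛ (d :+ₛ b :*ₛ c) :=ₛ (a :*ₛ y :+ₛ b) :*ₛ (y :*ₛ h :+ₛ c) :+ₛ d) (λ {_} → S.refl)
        (lin 1# 1#) (const a) (const b) (const (g (suc n))) (const (a * g (suc (suc n)))) (horner n g))

    horner-lin : ∀ a b n g → g (suc n) ≈ 0# → horner (suc n) (lin a b ⊛ g) ≋ shifted a b ⊛ horner n g
    horner-lin a b n g g₀ = S.trans (horner-lin-gen a b n g)
      (S.trans (S.+-congˡ {shifted a b ⊛ horner n g} (S.trans (const-cong (trans (*-congˡ g₀) (zeroʳ _))) const-0)) (S.+-identityʳ _))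

    altSum-coeff-0 : ∀ m (f : Fin m → Series) k → (∀ i → f i k ≈ 0#) → altSum m f k ≈ 0#
    altSum-coeff-0 zero    f k p = DS.altSum-[] f k
    altSum-coeff-0 (suc m) f k p = trans (DS.altSum-∷ m f k)
      (trans (+-cong (p zero) (trans (-‿cong (altSum-coeff-0 m (λ i → f (suc i)) k (λ i → p (suc i)))) -0#≈0#)) (+-identityˡ _))

    det-degree : ∀ n (α β : Fin n → Fin n → Carrier) k → n < k → det n (λ i j → lin (α i j) (β i j)) k ≈ 0#
    det-degree zero    α β (suc k) _       = DS.det-[] _ (suc k)
    det-degree (suc n) α β (suc k) (s≤s p) = trans (DS.det-row n _ (suc k)) (altSum-coeff-0 (suc n) _ (suc k) (λ j →
      trans (lin-⊛-suc _ _ _ k) (trans (+-cong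
        (trans (*-congˡ (det-degree n (λ a b → α (suc a) (punchIn j b)) (λ a b → β (suc a) (punchIn j b)) (suc k) (ℕₚ.m≤n⇒m≤1+n p))) (zeroʳ _))
        (trans (*-congˡ (det-degree n (λ a b → α (suc a) (punchIn j b)) (λ a b → β (suc a) (punchIn j b)) k p)) (zeroʳ _))) (+-identityˡ _))))

    -- This is u = 1 / (1 + x) followed by multiplication with (1 + x)^n, carried out without
    -- fractions: each row of the expansion takes one factor 1 + x.
    det-homogenise : ∀ n (α β : Fin n → Fin n → Carrier) →
      det n (λ i j → shifted (α i j) (β i j)) ≋ horner n (det n (λ i j → lin (α i j) (β i j)))
    det-homogenise zero    α β = S.trans (DS.det-[] _) (S.sym (const-cong (DS.det-[] _ 0)))
    det-homogenise (suc n) α β = begin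
      det (suc n) (λ i j → shifted (α i j) (β i j))
        ≈⟨ DS.det-row n _ ⟩
      altSum (suc n) (λ j → shifted (α zero j) (β zero j) ⊛ det n (λ a b → shifted (α (suc a) (punchIn j b)) (β (suc a) (punchIn j b))))
        ≈⟨ DS.altSum-cong (suc n) (λ j → S.trans
             (S.*-congˡ {shifted (α zero j) (β zero j)} (det-homogenise n (λ a b → α (suc a) (punchIn j b)) (λ a b → β (suc a) (punchIn j b))))
             (S.sym (horner-lin _ _ n _ (det-degree n (λ a b → α (suc a) (punchIn j b)) (λ a b → β (suc a) (punchIn j b)) (suc n) ℕₚ.≤-refl)))) ⟩
      altSum (suc n) (λ j → horner (suc n) (lin (α zero j) (β zero j) ⊛ det n (λ a b → lin (α (suc a) (punchIn j b)) (β (suc a) (punchIn j b)))))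
        ≈⟨ horner-altSum (suc n) (suc n) _ ⟨
      horner (suc n) (altSum (suc n) (λ j → lin (α zero j) (β zero j) ⊛ det n (λ a b → lin (α (suc a) (punchIn j b)) (β (suc a) (punchIn j b)))))
        ≈⟨ horner-cong (suc n) (DS.det-row n _) ⟨
      horner (suc n) (det (suc n) (λ i j → lin (α i j) (β i j))) ∎
      where open import Relation.Binary.Reasoning.Setoid S.setoid

    -- With `P` the ideal of the modulus, congruences between the a_k pass to the coefficients of
    -- the characteristic polynomial.
    horner-mem : (P : Carrier → Set) → (∀ {x y} → x ≈ y → P x → P y) → P 0# → (∀ {x y} → P x → P y → P (x + y)) →
      ∀ n d → (∀ k → P (d k)) → ∀ k → P (horner n d k)
    horner-mem P resp P0 P+ zero    d m zero    = m 0
    horner-mem P resp P0 P+ zero    d m (suc k) = P0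
    horner-mem P resp P0 P+ (suc n) d m zero    = P+ (resp (sym (*-identityˡ _)) (horner-mem P resp P0 P+ n d m 0)) (m (suc n))
    horner-mem P resp P0 P+ (suc n) d m (suc k) = P+
      (resp (sym (trans (lin-⊛-suc 1# 1# (horner n d) k) (+-cong (*-identityˡ _) (*-identityˡ _))))
        (P+ (horner-mem P resp P0 P+ n d m (suc k)) (horner-mem P resp P0 P+ n d m k))) P0

    horner-diff : ∀ n a b → horner n (a ⊞ (S.- b)) ≋ horner n a ⊞ (S.- horner n b)
    horner-diff n a b = S.trans (horner-+ n a (S.- b)) (S.+-congˡ {horner n a} (horner-neg n b))

-- Homomorphisms, polynomial rings, quotients and the quadratic extension

module Rings where
  open RingPreliminaries
  open PowerSeries
  open Determinant
  open Pencil
  open import Data.Bool.Base using (true; false)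
  open import Data.List.Base using (List; []; _∷_)
  open import Data.Product.Base using (_×_)
  import Algebra.Morphism.RingMonomorphism as RingMonomorphism

  record Hom (R S : CRing) : Set where
    private
      module R = CommutativeRing R
      module S = CommutativeRing S
    field
      fun    : R.Carrier → S.Carrier
      cong   : ∀ {x y} → x R.≈ y → fun x S.≈ fun y
      +-homo : ∀ x y → fun (x R.+ y) S.≈ fun x S.+ fun y
      *-homo : ∀ x y → fun (x R.* y) S.≈ fun x S.* fun y
      1-homo : fun R.1# S.≈ S.1#

    open import Algebra.Properties.AbelianGroup S.+-abelianGroup using (∙-cancelˡ; inverseʳ-unique)

    0-homo : fun R.0# S.≈ S.0#
    0-homo = ∙-cancelˡ (fun R.0#) _ _ (S.trans (S.sym (+-homo _ _)) (S.trans (cong (R.+-identityˡ _)) (S.sym (S.+-identityʳ _))))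

    neg-homo : ∀ x → fun (R.- x) S.≈ S.- fun x
    neg-homo x = inverseʳ-unique (fun x) _ (S.trans (S.sym (+-homo _ _)) (S.trans (cong (R.-‿inverseʳ x)) 0-homo))

    -‿homo₂ : ∀ x y → fun (x R.+ R.- y) S.≈ fun x S.+ S.- fun y
    -‿homo₂ x y = S.trans (+-homo _ _) (S.+-congˡ (neg-homo y))

  module SeriesHom {R S : CRing} (h : Hom R S) where
    private
      module R = CommutativeRing R
      module S = CommutativeRing S
      module PR = PS R
      module PS′ = PS S
    open Hom h

    map-⊛ : ∀ f g k → fun ((f PR.⊛ g) k) S.≈ ((λ i → fun (f i)) PS′.⊛ (λ i → fun (g i))) k
    map-⊛ f g zero    = *-homo _ _
    map-⊛ f g (suc k) = S.trans (+-homo _ _) (S.+-cong (*-homo _ _) (map-⊛ (λ i → f (suc i)) g k))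

    seriesHom : Hom PR.series PS′.series
    seriesHom = record
      { fun = λ f k → fun (f k)
      ; cong = λ p k → cong (p k)
      ; +-homo = λ f g k → +-homo _ _
      ; *-homo = map-⊛
      ; 1-homo = λ { zero → 1-homo ; (suc k) → 0-homo } }

  module _ {R S : CRing} (h : Hom R S) where
    open Hom h
    open CommutativeRing S
    private
      module R = CommutativeRing R
      module DR = DeterminantTheory R
      module DS = DeterminantTheory S
      operations : OperationHom R.0# R.1# R._+_ R._*_ R.-_ S
      operations = record { φ = fun ; φ-0 = 0-homo ; φ-1 = 1-homo ; φ-+ = +-homo ; φ-* = *-homo ; φ-neg = neg-homo }
      module H = DetHom R.0# R.1# R._+_ R._*_ R.-_ S operations

    hom-det : ∀ n M → fun (DR.det n M) ≈ DS.det n (λ i j → fun (M i j))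
    hom-det n M = trans (cong (DR.det-unfold n M)) (H.φ-det n M)

    hom-δ : ∀ {n} (i j : Fin n) → fun (Kronecker.δ R i j) ≈ Kronecker.δ S i j
    hom-δ i j with does (i ≟ j)
    ... | true  = 1-homo
    ... | false = 0-homo

  module Polynomials (R : CRing) where
    open CommutativeRing R hiding (zero)
    open PolyOps 0# 1# _+_ _*_ -_ public
    open PS R
    open import Algebra.Properties.Ring ring using (-0#≈0#)

    coeff-+ : ∀ p q k → coeff (p +P q) k ≈ coeff p k + coeff q k
    coeff-+ []      q       k       = sym (+-identityˡ _)
    coeff-+ (a ∷ p) []      k       = sym (+-identityʳ _)
    coeff-+ (a ∷ p) (b ∷ q) zero    = refl
    coeff-+ (a ∷ p) (b ∷ q) (suc k) = coeff-+ p q k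

    coeff-neg : ∀ p k → coeff (negP p) k ≈ - coeff p k
    coeff-neg []      k       = sym -0#≈0#
    coeff-neg (a ∷ p) zero    = refl
    coeff-neg (a ∷ p) (suc k) = coeff-neg p k

    coeff-scale : ∀ a p k → coeff (scaleP a p) k ≈ a * coeff p k
    coeff-scale a []      k       = sym (zeroʳ a)
    coeff-scale a (b ∷ p) zero    = refl
    coeff-scale a (b ∷ p) (suc k) = coeff-scale a p k

    coeff-* : ∀ p q k → coeff (p *P q) k ≈ (coeff p ⊛ coeff q) k
    coeff-* []      q k       = sym (⊛-zeroˡ (coeff q) (λ _ → refl) k)
    coeff-* (a ∷ p) q zero    = trans (coeff-+ (scaleP a q) _ 0) (trans (+-identityʳ _) (coeff-scale a q 0))
    coeff-* (a ∷ p) q (suc k) = trans (coeff-+ (scaleP a q) _ (suc k)) (+-cong (coeff-scale a q (suc k)) (coeff-* p q k))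

    coeff-1 : ∀ k → coeff (1# ∷ []) k ≈ const 1# k
    coeff-1 zero    = refl
    coeff-1 (suc k) = refl

    poly : CRing
    poly = record
      { Carrier = Pol ; _≈_ = λ p q → ∀ k → coeff p k ≈ coeff q k
      ; _+_ = _+P_ ; _*_ = _*P_ ; -_ = negP ; 0# = [] ; 1# = 1# ∷ []
      ; isCommutativeRing = RingMonomorphism.isCommutativeRing isMono (CommutativeRing.isCommutativeRing series) }
      where
      open import Algebra.Bundles using (RawRing)
      open import Algebra.Morphism.Structures using (IsRingMonomorphism)
      raw : RawRing _ _
      raw = record
        { Carrier = Pol ; _≈_ = λ p q → ∀ k → coeff p k ≈ coeff q k
        ; _+_ = _+P_ ; _*_ = _*P_ ; -_ = negP ; 0# = [] ; 1# = 1# ∷ [] }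
      isMono : IsRingMonomorphism raw (CommutativeRing.rawRing series) coeff
      isMono = record
        { isRingHomomorphism = record
          { isSemiringHomomorphism = record
            { isNearSemiringHomomorphism = record
              { +-isMonoidHomomorphism = record
                { isMagmaHomomorphism = record
                  { isRelHomomorphism = record { cong = λ p → p } ; homo = coeff-+ }
                ; ε-homo = λ k → refl }
              ; *-homo = coeff-* }
            ; 1#-homo = coeff-1 }
          ; -‿homo = coeff-neg }
        ; injective = λ p → p }

    module Eval {A : CRing} (ι : Hom R A) (t : CommutativeRing.Carrier A) where
      private
        module A = CommutativeRing A
        module ι = Hom ι
      open Solver A using (solve; _:=_; _:+_; _:*_; :-_; con)

      eval : Pol → A.Carrier
      eval []      = A.0#
      eval (c ∷ p) = ι.fun c A.+ t A.* eval p

      -- Propositional equality lets the evaluation fixed in the definitions be exchanged for `eval`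
      -- inside a term, before any ring equality is chosen.
      eval-unique : ∀ (g : Pol → A.Carrier) → g [] ≡ A.0# → (∀ c p → g (c ∷ p) ≡ ι.fun c A.+ t A.* g p) → ∀ p → g p ≡ eval p
      eval-unique g g₀ g₊ []      = g₀
      eval-unique g g₀ g₊ (c ∷ p) = ≡.trans (g₊ c p) (≡.cong (λ y → ι.fun c A.+ t A.* y) (eval-unique g g₀ g₊ p))

      eval-+ : ∀ p q → eval (p +P q) A.≈ eval p A.+ eval q
      eval-+ []      q       = A.sym (A.+-identityˡ _)
      eval-+ (a ∷ p) []      = A.sym (A.+-identityʳ _)
      eval-+ (a ∷ p) (b ∷ q) = A.trans (A.+-cong (ι.+-homo a b) (A.*-congˡ (eval-+ p q)))
        (solve 5 (λ a b t p q → (a :+ b) :+ t :* (p :+ q) := (a :+ t :* p) :+ (b :+ t :* q)) A.refl _ _ _ _ _)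

      eval-scale : ∀ a p → eval (scaleP a p) A.≈ ι.fun a A.* eval p
      eval-scale a []      = A.sym (A.zeroʳ _)
      eval-scale a (b ∷ p) = A.trans (A.+-cong (ι.*-homo a b) (A.*-congˡ (eval-scale a p)))
        (solve 4 (λ a b t p → a :* b :+ t :* (a :* p) := a :* (b :+ t :* p)) A.refl _ _ _ _)

      eval-* : ∀ p q → eval (p *P q) A.≈ eval p A.* eval q
      eval-* []      q = A.sym (A.zeroˡ _)
      eval-* (a ∷ p) q = A.trans (eval-+ (scaleP a q) (0# ∷ (p *P q)))
        (A.trans (A.+-cong (eval-scale a q) (A.+-cong ι.0-homo (A.*-congˡ (eval-* p q))))
          (solve 4 (λ a t p q → a :* q :+ (con (+ 0) :+ t :* (p :* q)) := (a :+ t :* p) :* q) A.refl _ _ _ _))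

      eval-0 : ∀ p → (∀ k → coeff p k ≈ 0#) → eval p A.≈ A.0#
      eval-0 []      z = A.refl
      eval-0 (a ∷ p) z = A.trans (A.+-cong (A.trans (ι.cong (z 0)) ι.0-homo) (A.*-congˡ (eval-0 p (λ k → z (suc k)))))
        (A.trans (A.+-identityˡ _) (A.zeroʳ _))

      eval-cong : ∀ p q → (∀ k → coeff p k ≈ coeff q k) → eval p A.≈ eval q
      eval-cong []      q       e = A.sym (eval-0 q (λ k → sym (e k)))
      eval-cong (a ∷ p) []      e = eval-0 (a ∷ p) e
      eval-cong (a ∷ p) (b ∷ q) e = A.+-cong (ι.cong (e 0)) (A.*-congˡ (eval-cong p q (λ k → e (suc k))))

      evalHom : Hom poly A
      evalHom = record
        { fun = eval ; cong = λ {p} {q} → eval-cong p q ; +-homo = eval-+ ; *-homo = eval-*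
        ; 1-homo = A.trans (A.+-cong ι.1-homo (A.zeroʳ _)) (A.+-identityʳ _) }

  record Congruent (R : CRing) (g a b : CommutativeRing.Carrier R) : Set where
    constructor congruent
    open CommutativeRing R
    field
      factor   : Carrier
      multiple : a + - b ≈ g * factor

  module Quotient (R : CRing) (g : CommutativeRing.Carrier R) where
    open CommutativeRing R hiding (zero)
    open Solver R using (solve; _:=_; _:+_; _:*_; :-_; con)
    open import Algebra.Properties.Ring ring using (-‿distribʳ-*; -0#≈0#)

    infix 4 _~_
    _~_ : Carrier → Carrier → Set
    _~_ = Congruent R g

    ≈⇒~ : ∀ {a b} → a ≈ b → a ~ b
    ≈⇒~ {a} {b} p = congruent 0# (trans (+-congʳ p) (trans (-‿inverseʳ b) (sym (zeroʳ g))))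

    private
      ~-sym : ∀ {a b} → a ~ b → b ~ a
      ~-sym {a} {b} (congruent d p) = congruent (- d) (trans (solve 2 (λ a b → b :+ :- a := :- (a :+ :- b)) refl a b) (trans (-‿cong p) (-‿distribʳ-* g d)))

      ~-trans : ∀ {a b c} → a ~ b → b ~ c → a ~ c
      ~-trans {a} {b} {c} (congruent d p) (congruent e q) = congruent (d + e)
        (trans (solve 3 (λ a b c → a :+ :- c := (a :+ :- b) :+ (b :+ :- c)) refl a b c) (trans (+-cong p q) (sym (distribˡ g d e))))

      ~-+ : ∀ {a b c d} → a ~ b → c ~ d → a + c ~ b + d
      ~-+ {a} {b} {c} {d} (congruent x p) (congruent y q) = congruent (x + y)
        (trans (solve 4 (λ a b c d → (a :+ c) :+ :- (b :+ d) := (a :+ :- b) :+ (c :+ :- d)) refl a b c d) (trans (+-cong p q) (sym (distribˡ g x y))))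

      ~-* : ∀ {a b c d} → a ~ b → c ~ d → a * c ~ b * d
      ~-* {a} {b} {c} {d} (congruent x p) (congruent y q) = congruent (x * c + b * y)
        (trans (solve 4 (λ a b c d → a :* c :+ :- (b :* d) := (a :+ :- b) :* c :+ b :* (c :+ :- d)) refl a b c d)
          (trans (+-cong (*-congʳ p) (*-congˡ q)) (solve 5 (λ g x c b y → g :* x :* c :+ b :* (g :* y) := g :* (x :* c :+ b :* y)) refl g x c b y)))

      ~-neg : ∀ {a b} → a ~ b → - a ~ - b
      ~-neg {a} {b} (congruent x p) = congruent (- x) (trans (solve 2 (λ a b → :- a :+ :- (:- b) := :- (a :+ :- b)) refl a b) (trans (-‿cong p) (-‿distribʳ-* g x)))

    quotient : CRing
    quotient = record
      { Carrier = Carrier ; _≈_ = _~_ ; _+_ = _+_ ; _*_ = _*_ ; -_ = -_ ; 0# = 0# ; 1# = 1#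
      ; isCommutativeRing = record
        { isRing = record
          { +-isAbelianGroup = record
            { isGroup = record
              { isMonoid = record
                { isSemigroup = record
                  { isMagma = record
                    { isEquivalence = record { refl = ≈⇒~ refl ; sym = ~-sym ; trans = ~-trans }
                    ; ∙-cong = ~-+ }
                  ; assoc = λ a b c → ≈⇒~ (+-assoc a b c) }
                ; identity = (λ a → ≈⇒~ (+-identityˡ a)) , (λ a → ≈⇒~ (+-identityʳ a)) }
              ; inverse = (λ a → ≈⇒~ (-‿inverseˡ a)) , (λ a → ≈⇒~ (-‿inverseʳ a))
              ; ⁻¹-cong = ~-neg }
            ; comm = λ a b → ≈⇒~ (+-comm a b) }
          ; *-cong = ~-*
          ; *-assoc = λ a b c → ≈⇒~ (*-assoc a b c)
          ; *-identity = (λ a → ≈⇒~ (*-identityˡ a)) , (λ a → ≈⇒~ (*-identityʳ a))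
          ; distrib = (λ a b c → ≈⇒~ (distribˡ a b c)) , (λ a b c → ≈⇒~ (distribʳ a b c)) }
        ; *-comm = λ a b → ≈⇒~ (*-comm a b) } }

    project : Hom R quotient
    project = record
      { fun = λ x → x ; cong = ≈⇒~ ; +-homo = λ x y → ≈⇒~ refl ; *-homo = λ x y → ≈⇒~ refl ; 1-homo = ≈⇒~ refl }

  -- R[π] / (π² - ρπ + ρ). For R = ℤ[ρ] this is the ring of Laurent polynomials in ζ = 1 - π,
  -- with ρ = (1 - ζ)(1 - ζ⁻¹).
  module Quadratic (R : CRing) (ρ : CommutativeRing.Carrier R) where
    open CommutativeRing R hiding (zero)
    open Solver R using (solve; _:=_; _:+_; _:*_; :-_; con)

    Pair : Set
    Pair = Carrier × Carrier

    infixl 7 _·_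
    _·_ : Pair → Pair → Pair
    (a , b) · (c , d) = a * c + - (ρ * (b * d)) , a * d + b * c + ρ * (b * d)

    private
      assoc₁ : ∀ a b c d e f → (a * c + - (ρ * (b * d))) * e + - (ρ * ((a * d + b * c + ρ * (b * d)) * f)) ≈
        a * (c * e + - (ρ * (d * f))) + - (ρ * (b * (c * f + d * e + ρ * (d * f))))
      assoc₁ a b c d e f = solve 7 (λ ρ a b c d e f → (a :* c :+ :- (ρ :* (b :* d))) :* e :+ :- (ρ :* ((a :* d :+ b :* c :+ ρ :* (b :* d)) :* f)) :=
        a :* (c :* e :+ :- (ρ :* (d :* f))) :+ :- (ρ :* (b :* (c :* f :+ d :* e :+ ρ :* (d :* f))))) refl ρ a b c d e f

      assoc₂ : ∀ a b c d e f → (a * c + - (ρ * (b * d))) * f + (a * d + b * c + ρ * (b * d)) * e + ρ * ((a * d + b * c + ρ * (b * d)) * f) ≈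
        a * (c * f + d * e + ρ * (d * f)) + b * (c * e + - (ρ * (d * f))) + ρ * (b * (c * f + d * e + ρ * (d * f)))
      assoc₂ a b c d e f = solve 7 (λ ρ a b c d e f →
        (a :* c :+ :- (ρ :* (b :* d))) :* f :+ (a :* d :+ b :* c :+ ρ :* (b :* d)) :* e :+ ρ :* ((a :* d :+ b :* c :+ ρ :* (b :* d)) :* f) :=
        a :* (c :* f :+ d :* e :+ ρ :* (d :* f)) :+ b :* (c :* e :+ :- (ρ :* (d :* f))) :+ ρ :* (b :* (c :* f :+ d :* e :+ ρ :* (d :* f)))) refl ρ a b c d e f

      ·-comm : ∀ x y → proj₁ (x · y) ≈ proj₁ (y · x) × proj₂ (x · y) ≈ proj₂ (y · x)
      ·-comm (a , b) (c , d) =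
        solve 5 (λ ρ a b c d → a :* c :+ :- (ρ :* (b :* d)) := c :* a :+ :- (ρ :* (d :* b))) refl ρ a b c d ,
        solve 5 (λ ρ a b c d → a :* d :+ b :* c :+ ρ :* (b :* d) := c :* b :+ d :* a :+ ρ :* (d :* b)) refl ρ a b c d

      identityˡ : ∀ x → proj₁ ((1# , 0#) · x) ≈ proj₁ x × proj₂ ((1# , 0#) · x) ≈ proj₂ x
      identityˡ (a , b) =
        solve 3 (λ ρ a b → con (+ 1) :* a :+ :- (ρ :* (con (+ 0) :* b)) := a) refl ρ a b ,
        solve 3 (λ ρ a b → con (+ 1) :* b :+ con (+ 0) :* a :+ ρ :* (con (+ 0) :* b) := b) refl ρ a b

      distˡ : ∀ x y z → proj₁ (x · (proj₁ y + proj₁ z , proj₂ y + proj₂ z)) ≈ proj₁ (x · y) + proj₁ (x · z) ×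
                        proj₂ (x · (proj₁ y + proj₁ z , proj₂ y + proj₂ z)) ≈ proj₂ (x · y) + proj₂ (x · z)
      distˡ (a , b) (c , d) (e , f) =
        solve 7 (λ ρ a b c d e f → a :* (c :+ e) :+ :- (ρ :* (b :* (d :+ f))) := (a :* c :+ :- (ρ :* (b :* d))) :+ (a :* e :+ :- (ρ :* (b :* f)))) refl ρ a b c d e f ,
        solve 7 (λ ρ a b c d e f → a :* (d :+ f) :+ b :* (c :+ e) :+ ρ :* (b :* (d :+ f)) := (a :* d :+ b :* c :+ ρ :* (b :* d)) :+ (a :* f :+ b :* e :+ ρ :* (b :* f))) refl ρ a b c d e f

      infix 4 _≈₂_
      _≈₂_ : Pair → Pair → Set
      x ≈₂ y = proj₁ x ≈ proj₁ y × proj₂ x ≈ proj₂ y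

      trans₂ : ∀ {x y z} → x ≈₂ y → y ≈₂ z → x ≈₂ z
      trans₂ (p , q) (r , s) = trans p r , trans q s

      ·-cong : ∀ {x y z w} → x ≈₂ y → z ≈₂ w → x · z ≈₂ y · w
      ·-cong (p , q) (r , s) = +-cong (*-cong p r) (-‿cong (*-congˡ (*-cong q s))) ,
        +-cong (+-cong (*-cong p s) (*-cong q r)) (*-congˡ (*-cong q s))

    extension : CRing
    extension = record
      { Carrier = Pair ; _≈_ = λ x y → proj₁ x ≈ proj₁ y × proj₂ x ≈ proj₂ y
      ; _+_ = λ x y → proj₁ x + proj₁ y , proj₂ x + proj₂ y ; _*_ = _·_ ; -_ = λ x → - proj₁ x , - proj₂ x
      ; 0# = 0# , 0# ; 1# = 1# , 0#
      ; isCommutativeRing = record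
        { isRing = record
          { +-isAbelianGroup = record
            { isGroup = record
              { isMonoid = record
                { isSemigroup = record
                  { isMagma = record
                    { isEquivalence = record { refl = refl , refl ; sym = λ (p , q) → sym p , sym q ; trans = trans₂ }
                    ; ∙-cong = λ (p , q) (r , s) → +-cong p r , +-cong q s }
                  ; assoc = λ a b c → +-assoc _ _ _ , +-assoc _ _ _ }
                ; identity = (λ a → +-identityˡ _ , +-identityˡ _) , (λ a → +-identityʳ _ , +-identityʳ _) }
              ; inverse = (λ a → -‿inverseˡ _ , -‿inverseˡ _) , (λ a → -‿inverseʳ _ , -‿inverseʳ _)
              ; ⁻¹-cong = λ (p , q) → -‿cong p , -‿cong q }
            ; comm = λ a b → +-comm _ _ , +-comm _ _ }
          ; *-cong = ·-cong
          ; *-assoc = λ (a , b) (c , d) (e , f) → assoc₁ a b c d e f , assoc₂ a b c d e f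
          ; *-identity = identityˡ , (λ x → trans₂ (·-comm x (1# , 0#)) (identityˡ x))
          ; distrib = distˡ , λ x y z → trans₂ (·-comm _ x) (trans₂ (distˡ x y z)
              (+-cong (proj₁ (·-comm x y)) (proj₁ (·-comm x z)) , +-cong (proj₂ (·-comm x y)) (proj₂ (·-comm x z)))) }
        ; *-comm = ·-comm } }

    π ζ ζ̄ : Pair
    π = 0# , 1#
    ζ = 1# , - 1#
    ζ̄ = 1# + - ρ , 1#

    embed : Carrier → Pair
    embed a = a , 0#

    -- π goes to ρ - π, the other root of x² - ρx + ρ; this exchanges ζ = 1 - π and ζ̄ = 1 - ρ + π.
    conjugate : Hom extension extension
    conjugate = record
      { fun = λ (a , b) → a + ρ * b , - b
      ; cong = λ (p , q) → +-cong p (*-congˡ q) , -‿cong q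
      ; +-homo = λ (a , b) (c , d) →
          solve 5 (λ ρ a b c d → (a :+ c) :+ ρ :* (b :+ d) := (a :+ ρ :* b) :+ (c :+ ρ :* d)) refl ρ a b c d ,
          solve 2 (λ b d → :- (b :+ d) := :- b :+ :- d) refl b d
      ; *-homo = λ (a , b) (c , d) →
          solve 5 (λ ρ a b c d → (a :* c :+ :- (ρ :* (b :* d))) :+ ρ :* (a :* d :+ b :* c :+ ρ :* (b :* d)) :=
            (a :+ ρ :* b) :* (c :+ ρ :* d) :+ :- (ρ :* (:- b :* :- d))) refl ρ a b c d ,
          solve 5 (λ ρ a b c d → :- (a :* d :+ b :* c :+ ρ :* (b :* d)) :=
            (a :+ ρ :* b) :* :- d :+ :- b :* (c :+ ρ :* d) :+ ρ :* (:- b :* :- d)) refl ρ a b c d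
      ; 1-homo = solve 1 (λ ρ → con (+ 1) :+ ρ :* con (+ 0) := con (+ 1)) refl ρ , solve 0 (:- con (+ 0) := con (+ 0)) refl }

  module QuadraticHom {R S : CRing} (h : Hom R S) (ρ : CommutativeRing.Carrier R) (r : CommutativeRing.Carrier S)
    (hρ : CommutativeRing._≈_ S (Hom.fun h ρ) r) where
    private
      module S = CommutativeRing S
      module QR = Quadratic R ρ
      module QS = Quadratic S r
    open Hom h

    private
      ρ*-homo : ∀ b d → fun (CommutativeRing._*_ R ρ (CommutativeRing._*_ R b d)) S.≈ r S.* (fun b S.* fun d)
      ρ*-homo b d = S.trans (*-homo _ _) (S.*-cong hρ (*-homo b d))

    extensionHom : Hom QR.extension QS.extension
    extensionHom = record
      { fun = λ (a , b) → fun a , fun b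
      ; cong = λ (p , q) → cong p , cong q
      ; +-homo = λ (a , b) (c , d) → +-homo a c , +-homo b d
      ; *-homo = λ (a , b) (c , d) →
          S.trans (-‿homo₂ _ _) (S.+-cong (*-homo a c) (S.-‿cong (ρ*-homo b d))) ,
          S.trans (+-homo _ _) (S.+-cong (S.trans (+-homo _ _) (S.+-cong (*-homo a d) (*-homo b c))) (ρ*-homo b d))
      ; 1-homo = 1-homo , 0-homo }

-- The even structure on series over a residue ring

module Residue where
  open RingPreliminaries
  open PowerSeries
  open Determinant
  open Hermitian
  open Pencil

  alternatingSign : (R : CRing) → ℕ → CommutativeRing.Carrier R
  alternatingSign R zero    = CommutativeRing.1# R
  alternatingSign R (suc m) = CommutativeRing.-_ R (alternatingSign R m)

  alternatingSign-unique : ∀ R (s : ℕ → CommutativeRing.Carrier R) → CommutativeRing.1# R ≡ s 0 →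
    (∀ m → CommutativeRing.-_ R (s m) ≡ s (suc m)) → ∀ m → alternatingSign R m ≡ s m
  alternatingSign-unique R s s₀ s₊ zero    = s₀
  alternatingSign-unique R s s₀ s₊ (suc m) = ≡.trans (≡.cong (CommutativeRing.-_ R) (alternatingSign-unique R s s₀ s₊ m)) (s₊ m)

  -- V is a residue ring of the ring generated by ζ on which conjugation is trivial, and c is the image of -ζ⁻¹ = π̄ / π.
  record ResidueStructure (V : CRing) : Set₁ where
    open CommutativeRing V
    field
      𝔪       : Carrier → Set
      𝔪-ideal : IsIdeal V 𝔪
      𝔪²≈0    : ∀ {x y} → 𝔪 x → 𝔪 y → x * y ≈ 0#
      2∈𝔪     : 𝔪 (1# + 1#)
      c       : Carrier
      c~1     : 𝔪 (c + - 1#)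

  module ResidueRing (V : CRing) (structure : ResidueStructure V) where
    open CommutativeRing V hiding (zero)
    open ResidueStructure structure
    open PS V
    open Rescale c
    open Kronecker V
    open Solver V using (solve; _:=_; _:+_; _:*_; :-_; con)
    open import Algebra.Properties.Semiring.Exp semiring using (_^_)
    open import Algebra.Properties.Ring ring using (-‿distribʳ-*; -0#≈0#)
    private
      module S = CommutativeRing series
      module 𝔪 = IsIdeal 𝔪-ideal

    0∈𝔪 : 𝔪 0#
    0∈𝔪 = 𝔪.resp (zeroˡ _) (𝔪.*-mem 0# 2∈𝔪)

    ⊛-mem : ∀ f g → (∀ k → 𝔪 (g k)) → ∀ k → 𝔪 ((f ⊛ g) k)
    ⊛-mem f g m zero    = 𝔪.*-mem _ (m 0)
    ⊛-mem f g m (suc k) = 𝔪.+-mem (𝔪.*-mem _ (m (suc k))) (⊛-mem (λ i → f (suc i)) g m k)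

    ⊛-null : ∀ f g → (∀ k → 𝔪 (f k)) → (∀ k → 𝔪 (g k)) → ∀ k → (f ⊛ g) k ≈ 0#
    ⊛-null f g m m′ zero    = 𝔪²≈0 (m 0) (m′ 0)
    ⊛-null f g m m′ (suc k) = trans (+-cong (𝔪²≈0 (m 0) (m′ (suc k))) (⊛-null (λ i → f (suc i)) g (λ i → m (suc i)) m′ k)) (+-identityˡ _)

    -- c is 1 modulo `𝔪`, so 1 + c^k is 2 modulo `𝔪`. This makes f + τ(f), with coefficients (1 +
    -- c^k) f_k, an even series.
    1+c^k : ∀ k → 𝔪 (1# + c ^ k)
    1+c^k zero    = 2∈𝔪
    1+c^k (suc k) = 𝔪.resp (solve 2 (λ c p → p :* (c :+ :- con (+ 1)) :+ (con (+ 1) :+ p) := con (+ 1) :+ c :* p) refl c (c ^ k))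
      (𝔪.+-mem (𝔪.*-mem (c ^ k) c~1) (1+c^k k))

    rescale-1 : rescale (const 1#) ≋ const 1#
    rescale-1 zero    = *-identityˡ _
    rescale-1 (suc k) = zeroʳ _

    invert : ∀ {f : Series} → 𝔪 ((f ⊞ (S.- S.1#)) 0) → ∃ λ g → f ⊛ g ≋ const 1#
    invert {f} m = inv , inverseʳ
      where
      -- f₀ = 1 + m with m² = 0, so 1 - m inverts the constant term.
      open Inverse f (1# + - (f 0 + - 1#)) (trans
        (solve 1 (λ a → a :* (con (+ 1) :+ :- (a :+ :- con (+ 1))) := con (+ 1) :+ :- ((a :+ :- con (+ 1)) :* (a :+ :- con (+ 1)))) refl (f 0))
        (trans (+-congˡ (trans (-‿cong (𝔪²≈0 m m)) -0#≈0#)) (+-identityʳ _)))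

    evenStructure : EvenStructure series
    evenStructure = record
      { τ = rescale ; τ-cong = λ p k → *-congˡ (p k) ; τ-1 = rescale-1 ; τ-+ = λ f g k → distribˡ _ _ _ ; τ-* = rescale-⊛
      ; τ-neg = λ f k → sym (-‿distribʳ-* _ _)
      ; 𝔞 = λ f → ∀ k → 𝔪 (f k) ; 𝔫 = λ f → 𝔪 (f 0)
      ; 𝔞-ideal = record { resp = λ p m k → 𝔪.resp (p k) (m k) ; +-mem = λ m m′ k → 𝔪.+-mem (m k) (m′ k) ; *-mem = λ f m → ⊛-mem f _ m }
      ; 𝔫-ideal = record { resp = λ p m → 𝔪.resp (p 0) m ; +-mem = λ m m′ → 𝔪.+-mem m m′ ; *-mem = λ f m → 𝔪.*-mem (f 0) m }
      ; 𝔞⊆𝔫 = λ m → m 0 ; 𝔞²≈0 = λ m m′ → ⊛-null _ _ m m′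
      ; trace∈𝔞 = λ f k → 𝔪.resp (solve 2 (λ a p → a :* (con (+ 1) :+ p) := a :+ p :* a) refl (f k) (c ^ k)) (𝔪.*-mem (f k) (1+c^k k))
      ; invert = λ {f} → invert {f} }

    module H = EvenHermitian series evenStructure

    sign-⊛ : ∀ m f k → (H.sign m ⊛ f) k ≈ alternatingSign V m * f k
    sign-⊛ zero    f k = const-⊛ 1# f k
    sign-⊛ (suc m) f k = trans (sym (-‿distribˡ-*ₛ (H.sign m) f k)) (trans (-‿cong (sign-⊛ m f k)) (-‿distribˡ-* _ _))
      where
      open import Algebra.Properties.Ring S.ring using () renaming (-‿distribˡ-* to -‿distribˡ-*ₛ)
      open import Algebra.Properties.Ring ring using (-‿distribˡ-*)

    module Seidel (n : ℕ) (T : Fin (suc n) → Fin (suc n) → Carrier) (B : Fin n → Fin n → Carrier)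
      (T-sym : ∀ i j → T i j ≈ T j i) (T~1 : ∀ i j → 𝔪 (T i j + - 1#)) (T₀-unit : ∀ i → T (suc i) zero * T zero (suc i) ≈ 1#)
      (B-herm : ∀ i j → c * B i j ≈ B j i) (B-diag : ∀ i → B i i ≈ 0#) where

      open CharacteristicSeries.Core V n T B public

      private
        δ-sym : ∀ {n} (i j : Fin n) → δ i j ≈ δ j i
        δ-sym zero    zero    = refl
        δ-sym zero    (suc j) = refl
        δ-sym (suc i) zero    = refl
        δ-sym (suc i) (suc j) = δ-sym i j

        -- In degree 1 the factor c of `B-herm` is absorbed by the substitution u ↦ c u contained in
        -- τ.
        core-herm : ∀ i j → rescale (core i j) ≋ core j i
        core-herm i j zero = trans (*-identityˡ _) (+-cong (δ-sym i j) (trans (*-cong (T-sym _ _) (T-sym _ _)) (*-comm _ _)))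
        core-herm i j (suc zero) = trans (*-congʳ (*-identityʳ c)) (B-herm i j)
        core-herm i j (suc (suc k)) = zeroʳ _

        -- The source of all evenness: the constant term is 1 + T_i0 T_0i = 2, and B has zero
        -- diagonal.
        core-diag : ∀ i k → 𝔪 (core i i k)
        core-diag i zero = 𝔪.resp (sym (+-cong (δ-diag i) (T₀-unit i))) 2∈𝔪
        core-diag i (suc zero) = 𝔪.resp (sym (B-diag i)) 0∈𝔪
        core-diag i (suc (suc k)) = 0∈𝔪

        core-off : ∀ i j → i ≢ j → 𝔪 (core i j 0 + - 1#)
        core-off i j ne = 𝔪.resp (trans
          (solve 2 (λ s t → s :* (t :+ :- con (+ 1)) :+ (s :+ :- con (+ 1)) := (con (+ 0) :+ s :* t) :+ :- con (+ 1)) refl (T (suc i) zero) (T zero (suc j)))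
          (+-congʳ (+-congʳ (sym (δ-off i j ne)))))
          (𝔪.+-mem (𝔪.*-mem _ (T~1 _ _)) (T~1 _ _))

        const-herm : ∀ {a b} → a ≈ b → rescale (const (- a)) ≋ const (- b)
        const-herm p zero    = trans (*-identityˡ _) (-‿cong p)
        const-herm p (suc k) = zeroʳ _

        neg~1 : ∀ {a} → 𝔪 (a + - 1#) → 𝔪 (- a + - 1#)
        neg~1 {a} m = 𝔪.resp (solve 1 (λ a → :- ((a :+ :- con (+ 1)) :+ (con (+ 1) :+ con (+ 1))) := :- a :+ :- con (+ 1)) refl a) (𝔪.neg-mem (𝔪.+-mem m 2∈𝔪))

      core-even : H.Even core
      core-even = record { herm = core-herm ; diag = core-diag ; off = core-off }

      bordered-even : H.Even bordered
      bordered-even = record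
        { herm = λ
          { zero    zero    → λ { zero → trans (*-identityˡ _) refl ; (suc k) → zeroʳ _ }
          ; zero    (suc j) → const-herm (T-sym _ _)
          ; (suc i) zero    → const-herm (T-sym _ _)
          ; (suc i) (suc j) → core-herm i j }
        ; diag = λ
          { zero    → λ { zero → 0∈𝔪 ; (suc k) → 0∈𝔪 }
          ; (suc i) → core-diag i }
        ; off = λ
          { zero    zero    ne → ⊥-elim (ne ≡.refl)
          ; zero    (suc j) ne → neg~1 (T~1 _ _)
          ; (suc i) zero    ne → neg~1 (T~1 _ _)
          ; (suc i) (suc j) ne → core-off i j (λ { ≡.refl → ne ≡.refl }) } }

-- Naturality of the core determinants, and squares of series

module CoreHom where
  open RingPreliminaries
  open PowerSeries
  open Determinant
  open Pencil
  open Rings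

  module _ {R S : CRing} (h : Hom R S) where
    open Hom h
    open CommutativeRing S hiding (zero)
    private
      module R = CommutativeRing R
      module PR = PS R
      module PS′ = PS S
      module CR = CharacteristicSeries R
      module CS = CharacteristicSeries S
      module DS = DeterminantTheory PS′.series
      module H = SeriesHom h

    hom-lin : ∀ {a b a′ b′} → fun a ≈ a′ → fun b ≈ b′ → ∀ k → fun (PR.lin a b k) ≈ PS′.lin a′ b′ k
    hom-lin p q zero          = p
    hom-lin p q (suc zero)    = q
    hom-lin p q (suc (suc k)) = 0-homo

    hom-const : ∀ {a a′} → fun a ≈ a′ → ∀ k → fun (PR.const a k) ≈ PS′.const a′ k
    hom-const p zero    = p
    hom-const p (suc k) = 0-homo

    hom-charSeries : ∀ n T k → fun (CR.charSeries n T k) ≈ CS.charSeries n (λ i j → fun (T i j)) k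
    hom-charSeries n T k = trans (hom-det H.seriesHom n _ k)
      (DS.det-cong n (λ i j → hom-lin (hom-δ h i j) (neg-homo _)) k)

    module _ (n : ℕ) (T : Fin (suc n) → Fin (suc n) → R.Carrier) (B : Fin n → Fin n → R.Carrier) where
      private
        module KR = CR.Core n T B
        module KS = CS.Core n (λ i j → fun (T i j)) (λ i j → fun (B i j))

      hom-core : ∀ i j k → fun (KR.core i j k) ≈ KS.core i j k
      hom-core i j = hom-lin (trans (+-homo _ _) (+-cong (hom-δ h i j) (*-homo _ _))) refl

      hom-bordered : ∀ i j k → fun (KR.bordered i j k) ≈ KS.bordered i j k
      hom-bordered zero    zero    = hom-const 0-homo
      hom-bordered zero    (suc j) = hom-const (neg-homo _)
      hom-bordered (suc i) zero    = hom-const (neg-homo _)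
      hom-bordered (suc i) (suc j) = hom-core i j

      hom-coreDet : ∀ k → fun (KR.coreDet k) ≈ KS.coreDet k
      hom-coreDet k = trans (hom-det H.seriesHom n _ k) (DS.det-cong n hom-core k)

      hom-borderedDet : ∀ k → fun (KR.borderedDet k) ≈ KS.borderedDet k
      hom-borderedDet k = trans (hom-det H.seriesHom (suc n) _ k) (DS.det-cong (suc n) hom-bordered k)

  module Squares (R : CRing) where
    open CommutativeRing R hiding (zero)
    open PS R
    open Solver R using (solve; _:=_; _:+_; _:*_; con)

    -- The two outermost products coincide. The factor 2 is what makes squares of series rigid
    -- modulo 2 and modulo 4.
    ⊛-square-peel : ∀ f k → (f ⊛ f) (suc (suc k)) ≈ (1# + 1#) * (f 0 * f (suc (suc k))) + ((λ i → f (suc i)) ⊛ (λ i → f (suc i))) k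
    ⊛-square-peel f k = trans (+-congˡ (⊛-peelʳ (λ i → f (suc i)) f k))
      (solve 3 (λ a b s → a :* b :+ (s :+ b :* a) := (con (+ 1) :+ con (+ 1)) :* (a :* b) :+ s) refl (f 0) (f (suc (suc k))) _)

    module CharacteristicTwo (two : 1# + 1# ≈ 0#) where

      double≈0 : ∀ x → x + x ≈ 0#
      double≈0 x = trans (solve 1 (λ x → x :+ x := (con (+ 1) :+ con (+ 1)) :* x) refl x) (trans (*-congʳ two) (zeroˡ x))

      ⊛-square-shift : ∀ f k → (f ⊛ f) (suc (suc k)) ≈ ((λ i → f (suc i)) ⊛ (λ i → f (suc i))) k
      ⊛-square-shift f k = trans (⊛-square-peel f k) (trans (+-congʳ (trans (*-congʳ two) (zeroˡ _))) (+-identityˡ _))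

      ⊛-square-diagonal : ∀ f l → (f ⊛ f) (l ℕ.+ l) ≈ f l * f l
      ⊛-square-diagonal f zero    = refl
      ⊛-square-diagonal f (suc l) = trans (reflexive (≡.cong (λ k → (f ⊛ f) (suc k)) (ℕₚ.+-suc l l)))
        (trans (⊛-square-shift f (l ℕ.+ l)) (⊛-square-diagonal (λ i → f (suc i)) l))

      -- Frobenius: the square of f is Σ f_l² u^(2l), so coefficient `k` depends on f_(k/2) alone
      -- and vanishes for odd `k`.
      ⊛-square-determined : ∀ k f g → (∀ l → l ℕ.+ l ≡ k → f l ≈ g l) → (f ⊛ f) k ≈ (g ⊛ g) k
      ⊛-square-determined zero f g p = *-cong (p 0 ≡.refl) (p 0 ≡.refl)
      ⊛-square-determined (suc zero) f g p = trans (odd f) (sym (odd g))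
        where
        odd : ∀ f → f 0 * f 1 + f 1 * f 0 ≈ 0#
        odd f = trans (+-congˡ (*-comm _ _)) (double≈0 _)
      ⊛-square-determined (suc (suc k)) f g p = trans (⊛-square-shift f k) (trans
        (⊛-square-determined k (λ i → f (suc i)) (λ i → g (suc i)) (λ l e → p (suc l) (≡.trans (≡.cong suc (ℕₚ.+-suc l l)) (≡.cong (λ n → suc (suc n)) e))))
        (sym (⊛-square-shift g k)))

-- The characteristic polynomial through the characteristic series

module CharPoly where
  open RingPreliminaries
  open PowerSeries
  open Determinant
  open Pencil
  open Horner
  open Rings
  open import Data.Bool.Base using (Bool; if_then_else_; true; false)
  open import Data.List.Base using (List; []; _∷_)

  module CharacteristicPolynomial (B : CRing) where
    open CommutativeRing B hiding (zero)
    open Polynomials B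
    open PS B
    open Homogenisation B
    open CharacteristicSeries B
    open Kronecker B
    open Solver B using (solve; _:=_; _:+_; _:*_; :-_; con)
    private
      module S = CommutativeRing series
      module DS = DeterminantTheory series
      module L = Det {Pol} [] (1# ∷ []) _+P_ _*P_ negP
      coeffHom : OperationHom [] (1# ∷ []) _+P_ _*P_ negP series
      coeffHom = record { φ = coeff ; φ-0 = λ k → refl ; φ-1 = coeff-1 ; φ-+ = coeff-+ ; φ-* = coeff-* ; φ-neg = coeff-neg }
      module H = DetHom [] (1# ∷ []) _+P_ _*P_ negP series coeffHom

    module _ {n : ℕ} (mat : Fin n → Fin n → Carrier) where
      entry : Fin n → Fin n → Pol
      entry i j = (if does (i ≟ j) then X else []) -P constP (mat i j)

      private
        lin-shift : ∀ (b : Bool) m k → let d = if b then 1# else 0# in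
          coeff ((if b then X else []) -P constP m) k ≈ shifted d (- (m + d)) k
        lin-shift true m zero = solve 1 (λ m → con (+ 0) :+ :- m := con (+ 1) :* con (+ 1) :+ :- (m :+ con (+ 1))) refl m
        lin-shift true m (suc zero) = sym (trans (+-congʳ (const-⊛ 1# (lin 1# 1#) 1)) (trans (+-identityʳ _) (*-identityˡ _)))
        lin-shift true m (suc (suc k)) = sym (trans (+-congʳ (const-⊛ 1# (lin 1# 1#) (suc (suc k)))) (trans (+-identityʳ _) (*-identityˡ _)))
        lin-shift false m zero = solve 1 (λ m → :- m := con (+ 0) :* con (+ 1) :+ :- (m :+ con (+ 0))) refl m
        lin-shift false m (suc k) = sym (trans (+-congʳ (const-⊛ 0# (lin 1# 1#) (suc k))) (trans (+-identityʳ _) (zeroˡ _)))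

      -- x I - S = (1 + x) I - T for T = S + I, so the entries have the `shifted` form and
      -- `det-homogenise` applies.
      charPoly-coeff : ∀ k → coeff (L.det n entry) k ≈ horner n (charSeries n (λ i j → mat i j + δ i j)) k
      charPoly-coeff k = trans (H.φ-det n entry k) (trans
        (DS.det-cong n (λ i j → lin-shift (does (i ≟ j)) (mat i j)) k)
        (det-homogenise n δ (λ i j → - (mat i j + δ i j)) k))

-- Counting classes by recorded digits

module Counting where
  open import Data.Nat.Base using (_+_; _^_)
  open import Data.Fin.Base using (funToFin; finToFun)
  open import Data.Fin.Properties using (pigeonhole; finToFun-funToFin; <⇒≢)
  open import Data.List.Base using (List; []; _++_; map; length; upTo; lookup)
  open import Data.List.Properties using (length-++; length-map; length-upTo)
  open import Data.List.Relation.Unary.Any using (index)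
  open import Data.List.Relation.Unary.Any.Properties using (lookup-index)
  open import Data.List.Membership.Propositional using (_∈_)
  open import Data.List.Membership.Propositional.Properties using (∈-map⁺; ∈-++⁺ˡ; ∈-++⁺ʳ; ∈-upTo⁺)
  open import Data.Product.Base using (_×_; map₁)
  open ≡ using (refl; sym; trans; cong; cong₂; subst)

  total : ℕ → (ℕ → ℕ) → ℕ
  total zero    ℓ = 0
  total (suc K) ℓ = ℓ 0 + total K (λ k → ℓ (suc k))

  private
    at : ℕ → ℕ → ℕ × ℕ
    at = _,_

    positions : ℕ → (ℕ → ℕ) → List (ℕ × ℕ)
    positions zero    ℓ = []
    positions (suc K) ℓ = map (at 0) (upTo (ℓ 0)) ++ map (map₁ suc) (positions K (λ k → ℓ (suc k)))

    length-positions : ∀ K ℓ → length (positions K ℓ) ≡ total K ℓ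
    length-positions zero    ℓ = refl
    length-positions (suc K) ℓ = trans (length-++ (map (at 0) (upTo (ℓ 0))))
      (cong₂ _+_ (trans (length-map (at 0) (upTo (ℓ 0))) (length-upTo (ℓ 0)))
        (trans (length-map (map₁ suc) (positions K (λ k → ℓ (suc k)))) (length-positions K (λ k → ℓ (suc k)))))

    ∈-positions : ∀ K ℓ k i → k < K → i < ℓ k → (k , i) ∈ positions K ℓ
    ∈-positions (suc K) ℓ zero    i _       i<ℓ = ∈-++⁺ˡ (∈-map⁺ (at 0) (∈-upTo⁺ i<ℓ))
    ∈-positions (suc K) ℓ (suc k) i (s≤s p) i<ℓ =
      ∈-++⁺ʳ (map (at 0) (upTo (ℓ 0))) (∈-map⁺ (map₁ suc) (∈-positions K (λ k → ℓ (suc k)) k i p i<ℓ))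

  -- Pigeonhole on the functions from recorded positions to digits. Only decoding is asked of the
  -- code, so it may depend on the chosen representatives.
  family-bound : ∀ {A : Set} (p : ℕ) (code : A → ℕ → ℕ → Fin p) (K : ℕ) (ℓ : ℕ → ℕ) (Cong : A → A → Set) →
    (∀ a b → (∀ k i → k < K → i < ℓ k → code a k i ≡ code b k i) → Cong a b) →
    ∀ m (S : Fin m → A) → (∀ i j → i ≢ j → ¬ Cong (S i) (S j)) → m ≤ p ^ total K ℓ
  family-bound p code K ℓ Cong decode m S distinct = ℕₚ.≮⇒≥ λ p^t<m →
    let L = positions K ℓ
        encode = λ i → funToFin (λ x → code (S i) (proj₁ (lookup L x)) (proj₂ (lookup L x)))
        i , j , i<j , same = pigeonhole (subst (λ t → p ^ t < m) (sym (length-positions K ℓ)) p^t<m) encode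
        agree = λ k d k<K d<ℓ →
          let ∈L = ∈-positions K ℓ k d k<K d<ℓ
              x  = index ∈L
              eq = trans (sym (finToFun-funToFin _ x)) (trans (cong (λ c → finToFun c x) same) (finToFun-funToFin _ x))
          in subst (λ q → code (S i) (proj₁ q) (proj₂ q) ≡ code (S j) (proj₁ q) (proj₂ q)) (sym (lookup-index ∈L)) eq
    in distinct i j (<⇒≢ i<j) (decode (S i) (S j) agree)

  -- One scheme for two expansions: base 2 in ℤ, and base ρ for polynomials in ρ, where carries are
  -- re-expanded in ρ.
  module Digits {Z : Set} {p : ℕ} (digit : Z → Fin p) (next : Z → Z) (Congruent : ℕ → Z → Z → Set)
    (base : ∀ x y → Congruent 0 x y)
    (step : ∀ s x y → digit x ≡ digit y → Congruent s (next x) (next y) → Congruent (suc s) x y) where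

    digits : Z → ℕ → Fin p
    digits x zero    = digit x
    digits x (suc i) = digits (next x) i

    digits-agree : ∀ s x y → (∀ i → i < s → digits x i ≡ digits y i) → Congruent s x y
    digits-agree zero    x y eq = base x y
    digits-agree (suc s) x y eq = step s x y (eq 0 (s≤s z≤n)) (digits-agree s (next x) (next y) (λ i i<s → eq (suc i) (s≤s i<s)))

-- Remainders of integers

module IntDigits where
  open RingPreliminaries
  open Rings
  open import Data.Nat.Base using (NonZero)
  open import Data.Fin.Base using (fromℕ<)
  open import Data.Fin.Properties using (toℕ-fromℕ<; toℕ-injective)
  open import Data.Integer.Base using (∣_∣)
  open import Data.Integer.DivMod using (_/ℕ_; n%ℕd<d; a≡a%ℕn+[a/ℕn]*n)
  open import Data.Empty using (⊥)
  open ≡ using (refl; sym; trans; cong; cong₂; module ≡-Reasoning)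

  ℤ-ring : CRing
  ℤ-ring = ℤₚ.+-*-commutativeRing

  module Mod (m : ℕ) = Quotient ℤ-ring (+ m)

  open Solver ℤ-ring using (solve; _:=_; _:+_; _:*_; :-_; con)

  module _ (p : ℕ) .{{_ : NonZero p}} where

    digitℤ : ℤ → Fin p
    digitℤ x = fromℕ< (n%ℕd<d x p)

    digitℤ-/ : ∀ x → x ≡ + toℕ (digitℤ x) ℤ.+ + p ℤ.* (x /ℕ p)
    digitℤ-/ x = trans (a≡a%ℕn+[a/ℕn]*n x p)
      (cong₂ ℤ._+_ (cong +_ (sym (toℕ-fromℕ< (n%ℕd<d x p)))) (ℤₚ.*-comm (x /ℕ p) (+ p)))

  digitℤ-congruent : ∀ p .{{_ : NonZero p}} x y → digitℤ p x ≡ digitℤ p y → x ℤ.+ ℤ.- y ≡ + p ℤ.* (x /ℕ p ℤ.+ ℤ.- (y /ℕ p))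
  digitℤ-congruent p x y eq = trans (cong₂ (λ a b → a ℤ.+ ℤ.- b) (digitℤ-/ p x) (trans (digitℤ-/ p y) (cong (λ d → + toℕ d ℤ.+ + p ℤ.* (y /ℕ p)) (sym eq))))
    (solve 4 (λ r p a b → (r :+ p :* a) :+ :- (r :+ p :* b) := p :* (a :+ :- b)) refl (+ toℕ (digitℤ p x)) (+ p) (x /ℕ p) (y /ℕ p))

  1≢2* : ∀ z → + 1 ≡ + 2 ℤ.* z → ⊥
  1≢2* z eq = odd (∣ z ∣) (trans (cong ∣_∣ eq) (ℤₚ.abs-* (+ 2) z))
    where
    odd : ∀ n → 1 ≡ 2 ℕ.* n → ⊥
    odd zero ()
    odd (suc n) e with trans e (cong suc (ℕₚ.+-suc n (n ℕ.+ 0)))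
    ... | ()

  -- Through this a lowest digit that was not recorded is recovered from a congruence modulo 2.
  digitℤ-cong₂ : ∀ x y → Mod._~_ 2 x y → digitℤ 2 x ≡ digitℤ 2 y
  digitℤ-cong₂ x y (congruent d p) = toℕ-injective (cases (digitℤ 2 x) (digitℤ 2 y) (digitℤ-/ 2 x) (digitℤ-/ 2 y))
    where
    cases : (r s : Fin 2) → x ≡ + toℕ r ℤ.+ + 2 ℤ.* (x /ℕ 2) → y ≡ + toℕ s ℤ.+ + 2 ℤ.* (y /ℕ 2) → toℕ r ≡ toℕ s
    cases zero zero _ _ = refl
    cases (suc zero) (suc zero) _ _ = refl
    cases zero (suc zero) e f = ⊥-elim (1≢2* (x /ℕ 2 ℤ.+ ℤ.- (y /ℕ 2) ℤ.+ ℤ.- d) (begin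
      + 1 ≡⟨ solve 2 (λ a b → con (+ 1) := con (+ 2) :* (a :+ :- b) :+ :- ((con (+ 0) :+ con (+ 2) :* a) :+ :- (con (+ 1) :+ con (+ 2) :* b))) refl (x /ℕ 2) (y /ℕ 2) ⟩
      + 2 ℤ.* (x /ℕ 2 ℤ.+ ℤ.- (y /ℕ 2)) ℤ.+ ℤ.- ((+ 0 ℤ.+ + 2 ℤ.* (x /ℕ 2)) ℤ.+ ℤ.- (+ 1 ℤ.+ + 2 ℤ.* (y /ℕ 2)))
        ≡⟨ cong (λ t → + 2 ℤ.* (x /ℕ 2 ℤ.+ ℤ.- (y /ℕ 2)) ℤ.+ ℤ.- t) (trans (sym (cong₂ (λ a b → a ℤ.+ ℤ.- b) e f)) p) ⟩
      + 2 ℤ.* (x /ℕ 2 ℤ.+ ℤ.- (y /ℕ 2)) ℤ.+ ℤ.- (+ 2 ℤ.* d)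
        ≡⟨ solve 2 (λ a d → con (+ 2) :* a :+ :- (con (+ 2) :* d) := con (+ 2) :* (a :+ :- d)) refl (x /ℕ 2 ℤ.+ ℤ.- (y /ℕ 2)) d ⟩
      + 2 ℤ.* (x /ℕ 2 ℤ.+ ℤ.- (y /ℕ 2) ℤ.+ ℤ.- d) ∎))
      where open ≡-Reasoning
    cases (suc zero) zero e f = ⊥-elim (1≢2* (d ℤ.+ ℤ.- (x /ℕ 2 ℤ.+ ℤ.- (y /ℕ 2))) (begin
      + 1 ≡⟨ solve 2 (λ a b → con (+ 1) := ((con (+ 1) :+ con (+ 2) :* a) :+ :- (con (+ 0) :+ con (+ 2) :* b)) :+ :- (con (+ 2) :* (a :+ :- b))) refl (x /ℕ 2) (y /ℕ 2) ⟩
      ((+ 1 ℤ.+ + 2 ℤ.* (x /ℕ 2)) ℤ.+ ℤ.- (+ 0 ℤ.+ + 2 ℤ.* (y /ℕ 2))) ℤ.+ ℤ.- (+ 2 ℤ.* (x /ℕ 2 ℤ.+ ℤ.- (y /ℕ 2)))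
        ≡⟨ cong (λ t → t ℤ.+ ℤ.- (+ 2 ℤ.* (x /ℕ 2 ℤ.+ ℤ.- (y /ℕ 2)))) (trans (sym (cong₂ (λ a b → a ℤ.+ ℤ.- b) e f)) p) ⟩
      + 2 ℤ.* d ℤ.+ ℤ.- (+ 2 ℤ.* (x /ℕ 2 ℤ.+ ℤ.- (y /ℕ 2)))
        ≡⟨ solve 2 (λ a d → con (+ 2) :* d :+ :- (con (+ 2) :* a) := con (+ 2) :* (d :+ :- a)) refl (x /ℕ 2 ℤ.+ ℤ.- (y /ℕ 2)) d ⟩
      + 2 ℤ.* (d ℤ.+ ℤ.- (x /ℕ 2 ℤ.+ ℤ.- (y /ℕ 2))) ∎))
      where open ≡-Reasoning

-- The case q = 2: the core determinant modulo 4

module RealSeries where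
  open RingPreliminaries
  open PowerSeries
  open Determinant
  open Hermitian
  open Pencil
  open Rings
  open Residue
  open CoreHom
  open CharPoly
  open Horner
  open LowCoeffs
  open IntDigits
  open import Data.Integer.DivMod using (_/ℕ_)
  open import Data.Product.Base using (_×_)
  open ≡ using (refl; sym; trans; cong; cong₂; subst; module ≡-Reasoning)

  open Solver ℤ-ring using (solve; _:=_; _:+_; _:*_; :-_; con)
  open PS ℤ-ring using (Series; _⊛_)
  open Kronecker ℤ-ring using (δ; δ-diag; δ-off)

  module M₂ = Mod 2
  module M₄ = Mod 4
  open M₂ using () renaming (_~_ to _~₂_)
  open M₄ using () renaming (_~_ to _~₄_)
  module Z₂ = CommutativeRing M₂.quotient
  module Z₄ = CommutativeRing M₄.quotient

  IsEven : ℤ → Set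
  IsEven x = ∃ λ d → x ≡ + 2 ℤ.* d

  ~₄⇒~₂ : ∀ {x y} → x ~₄ y → x ~₂ y
  ~₄⇒~₂ (congruent d p) = congruent (+ 2 ℤ.* d) (trans p (solve 1 (λ d → con (+ 4) :* d := con (+ 2) :* (con (+ 2) :* d)) refl d))

  even⇒~0 : ∀ {x} → IsEven x → x ~₂ + 0
  even⇒~0 {x} (d , p) = congruent d (trans (ℤₚ.+-identityʳ x) p)

  double-~ : ∀ {x y} → x ~₂ y → + 2 ℤ.* x ~₄ + 2 ℤ.* y
  double-~ {x} {y} (congruent d p) = congruent d (trans (solve 2 (λ x y → con (+ 2) :* x :+ :- (con (+ 2) :* y) := con (+ 2) :* (x :+ :- y)) refl x y)
    (trans (cong (+ 2 ℤ.*_) p) (solve 1 (λ d → con (+ 2) :* (con (+ 2) :* d) := con (+ 4) :* d) refl d)))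

  halve-~ : ∀ {x y} → + 2 ℤ.* x ~₄ + 2 ℤ.* y → x ~₂ y
  halve-~ {x} {y} (congruent d p) = congruent d (ℤₚ.*-cancelˡ-≡ (+ 2) _ _ (trans
    (solve 2 (λ x y → con (+ 2) :* (x :+ :- y) := con (+ 2) :* x :+ :- (con (+ 2) :* y)) refl x y)
    (trans p (solve 1 (λ d → con (+ 4) :* d := con (+ 2) :* (con (+ 2) :* d)) refl d))))

  even-resp : ∀ {x y} → x ~₄ y → IsEven x → IsEven y
  even-resp {x} {y} (congruent k p) (d , q) = d ℤ.+ ℤ.- (+ 2 ℤ.* k) , (begin
    y                                        ≡⟨ solve 2 (λ x y → y := x :+ :- (x :+ :- y)) refl x y ⟩
    x ℤ.+ ℤ.- (x ℤ.+ ℤ.- y)                  ≡⟨ cong₂ (λ a b → a ℤ.+ ℤ.- b) q p ⟩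
    + 2 ℤ.* d ℤ.+ ℤ.- (+ 4 ℤ.* k)            ≡⟨ solve 2 (λ d k → con (+ 2) :* d :+ :- (con (+ 4) :* k) := con (+ 2) :* (d :+ :- (con (+ 2) :* k))) refl d k ⟩
    + 2 ℤ.* (d ℤ.+ ℤ.- (+ 2 ℤ.* k))          ∎)
    where open ≡-Reasoning

  even-ideal : IsIdeal M₄.quotient IsEven
  even-ideal = record
    { resp = even-resp
    ; +-mem = λ { (d , p) (e , q) → d ℤ.+ e , trans (cong₂ ℤ._+_ p q) (sym (ℤₚ.*-distribˡ-+ (+ 2) d e)) }
    ; *-mem = λ { x (d , p) → x ℤ.* d , trans (cong (x ℤ.*_) p) (solve 2 (λ x d → x :* (con (+ 2) :* d) := con (+ 2) :* (x :* d)) refl x d) } }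

  even-² : ∀ {x y} → IsEven x → IsEven y → x ℤ.* y ~₄ + 0
  even-² {x} {y} (d , p) (e , q) = congruent (d ℤ.* e) (trans (ℤₚ.+-identityʳ _) (trans (cong₂ ℤ._*_ p q)
    (solve 2 (λ d e → con (+ 2) :* d :* (con (+ 2) :* e) := con (+ 4) :* (d :* e)) refl d e)))

  square-~₂ : ∀ x → x ℤ.* x ~₂ x
  square-~₂ x = cases (digitℤ 2 x) (x /ℕ 2) (digitℤ-/ 2 x)
    where
    cases : (r : Fin 2) (y : ℤ) → x ≡ + Data.Fin.Base.toℕ r ℤ.+ + 2 ℤ.* y → x ℤ.* x ~₂ x
    cases zero       y e = congruent (+ 2 ℤ.* y ℤ.* y ℤ.+ ℤ.- y) (trans (cong (λ x → x ℤ.* x ℤ.+ ℤ.- x) e)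
      (solve 1 (λ y → (con (+ 0) :+ con (+ 2) :* y) :* (con (+ 0) :+ con (+ 2) :* y) :+ :- (con (+ 0) :+ con (+ 2) :* y) :=
        con (+ 2) :* (con (+ 2) :* y :* y :+ :- y)) refl y))
    cases (suc zero) y e = congruent (+ 2 ℤ.* y ℤ.* y ℤ.+ y) (trans (cong (λ x → x ℤ.* x ℤ.+ ℤ.- x) e)
      (solve 1 (λ y → (con (+ 1) :+ con (+ 2) :* y) :* (con (+ 1) :+ con (+ 2) :* y) :+ :- (con (+ 1) :+ con (+ 2) :* y) :=
        con (+ 2) :* (con (+ 2) :* y :* y :+ y)) refl y))

  open Squares ℤ-ring using (⊛-square-peel)

  -- Off-diagonal products occur twice, and for the middle one both factors of x² - y² = (x - y)(x +
  -- y) are even.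
  ⊛-square-~₄ : ∀ k f g → (∀ a → a ℕ.≤ k → f a ~₂ g a) → (f ⊛ f) k ~₄ (g ⊛ g) k
  ⊛-square-~₄ zero f g p = congruent (d ℤ.* (f 0 ℤ.+ ℤ.- (+ 1 ℤ.* d))) (begin
      x ℤ.* x ℤ.+ ℤ.- (y ℤ.* y)                    ≡⟨ solve 2 (λ x y → x :* x :+ :- (y :* y) := (x :+ :- y) :* (con (+ 2) :* x :+ :- (x :+ :- y))) refl x y ⟩
      (x ℤ.+ ℤ.- y) ℤ.* (+ 2 ℤ.* x ℤ.+ ℤ.- (x ℤ.+ ℤ.- y)) ≡⟨ cong (λ t → t ℤ.* (+ 2 ℤ.* x ℤ.+ ℤ.- t)) e ⟩
      + 2 ℤ.* d ℤ.* (+ 2 ℤ.* x ℤ.+ ℤ.- (+ 2 ℤ.* d))       ≡⟨ solve 2 (λ x d → con (+ 2) :* d :* (con (+ 2) :* x :+ :- (con (+ 2) :* d)) := con (+ 4) :* (d :* (x :+ :- (con (+ 1) :* d)))) refl x d ⟩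
      + 4 ℤ.* (d ℤ.* (f 0 ℤ.+ ℤ.- (+ 1 ℤ.* d)))         ∎)
    where
    open ≡-Reasoning
    x y d : ℤ
    x = f 0
    y = g 0
    d = Congruent.factor (p 0 z≤n)
    e : x ℤ.+ ℤ.- y ≡ + 2 ℤ.* d
    e = Congruent.multiple (p 0 z≤n)
  ⊛-square-~₄ (suc zero) f g p = Z₄.trans (M₄.≈⇒~ (twice f)) (Z₄.trans
    (double-~ (Z₂.*-cong (p 0 z≤n) (p 1 (s≤s z≤n)))) (M₄.≈⇒~ (sym (twice g))))
    where
    twice : ∀ f → f 0 ℤ.* f 1 ℤ.+ f 1 ℤ.* f 0 ≡ + 2 ℤ.* (f 0 ℤ.* f 1)
    twice f = solve 2 (λ a b → a :* b :+ b :* a := con (+ 2) :* (a :* b)) refl (f 0) (f 1)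
  ⊛-square-~₄ (suc (suc k)) f g p = Z₄.trans (M₄.≈⇒~ (⊛-square-peel f k)) (Z₄.trans
    (Z₄.+-cong (double-~ (Z₂.*-cong (p 0 z≤n) (p (suc (suc k)) ℕₚ.≤-refl)))
      (⊛-square-~₄ k (λ i → f (suc i)) (λ i → g (suc i)) (λ a a≤k → p (suc a) (s≤s (ℕₚ.m≤n⇒m≤1+n a≤k)))))
    (M₄.≈⇒~ (sym (⊛-square-peel g k))))

  -- The top coefficient enters the square only as 2 f₀ f_j, and lower coefficients fix all the rest
  -- modulo 4. Since f₀ is odd, f_j is recovered modulo 2.
  ⊛-square-cancel : ∀ k f g → (∀ a → a ℕ.< suc (suc k) → f a ~₂ g a) → f 0 ~₂ + 1 → g 0 ~₂ + 1 →
    (f ⊛ f) (suc (suc k)) ~₄ (g ⊛ g) (suc (suc k)) → f (suc (suc k)) ~₂ g (suc (suc k))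
  ⊛-square-cancel k f g p f₀ g₀ eq = Z₂.trans (Z₂.sym (unit f f₀)) (Z₂.trans (halve-~ doubled) (unit g g₀))
    where
    j : ℕ
    j = suc (suc k)
    unit : ∀ h → h 0 ~₂ + 1 → h 0 ℤ.* h j ~₂ h j
    unit h h₀ = Z₂.trans (Z₂.*-congʳ h₀) (Z₂.*-identityˡ (h j))
    doubled : + 2 ℤ.* (f 0 ℤ.* f j) ~₄ + 2 ℤ.* (g 0 ℤ.* g j)
    doubled = ∙-cancelʳ _ _ _ (Z₄.trans (Z₄.sym (M₄.≈⇒~ (⊛-square-peel f k))) (Z₄.trans eq (Z₄.trans (M₄.≈⇒~ (⊛-square-peel g k))
      (Z₄.+-congˡ {+ 2 ℤ.* (g 0 ℤ.* g j)} (Z₄.sym (⊛-square-~₄ k (λ i → f (suc i)) (λ i → g (suc i)) (λ a a≤k → p (suc a) (s≤s (s≤s a≤k)))))))))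
      where open import Algebra.Properties.AbelianGroup Z₄.+-abelianGroup using (∙-cancelʳ)

  -- For q = 2 the residue ring is ℤ/4 and π = 2 is real, so π̄/π = 1 and hence c = 1.
  residueStructure₄ : ResidueStructure M₄.quotient
  residueStructure₄ = record
    { 𝔪 = IsEven ; 𝔪-ideal = even-ideal ; 𝔪²≈0 = even-² ; 2∈𝔪 = + 1 , refl ; c = + 1 ; c~1 = + 0 , refl }

  module R₄ = ResidueRing M₄.quotient residueStructure₄

  module RealMatrix {n : ℕ} (S : Two.Seidel (suc n)) where
    open Two.Seidel S

    T : Fin (suc n) → Fin (suc n) → ℤ
    T i j = mat i j ℤ.+ δ i j

    private
      unit-dec : ∀ i j → Dec (i ≡ j) → T i j ≡ + 1 ⊎ T i j ≡ -[1+ 0 ]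
      unit-dec i .i (yes refl) = inj₁ (cong₂ ℤ._+_ (diag i) (δ-diag i))
      unit-dec i j (no i≢j) with offdiag i j i≢j
      ... | inj₁ p = inj₁ (cong₂ ℤ._+_ p (δ-off i j i≢j))
      ... | inj₂ p = inj₂ (cong₂ ℤ._+_ p (δ-off i j i≢j))

      unit : ∀ i j → T i j ≡ + 1 ⊎ T i j ≡ -[1+ 0 ]
      unit i j = unit-dec i j (i ≟ j)

      half : ∀ {a b c} → a ≡ + 1 ⊎ a ≡ -[1+ 0 ] → b ≡ + 1 ⊎ b ≡ -[1+ 0 ] → c ≡ + 1 ⊎ c ≡ -[1+ 0 ] → ∃ λ d → + 2 ℤ.* d ≡ a ℤ.* b ℤ.+ ℤ.- c
      half (inj₁ refl) (inj₁ refl) (inj₁ refl) = + 0 , refl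
      half (inj₁ refl) (inj₁ refl) (inj₂ refl) = + 1 , refl
      half (inj₁ refl) (inj₂ refl) (inj₁ refl) = -[1+ 0 ] , refl
      half (inj₁ refl) (inj₂ refl) (inj₂ refl) = + 0 , refl
      half (inj₂ refl) (inj₁ refl) (inj₁ refl) = -[1+ 0 ] , refl
      half (inj₂ refl) (inj₁ refl) (inj₂ refl) = + 0 , refl
      half (inj₂ refl) (inj₂ refl) (inj₁ refl) = + 0 , refl
      half (inj₂ refl) (inj₂ refl) (inj₂ refl) = + 1 , refl

      unit-square : ∀ {a} → a ≡ + 1 ⊎ a ≡ -[1+ 0 ] → a ℤ.* a ≡ + 1
      unit-square (inj₁ refl) = refl
      unit-square (inj₂ refl) = refl

      unit-~1 : ∀ {a} → a ≡ + 1 ⊎ a ≡ -[1+ 0 ] → IsEven (a ℤ.+ ℤ.- + 1)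
      unit-~1 (inj₁ refl) = + 0 , refl
      unit-~1 (inj₂ refl) = -[1+ 0 ] , refl

      δ-sym : ∀ {n} (i j : Fin n) → δ i j ≡ δ j i
      δ-sym zero    zero    = refl
      δ-sym zero    (suc j) = refl
      δ-sym (suc i) zero    = refl
      δ-sym (suc i) (suc j) = δ-sym i j

    T-diag : ∀ i → T i i ≡ + 1
    T-diag i = cong₂ ℤ._+_ (diag i) (δ-diag i)

    T-sym : ∀ i j → T i j ≡ T j i
    T-sym i j = cong₂ ℤ._+_ (symm j i) (δ-sym i j)

    T-unit : ∀ i j → T i j ℤ.* T j i ≡ + 1
    T-unit i j = trans (cong (T i j ℤ.*_) (T-sym j i)) (unit-square (unit i j))

    B : Fin n → Fin n → ℤ
    B i j = proj₁ (half (unit (suc i) zero) (unit zero (suc j)) (unit (suc i) (suc j)))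

    2B : ∀ i j → + 2 ℤ.* B i j ≡ T (suc i) zero ℤ.* T zero (suc j) ℤ.+ ℤ.- T (suc i) (suc j)
    2B i j = proj₂ (half (unit (suc i) zero) (unit zero (suc j)) (unit (suc i) (suc j)))

    private
      B-sym : ∀ i j → B i j ≡ B j i
      B-sym i j = ℤₚ.*-cancelˡ-≡ (+ 2) _ _ (trans (2B i j) (trans
        (cong₂ (λ a b → a ℤ.+ ℤ.- b) (trans (cong₂ ℤ._*_ (T-sym _ _) (T-sym _ _)) (ℤₚ.*-comm (T zero (suc i)) (T (suc j) zero))) (T-sym _ _)) (sym (2B j i))))

      B-diag : ∀ i → B i i ≡ + 0
      B-diag i = ℤₚ.*-cancelˡ-≡ (+ 2) _ _ (trans (2B i i) (cong₂ (λ a b → a ℤ.+ ℤ.- b) (T-unit (suc i) zero) (T-diag (suc i))))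

    open CharacteristicSeries ℤ-ring using (charSeries)
    open CharacteristicSeries.Reduction ℤ-ring (+ 2) n T B (T-diag zero) 2B public using (quotient; charSeries-coeff; coreDet; borderedDet)

    a : Series
    a = charSeries (suc n) T

    module V = R₄.Seidel n T B (λ i j → M₄.≈⇒~ (T-sym i j)) (λ i j → unit-~1 (unit i j)) (λ i → M₄.≈⇒~ (T-unit (suc i) zero))
      (λ i j → M₄.≈⇒~ (trans (ℤₚ.*-identityˡ _) (B-sym i j))) (λ i → M₄.≈⇒~ (B-diag i))

    coreDet-~₄ : ∀ k → coreDet k ~₄ V.coreDet k
    coreDet-~₄ = hom-coreDet M₄.project n T B

    borderedDet-~₄ : ∀ k → borderedDet k ~₄ V.borderedDet k
    borderedDet-~₄ = hom-borderedDet M₄.project n T B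

    a-low : ∀ k → k ℕ.≤ 2 → a k ≡ LowDegree.low ℤ-ring (suc n) (+ 0) k
    a-low = LowDegree.charSeries-low ℤ-ring (suc n) T T-diag (λ i j _ → T-unit i j)

    quotient-parity : ∀ k → quotient k ~₂ coreDet k
    quotient-parity k = congruent (E₁ ℤ.+ ℤ.- E ℤ.+ β)
      (solve 3 (λ e f b → (con (+ 2) :* f :+ :- e :+ con (+ 2) :* b) :+ :- e := con (+ 2) :* (f :+ :- e :+ b)) refl E E₁ β)
      where
      E E₁ β : ℤ
      E = coreDet k
      E₁ = coreDet (suc k)
      β = borderedDet (suc k)

    open CharacteristicPolynomial ℤ-ring using (charPoly-coeff)
    open Homogenisation ℤ-ring using (horner)

    charPoly-horner : ∀ k → ZP.coeff (Two.charPoly S) k ≡ horner (suc n) a k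
    charPoly-horner = charPoly-coeff mat

  -- The core has odd size, so its determinant is even, and the other two terms of `quotient` carry
  -- the factor π = 2.
  quotient-even : ∀ {m} (S : Two.Seidel (suc (suc (double m)))) k → IsEven (RealMatrix.quotient S k)
  quotient-even {m} S k = even-~₂ (Z₂.trans (quotient-parity k) (even⇒~0 (even-resp (Z₄.sym (coreDet-~₄ k)) (R₄.H.det-odd m V.core-even k))))
    where
    open RealMatrix S
    even-~₂ : ∀ {x} → x ~₂ + 0 → IsEven x
    even-~₂ {x} (congruent d p) = d , trans (sym (ℤₚ.+-identityʳ x)) p

  sgn : ℕ → ℤ
  sgn zero    = + 1
  sgn (suc m) = ℤ.- sgn m

  sgn-quotient : ∀ m → alternatingSign M₄.quotient m ≡ sgn m
  sgn-quotient = alternatingSign-unique M₄.quotient sgn refl (λ _ → refl)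

  sgn-square : ∀ m → sgn m ℤ.* sgn m ≡ + 1
  sgn-square zero    = refl
  sgn-square (suc m) = trans (solve 1 (λ s → :- s :* :- s := s :* s) refl (sgn m)) (sgn-square m)

  module OddOrder {m : ℕ} (S : Two.Seidel (suc (double m))) where
    open RealMatrix S
    private
      module P₄ = PS M₄.quotient
      root : ∃ λ P → R₄.H._~1 P × V.coreDet P₄.≋ R₄.H.sign m P₄.⊛ (P P₄.⊛ PS.Rescale.rescale M₄.quotient (+ 1) P)
      root = R₄.H.det-even m V.core-even

    -- Elements of ℤ/4 are represented by integers, so the root over ℤ/4 is already an integer
    -- series.
    P : Series
    P = proj₁ root

    sq : Series
    sq = P ⊛ P

    P₀ : P 0 ~₂ + 1
    P₀ = congruent (proj₁ (proj₁ (proj₂ root))) (proj₂ (proj₁ (proj₂ root)))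

    private
      rescale-P : ∀ k → PS.Rescale.rescale M₄.quotient (+ 1) P k ~₄ P k
      rescale-P k = Z₄.trans (Z₄.*-congʳ {P k} (^-1 k)) (Z₄.*-identityˡ (P k))
        where
        open import Algebra.Properties.Semiring.Exp Z₄.semiring using (_^_)
        ^-1 : ∀ k → (+ 1) ^ k ~₄ + 1
        ^-1 zero    = Z₄.refl
        ^-1 (suc k) = Z₄.trans (Z₄.*-identityˡ ((+ 1) ^ k)) (^-1 k)

    private
      τP : Series
      τP = PS.Rescale.rescale M₄.quotient (+ 1) P

      V-square : ∀ k → V.coreDet k ~₄ (R₄.H.sign m P₄.⊛ (P P₄.⊛ τP)) k
      V-square = proj₂ (proj₂ root)

      signed : ∀ k → (R₄.H.sign m P₄.⊛ (P P₄.⊛ τP)) k ~₄ sgn m ℤ.* (P P₄.⊛ τP) k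
      signed k = subst (λ s → (R₄.H.sign m P₄.⊛ (P P₄.⊛ τP)) k ~₄ s ℤ.* (P P₄.⊛ τP) k) (sgn-quotient m) (R₄.sign-⊛ m (P P₄.⊛ τP) k)

      unscaled : ∀ k → (P P₄.⊛ τP) k ~₄ (P P₄.⊛ P) k
      unscaled = P₄.⊛-cong {P} {P} {τP} {P} (λ _ → Z₄.refl) rescale-P

      lifted : ∀ k → (P ⊛ P) k ~₄ (P P₄.⊛ P) k
      lifted = SeriesHom.map-⊛ M₄.project P P

    -- With c = 1 the twist τ is trivial modulo 4, so P τ(P) is the square of P.
    coreDet-square : ∀ k → coreDet k ~₄ sgn m ℤ.* sq k
    coreDet-square k = Z₄.trans (coreDet-~₄ k) (Z₄.trans (V-square k) (Z₄.trans (signed k)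
      (Z₄.*-congˡ {sgn m} (Z₄.trans (unscaled k) (Z₄.sym (lifted k))))))

    sgn-~₂ : sgn m ~₂ + 1
    sgn-~₂ = Z₂.trans (Z₂.sym (square-~₂ (sgn m))) (M₂.≈⇒~ (sgn-square m))

    quotient-square-parity : ∀ k → quotient k ~₂ sq k
    quotient-square-parity k = Z₂.trans (quotient-parity k) (Z₂.trans (~₄⇒~₂ (coreDet-square k))
      (Z₂.trans (Z₂.*-congʳ {sq k} sgn-~₂) (Z₂.*-identityˡ (sq k))))

    -- The bordered matrix has odd size, so β is even and 2 β vanishes modulo 4; both core
    -- determinants are signed squares.
    quotient-square : ∀ k → quotient k ~₄ sgn m ℤ.* (+ 2 ℤ.* sq (suc k) ℤ.+ ℤ.- sq k)
    quotient-square k = combine (coreDet (suc k)) (coreDet k) (borderedDet (suc k)) (coreDet-square (suc k)) (coreDet-square k)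
        (even⇒~0 (even-resp (Z₄.sym (borderedDet-~₄ (suc k))) (R₄.H.det-odd m V.bordered-even (suc k))))
      where
      combine : ∀ E₁ E β → E₁ ~₄ sgn m ℤ.* sq (suc k) → E ~₄ sgn m ℤ.* sq k → β ~₂ + 0 →
        + 2 ℤ.* E₁ ℤ.+ ℤ.- E ℤ.+ + 2 ℤ.* β ~₄ sgn m ℤ.* (+ 2 ℤ.* sq (suc k) ℤ.+ ℤ.- sq k)
      combine E₁ E β p q r = Z₄.trans {+ 2 ℤ.* E₁ ℤ.+ ℤ.- E ℤ.+ + 2 ℤ.* β} {+ 2 ℤ.* (sgn m ℤ.* sq (suc k)) ℤ.+ ℤ.- (sgn m ℤ.* sq k) ℤ.+ + 2 ℤ.* + 0}
        (Z₄.+-cong {+ 2 ℤ.* E₁ ℤ.+ ℤ.- E} {+ 2 ℤ.* (sgn m ℤ.* sq (suc k)) ℤ.+ ℤ.- (sgn m ℤ.* sq k)}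
          (Z₄.+-cong {+ 2 ℤ.* E₁} (Z₄.*-congˡ {+ 2} p) (Z₄.-‿cong q)) (double-~ r))
        (M₄.≈⇒~ (solve 3 (λ s f e → con (+ 2) :* (s :* f) :+ :- (s :* e) :+ con (+ 2) :* con (+ 0) := s :* (con (+ 2) :* f :+ :- e)) refl (sgn m) (sq (suc k)) (sq k)))

-- The case q = 2: recovering digits and counting

module RealBound where
  open RingPreliminaries
  open PowerSeries
  open Hermitian using (double)
  open Rings
  open CoreHom
  open Horner
  open Counting
  open IntDigits
  open RealSeries
  open import Data.Nat.Base using (_^_)
  open import Data.Nat.Divisibility as ℕD using (_∣_; divides)
  import Data.Integer.Divisibility.Signed as ℤS
  open import Data.Integer.DivMod using (_/ℕ_)
  open ≡ using (refl; sym; trans; cong; cong₂; subst; module ≡-Reasoning)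

  open Solver ℤ-ring using (solve; _:=_; _:+_; _:*_; :-_; con)
  open PS ℤ-ring using (Series; _⊛_)

  <∸⇒+< : ∀ i e k → i < e ∸ k → i ℕ.+ k < e
  <∸⇒+< i e       zero    p = subst (_< e) (sym (ℕₚ.+-identityʳ i)) p
  <∸⇒+< i (suc e) (suc k) p = subst (_< suc e) (sym (ℕₚ.+-suc i k)) (s≤s (<∸⇒+< i e k p))

  +<⇒<∸ : ∀ i {e} k → i ℕ.+ k < e → i < e ∸ k
  +<⇒<∸ i k p = ℕₚ.m+n≤o⇒m≤o∸n (suc i) p

  CongruentPow : ℕ → ℤ → ℤ → Set
  CongruentPow s = Congruent ℤ-ring (+ (2 ^ s))

  private
    digit-step : ∀ s x y → digitℤ 2 x ≡ digitℤ 2 y → CongruentPow s (x /ℕ 2) (y /ℕ 2) → CongruentPow (suc s) x y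
    digit-step s x y eq (congruent d p) = congruent d (begin
      x ℤ.+ ℤ.- y                         ≡⟨ digitℤ-congruent 2 x y eq ⟩
      + 2 ℤ.* (x /ℕ 2 ℤ.+ ℤ.- (y /ℕ 2))   ≡⟨ cong (+ 2 ℤ.*_) p ⟩
      + 2 ℤ.* (+ (2 ^ s) ℤ.* d)           ≡⟨ sym (ℤₚ.*-assoc (+ 2) (+ (2 ^ s)) d) ⟩
      + 2 ℤ.* + (2 ^ s) ℤ.* d             ≡⟨ cong (ℤ._* d) (sym (ℤₚ.pos-* 2 (2 ^ s))) ⟩
      + (2 ^ suc s) ℤ.* d                 ∎)
      where open ≡-Reasoning

  open Digits (digitℤ 2) (_/ℕ 2) CongruentPow (λ x y → congruent (x ℤ.+ ℤ.- y) (sym (ℤₚ.*-identityˡ _))) digit-step public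

  digit-~₂ : ∀ {x y} → digits x 0 ≡ digits y 0 → M₂._~_ x y
  digit-~₂ {x} {y} eq = congruent (x /ℕ 2 ℤ.+ ℤ.- (y /ℕ 2)) (digitℤ-congruent 2 x y eq)

  private
    q : ∀ {n} → Two.Seidel (suc n) → ℕ → ℤ
    q S = RealMatrix.quotient S

    open import Algebra.Properties.Semiring.Exp (CommutativeRing.semiring ℤ-ring) using () renaming (_^_ to _^ℤ_)

    pow : ∀ k → (+ 2) ^ℤ k ≡ + (2 ^ k)
    pow zero    = refl
    pow (suc k) = trans (cong (+ 2 ℤ.*_) (pow k)) (sym (ℤₚ.pos-* 2 (2 ^ k)))

    scale-congruent : ∀ e k x y → CongruentPow (e ∸ k) x y → CongruentPow e (+ (2 ^ k) ℤ.* x) (+ (2 ^ k) ℤ.* y)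
    scale-congruent e k x y (congruent d p) = congruent (+ (2 ^ r) ℤ.* d) (begin
      + (2 ^ k) ℤ.* x ℤ.+ ℤ.- (+ (2 ^ k) ℤ.* y)   ≡⟨ solve 3 (λ c x y → c :* x :+ :- (c :* y) := c :* (x :+ :- y)) refl (+ (2 ^ k)) x y ⟩
      + (2 ^ k) ℤ.* (x ℤ.+ ℤ.- y)                 ≡⟨ cong (+ (2 ^ k) ℤ.*_) p ⟩
      + (2 ^ k) ℤ.* (+ (2 ^ (e ∸ k)) ℤ.* d)       ≡⟨ sym (ℤₚ.*-assoc (+ (2 ^ k)) (+ (2 ^ (e ∸ k))) d) ⟩
      + (2 ^ k) ℤ.* + (2 ^ (e ∸ k)) ℤ.* d         ≡⟨ cong (ℤ._* d) (trans (sym (ℤₚ.pos-* (2 ^ k) (2 ^ (e ∸ k)))) (cong +_ powers)) ⟩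
      + (2 ^ e ℕ.* 2 ^ r) ℤ.* d                   ≡⟨ cong (ℤ._* d) (ℤₚ.pos-* (2 ^ e) (2 ^ r)) ⟩
      + (2 ^ e) ℤ.* + (2 ^ r) ℤ.* d               ≡⟨ ℤₚ.*-assoc (+ (2 ^ e)) (+ (2 ^ r)) d ⟩
      + (2 ^ e) ℤ.* (+ (2 ^ r) ℤ.* d)             ∎)
      where
      open ≡-Reasoning
      -- Truncated subtraction makes r = 0 for k ≤ e. For k > e no digits are asked for, and 2^r is
      -- the surplus of 2^k over 2^e.
      r : ℕ
      r = (k ℕ.+ (e ∸ k)) ∸ e
      powers : 2 ^ k ℕ.* 2 ^ (e ∸ k) ≡ 2 ^ e ℕ.* 2 ^ r
      powers = trans (sym (ℕₚ.^-distribˡ-+-* 2 k (e ∸ k))) (trans (cong (2 ^_) (sym (ℕₚ.m+[n∸m]≡n (ℕₚ.m≤n+m∸n e k)))) (ℕₚ.^-distribˡ-+-* 2 e r))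

  module _ {n : ℕ} (e : ℕ) (S S′ : Two.Seidel (suc n))
    (agree : ∀ k i → 2 ≤ k → i < e ∸ k → digits (q S k) i ≡ digits (q S′ k) i) where
    private
      module A = RealMatrix S
      module A′ = RealMatrix S′
      open Homogenisation ℤ-ring using (horner; horner-mem; horner-diff)

      a-congruent : ∀ k → CongruentPow e (A.a k) (A′.a k)
      a-congruent 0 = low 0 z≤n
        where
        low : ∀ k → k ≤ 2 → CongruentPow e (A.a k) (A′.a k)
        low k k≤2 = Quotient.≈⇒~ ℤ-ring (+ (2 ^ e)) (trans (A.a-low k k≤2) (sym (A′.a-low k k≤2)))
      a-congruent 1 = Quotient.≈⇒~ ℤ-ring (+ (2 ^ e)) (trans (A.a-low 1 (s≤s z≤n)) (sym (A′.a-low 1 (s≤s z≤n))))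
      a-congruent 2 = Quotient.≈⇒~ ℤ-ring (+ (2 ^ e)) (trans (A.a-low 2 (s≤s (s≤s z≤n))) (sym (A′.a-low 2 (s≤s (s≤s z≤n)))))
      -- a_(k+1) = 2^k q_k, so e - k digits of q_k settle it modulo 2^e.
      a-congruent (suc k@(suc (suc k′))) = subst₂ (CongruentPow e) (sym (trans (A.charSeries-coeff k) (cong (ℤ._* A.quotient k) (pow k))))
        (sym (trans (A′.charSeries-coeff k) (cong (ℤ._* A′.quotient k) (pow k))))
        (scale-congruent e k (A.quotient k) (A′.quotient k) (digits-agree (e ∸ k) _ _ (λ i → agree k i (s≤s (s≤s z≤n)))))
        where open import Relation.Binary.PropositionalEquality using (subst₂)

    charPoly-congruent : Two.CongMod e (Two.charPoly S) (Two.charPoly S′)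
    charPoly-congruent k = ℤS.∣⇒∣ᵤ (subst (λ x → (+ (2 ^ e)) ℤS.∣ x) eq
      (horner-mem (λ x → (+ (2 ^ e)) ℤS.∣ x) (λ { refl m → m }) (ℤS.divides (+ 0) refl) ℤS.∣m∣n⇒∣m+n (suc n) (λ k → A.a k ℤ.+ ℤ.- A′.a k)
        (λ k → ℤS.divides (Congruent.factor (a-congruent k)) (trans (Congruent.multiple (a-congruent k)) (ℤₚ.*-comm (+ (2 ^ e)) _))) k))
      where
      eq : horner (suc n) (λ k → A.a k ℤ.+ ℤ.- A′.a k) k ≡ ZP.coeff (Two.charPoly S) k ℤ.- ZP.coeff (Two.charPoly S′) k
      eq = trans (horner-diff (suc n) A.a A′.a k) (cong₂ (λ x y → x ℤ.+ ℤ.- y) (sym (A.charPoly-horner k)) (sym (A′.charPoly-horner k)))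

  -- Position k stands for q_(k+2), whose lowest digit is 0; of its e - (k + 2) digits e - 3 - k
  -- have to be recorded.
  card-even : ∀ m e → Two.CardX'≤ (suc (suc (double m))) e (2 ^ total (e ∸ 3) (λ k → e ∸ 3 ∸ k))
  card-even m e = family-bound 2 (λ S k i → digits (q S (2 ℕ.+ k)) (suc i)) (e ∸ 3) (λ k → e ∸ 3 ∸ k) _
    (λ S S′ agree → charPoly-congruent e S S′ (λ
      { (suc (suc k)) zero    (s≤s (s≤s _)) p → digitℤ-cong₂ _ _ (Z₂.trans (even⇒~0 (quotient-even S (2 ℕ.+ k))) (Z₂.sym (even⇒~0 (quotient-even S′ (2 ℕ.+ k)))))
      ; (suc (suc k)) (suc i) (s≤s (s≤s _)) p → agree k i
          (+<⇒<∸ k 3 (ℕₚ.≤-<-trans (bound₁ k i) (<∸⇒+< (suc i) e (2 ℕ.+ k) p)))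
          (+<⇒<∸ i k (+<⇒<∸ (i ℕ.+ k) 3 (subst (_< e) (shuffle i k) (<∸⇒+< (suc i) e (2 ℕ.+ k) p)))) }))
    where
    open import Data.Nat.Solver using (module +-*-Solver)
    open +-*-Solver using () renaming (solve to solveℕ; _:+_ to _⊹_; _:=_ to _≗_; con to κ)
    shuffle : ∀ i k → suc i ℕ.+ (2 ℕ.+ k) ≡ i ℕ.+ k ℕ.+ 3
    shuffle = solveℕ 2 (λ i k → (κ 1 ⊹ i) ⊹ (κ 2 ⊹ k) ≗ i ⊹ k ⊹ κ 3) refl
    bound₁ : ∀ k i → k ℕ.+ 3 ≤ suc i ℕ.+ (2 ℕ.+ k)
    bound₁ k i = subst (k ℕ.+ 3 ≤_) (sym (trans (shuffle i k) (ℕₚ.+-assoc i k 3))) (ℕₚ.m≤n+m (k ℕ.+ 3) i)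

  module _ {m : ℕ} (e : ℕ) (S S′ : Two.Seidel (suc (double m)))
    (agree₂ : ∀ i → i < e ∸ 2 → digits (q S 2) i ≡ digits (q S′ 2) i)
    (agree₃ : ∀ k i → suc i < e ∸ (3 ℕ.+ k) → digits (q S (3 ℕ.+ k)) (suc i) ≡ digits (q S′ (3 ℕ.+ k)) (suc i)) where
    private
      module A = OddOrder S
      module A′ = OddOrder S′
      open M₂ using () renaming (_~_ to _~₂_)
      open M₄ using () renaming (_~_ to _~₄_)

      module C₂ = Squares.CharacteristicTwo M₂.quotient (congruent (+ 1) refl)
      sq-⊛ : ∀ (f : Series) k → (f ⊛ f) k ~₂ PS._⊛_ M₂.quotient f f k
      sq-⊛ f = SeriesHom.map-⊛ M₂.project f f

      sq-parity : ∀ k → (∀ l → l ℕ.+ l ≡ k → A.P l ~₂ A′.P l) → A.sq k ~₂ A′.sq k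
      sq-parity k p = Z₂.trans (sq-⊛ A.P k) (Z₂.trans (C₂.⊛-square-determined k A.P A′.P p) (Z₂.sym (sq-⊛ A′.P k)))

      q-parity : ∀ k → (∀ l → l ℕ.+ l ≡ k → A.P l ~₂ A′.P l) → q S k ~₂ q S′ k
      q-parity k p = Z₂.trans (A.quotient-square-parity k) (Z₂.trans (sq-parity k p) (Z₂.sym (A′.quotient-square-parity k)))

      -- As s² = 1, the relation for q_k solves to (P²)_k = 2 (P²)_(k+1) - s q_k modulo 4. The next
      -- coefficient of the square is needed only modulo 2.
      sq-cancel : ∀ k → q S k ~₄ q S′ k → A.sq (suc k) ~₂ A′.sq (suc k) → A.sq k ~₄ A′.sq k
      sq-cancel k p r = Z₄.trans (Z₄.sym (solved (A.sq (suc k)) (A.sq k) _ (A.quotient-square k))) (Z₄.trans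
        (Z₄.+-cong (double-~ r) (Z₄.-‿cong (Z₄.*-congˡ {s} p)))
        (solved (A′.sq (suc k)) (A′.sq k) _ (A′.quotient-square k)))
        where
        s : ℤ
        s = sgn m
        solved : ∀ F E Q → Q ~₄ s ℤ.* (+ 2 ℤ.* F ℤ.+ ℤ.- E) → + 2 ℤ.* F ℤ.+ ℤ.- (s ℤ.* Q) ~₄ E
        solved F E Q h = Z₄.trans {+ 2 ℤ.* F ℤ.+ ℤ.- (s ℤ.* Q)} {+ 2 ℤ.* F ℤ.+ ℤ.- (s ℤ.* (s ℤ.* (+ 2 ℤ.* F ℤ.+ ℤ.- E)))}
          (Z₄.+-congˡ {+ 2 ℤ.* F} (Z₄.-‿cong (Z₄.*-congˡ {s} h))) (M₄.≈⇒~ (begin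
          + 2 ℤ.* F ℤ.+ ℤ.- (s ℤ.* (s ℤ.* (+ 2 ℤ.* F ℤ.+ ℤ.- E)))
            ≡⟨ solve 3 (λ s f e → con (+ 2) :* f :+ :- (s :* (s :* (con (+ 2) :* f :+ :- e))) :=
                 con (+ 2) :* f :+ :- (s :* s :* (con (+ 2) :* f :+ :- e))) refl s F E ⟩
          + 2 ℤ.* F ℤ.+ ℤ.- (s ℤ.* s ℤ.* (+ 2 ℤ.* F ℤ.+ ℤ.- E))
            ≡⟨ cong (λ t → + 2 ℤ.* F ℤ.+ ℤ.- (t ℤ.* (+ 2 ℤ.* F ℤ.+ ℤ.- E))) (sgn-square m) ⟩
          + 2 ℤ.* F ℤ.+ ℤ.- (+ 1 ℤ.* (+ 2 ℤ.* F ℤ.+ ℤ.- E))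
            ≡⟨ solve 2 (λ f e → con (+ 2) :* f :+ :- (con (+ 1) :* (con (+ 2) :* f :+ :- e)) := e) refl F E ⟩
          E ∎))
          where open ≡-Reasoning

      half< : ∀ l k → l ℕ.+ l ≡ suc (suc (suc k)) → l < suc (suc k)
      half< l@(suc (suc _)) k eq = ℕₚ.≤-pred (subst (suc (suc l) ≤_) eq (ℕₚ.+-monoˡ-≤ l (s≤s (s≤s z≤n))))
      half< (suc zero) k ()

      -- The k-th coefficient of P is read off from q k modulo 4 once the lower ones are known.
      P-agree : ∀ b j → j < b → j ℕ.+ j < e → A.P j ~₂ A′.P j
      P-agree (suc b) zero          _       _  = Z₂.trans A.P₀ (Z₂.sym A′.P₀)
      -- P₁ cannot be read off from q₁, because 2 (P²)₂ - (P²)₁ = 2 P₁ (P₁ - P₀) = 0 modulo 4 when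
      -- P₀ is odd. It comes from the lowest digit of q₂, which is P₁² modulo 2; therefore q₂ is
      -- recorded in full.
      P-agree (suc b) (suc zero)    _       2<e = Z₂.trans (root A.P) (Z₂.trans
        (Z₂.trans (Z₂.sym (A.quotient-square-parity 2)) (Z₂.trans (digit-~₂ (agree₂ 0 (+<⇒<∸ 0 2 2<e))) (A′.quotient-square-parity 2)))
        (Z₂.sym (root A′.P)))
        where
        root : ∀ f → f 1 ~₂ (f ⊛ f) 2
        root f = Z₂.sym (Z₂.trans (sq-⊛ f 2) (Z₂.trans (C₂.⊛-square-diagonal f 1) (square-~₂ (f 1))))
      P-agree (suc b) (suc (suc k)) (s≤s j≤b) 2j<e = ⊛-square-cancel k A.P A′.P lower A.P₀ A′.P₀ (sq-cancel j q~ (sq-parity (suc j) λ l eq → lower l (half< l k eq)))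
        where
        j : ℕ
        j = suc (suc k)
        lower : ∀ l → l < j → A.P l ~₂ A′.P l
        lower l l<j = P-agree b l (ℕₚ.<-≤-trans l<j j≤b) (ℕₚ.<-trans (ℕₚ.+-mono-< l<j l<j) 2j<e)
        half≤ : ∀ l → l ℕ.+ l ≡ j → l < j
        half≤ zero    ()
        half≤ l@(suc _) eq = subst (suc l ≤_) eq (ℕₚ.+-monoˡ-≤ l (s≤s z≤n))
        -- The lowest digit of q_j follows from coefficients of P below j. The second digit is
        -- recorded, for j = 2 as part of q₂ and for j ≥ 3 as the first digit kept.
        digit : ∀ i → i < 2 → digits (q S j) i ≡ digits (q S′ j) i
        digit zero       _ = digitℤ-cong₂ _ _ (q-parity j (λ l eq → lower l (half≤ l eq)))
        digit (suc zero) _ = second k 2j<e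
          where
          second : ∀ k → suc (suc k) ℕ.+ suc (suc k) < e → digits (q S (suc (suc k))) 1 ≡ digits (q S′ (suc (suc k))) 1
          second zero    p = agree₂ 1 (+<⇒<∸ 1 2 (ℕₚ.<-trans (s≤s (s≤s (s≤s (s≤s z≤n)))) p))
          second (suc k) p = agree₃ k 0 (+<⇒<∸ 1 (3 ℕ.+ k) (ℕₚ.≤-<-trans (ℕₚ.+-monoˡ-≤ (3 ℕ.+ k) (s≤s (z≤n {suc (suc k)}))) p))
        digit (suc (suc i)) (s≤s (s≤s ()))
        q~ : q S j ~₄ q S′ j
        q~ = digits-agree 2 _ _ digit

    -- From k = 3 on the lowest digit of q_k is (P²)_k modulo 2, that is P_(k/2) for even k and 0
    -- for odd k, and `P-agree` supplies P_(k/2).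
    odd-agree : ∀ k i → 2 ≤ k → i < e ∸ k → digits (q S k) i ≡ digits (q S′ k) i
    odd-agree (suc zero) i (s≤s ())
    odd-agree (suc (suc zero)) i _ p = agree₂ i p
    odd-agree (suc (suc (suc k))) zero    _ p = digitℤ-cong₂ _ _ (q-parity (3 ℕ.+ k) (λ l eq → P-agree (suc l) l ℕₚ.≤-refl (subst (_< e) (sym eq) (<∸⇒+< 0 e (3 ℕ.+ k) p))))
    odd-agree (suc (suc (suc k))) (suc i) _ p = agree₃ k i p

  -- Position 0 is q₂ with all its digits; position k + 1 is q_(k+3) without its lowest digit.
  oddLengths : ℕ → ℕ → ℕ
  oddLengths e zero    = e ∸ 2
  oddLengths e (suc k) = e ∸ 3 ∸ suc k

  private
    oddCode : ∀ {m} → Two.Seidel (suc (double m)) → ℕ → ℕ → Fin 2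
    oddCode S zero    i = digits (q S 2) i
    oddCode S (suc k) i = digits (q S (3 ℕ.+ k)) (suc i)

  card-odd : ∀ m e → Two.CardX'≤ (suc (double m)) e (2 ^ total (suc (e ∸ 3)) (oddLengths e))
  card-odd m e = family-bound 2 oddCode (suc (e ∸ 3)) (oddLengths e) _
    (λ S S′ agree → charPoly-congruent e S S′ (odd-agree e S S′ (λ i p → agree 0 i (s≤s z≤n) p)
      (λ k i p → agree (suc k) i
        (s≤s (+<⇒<∸ k 3 (ℕₚ.≤-<-trans (bound₁ k i) (<∸⇒+< (suc i) e (3 ℕ.+ k) p))))
        (+<⇒<∸ i (suc k) (+<⇒<∸ (i ℕ.+ suc k) 3 (subst (_< e) (shuffle i k) (<∸⇒+< (suc i) e (3 ℕ.+ k) p)))))))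
    where
    open import Data.Nat.Solver using (module +-*-Solver)
    open +-*-Solver using () renaming (solve to solveℕ; _:+_ to _⊹_; _:=_ to _≗_; con to κ)
    shuffle : ∀ i k → suc i ℕ.+ (3 ℕ.+ k) ≡ i ℕ.+ suc k ℕ.+ 3
    shuffle = solveℕ 2 (λ i k → (κ 1 ⊹ i) ⊹ (κ 3 ⊹ k) ≗ i ⊹ (κ 1 ⊹ k) ⊹ κ 3) refl
    bound₁ : ∀ k i → k ℕ.+ 3 ≤ suc i ℕ.+ (3 ℕ.+ k)
    bound₁ k i = subst (_≤ suc i ℕ.+ (3 ℕ.+ k)) (ℕₚ.+-comm 3 k) (ℕₚ.m≤n+m (3 ℕ.+ k) (suc i))

-- Geometric sums and maps out of the quadratic extension

module Geometric where
  open RingPreliminaries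
  open Rings

  module GeometricSums (A : CRing) where
    open CommutativeRing A hiding (zero)
    open import Algebra.Properties.Semiring.Exp semiring public using (_^_; ^-homo-*; ^-assocʳ; ^-congˡ)
    open import Algebra.Properties.CommutativeSemiring.Exp commutativeSemiring public using (^-distrib-*)
    open Solver A using (solve; _:=_; _:+_; _:*_; :-_; con)
    open import Relation.Binary.Reasoning.Setoid setoid

    ^-unique : ∀ x (g : ℕ → Carrier) → g 0 ≡ 1# → (∀ k → g (suc k) ≡ x * g k) → ∀ k → g k ≡ x ^ k
    ^-unique x g g₀ g₊ zero    = g₀
    ^-unique x g g₀ g₊ (suc k) = ≡.trans (g₊ k) (≡.cong (x *_) (^-unique x g g₀ g₊ k))

    geo : Carrier → ℕ → Carrier
    geo z zero    = 0#
    geo z (suc m) = z ^ m + geo z m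

    count : ℕ → Carrier
    count zero    = 0#
    count (suc m) = 1# + count m

    1^ : ∀ k → 1# ^ k ≈ 1#
    1^ zero    = refl
    1^ (suc k) = trans (*-identityˡ _) (1^ k)

    inverse-^ : ∀ {z z̄} → z * z̄ ≈ 1# → ∀ k → z ^ k * z̄ ^ k ≈ 1#
    inverse-^ {z} {z̄} p k = trans (sym (^-distrib-* z z̄ k)) (trans (^-congˡ k p) (1^ k))

    geo-cong : ∀ {y z} m → y ≈ z → geo y m ≈ geo z m
    geo-cong zero    p = refl
    geo-cong (suc m) p = +-cong (^-congˡ m p) (geo-cong m p)

    geo-telescope : ∀ z m → (z + - 1#) * geo z m ≈ z ^ m + - 1#
    geo-telescope z zero    = solve 1 (λ z → (z :+ :- con (+ 1)) :* con (+ 0) := con (+ 1) :+ :- con (+ 1)) refl z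
    geo-telescope z (suc m) = begin
      (z + - 1#) * (z ^ m + geo z m)                  ≈⟨ distribˡ _ _ _ ⟩
      (z + - 1#) * z ^ m + (z + - 1#) * geo z m       ≈⟨ +-congˡ (geo-telescope z m) ⟩
      (z + - 1#) * z ^ m + (z ^ m + - 1#)             ≈⟨ solve 2 (λ z p → (z :+ :- con (+ 1)) :* p :+ (p :+ :- con (+ 1)) := z :* p :+ :- con (+ 1)) refl z (z ^ m) ⟩
      z ^ suc m + - 1#                                ∎

    geo-shift : ∀ z m → 1# + z * geo z m ≈ geo z (suc m)
    geo-shift z zero    = solve 1 (λ z → con (+ 1) :+ z :* con (+ 0) := con (+ 1) :+ con (+ 0)) refl z
    geo-shift z (suc m) = begin
      1# + z * (z ^ m + geo z m)         ≈⟨ solve 3 (λ z p g → con (+ 1) :+ z :* (p :+ g) := z :* p :+ (con (+ 1) :+ z :* g)) refl z (z ^ m) (geo z m) ⟩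
      z * z ^ m + (1# + z * geo z m)     ≈⟨ +-congˡ (geo-shift z m) ⟩
      geo z (suc (suc m))                ∎

    -- The sum 1 + z + ... + z^m read backwards: division by z^m yields the same sum in z̄.
    geo-reverse : ∀ {z z̄} → z * z̄ ≈ 1# → ∀ m → geo z (suc m) * z̄ ^ m ≈ geo z̄ (suc m)
    geo-reverse p zero = *-identityʳ _
    geo-reverse {z} {z̄} p (suc m) = begin
      (z ^ suc m + geo z (suc m)) * (z̄ * z̄ ^ m)
        ≈⟨ solve 4 (λ a g y b → (a :+ g) :* (y :* b) := a :* (y :* b) :+ y :* (g :* b)) refl (z ^ suc m) (geo z (suc m)) z̄ (z̄ ^ m) ⟩
      z ^ suc m * z̄ ^ suc m + z̄ * (geo z (suc m) * z̄ ^ m)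
        ≈⟨ +-cong (inverse-^ p (suc m)) (*-congˡ (geo-reverse p m)) ⟩
      1# + z̄ * geo z̄ (suc m)
        ≈⟨ geo-shift z̄ (suc m) ⟩
      geo z̄ (suc (suc m)) ∎

    -- Ψ = z̄ ^ c (1 + z ^ s + … + z ^ (s m)) is symmetric under z ↔ z̄ when 2 c = s m.
    balanced : ∀ {z z̄} → z * z̄ ≈ 1# → ∀ s m c → c ℕ.+ c ≡ s ℕ.* m → z ^ c * geo (z̄ ^ s) (suc m) ≈ z̄ ^ c * geo (z ^ s) (suc m)
    balanced {z} {z̄} p s m c eq = begin
      z ^ c * geo (z̄ ^ s) (suc m)
        ≈⟨ *-congˡ (geo-reverse (inverse-^ p s) m) ⟨
      z ^ c * (geo (z ^ s) (suc m) * (z̄ ^ s) ^ m)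
        ≈⟨ *-congˡ (*-congˡ (trans (^-assocʳ z̄ s m) (trans (reflexive (≡.cong (z̄ ^_) (≡.sym eq))) (^-homo-* z̄ c c)))) ⟩
      z ^ c * (geo (z ^ s) (suc m) * (z̄ ^ c * z̄ ^ c))
        ≈⟨ solve 3 (λ a g b → a :* (g :* (b :* b)) := (a :* b) :* (b :* g)) refl (z ^ c) (geo (z ^ s) (suc m)) (z̄ ^ c) ⟩
      (z ^ c * z̄ ^ c) * (z̄ ^ c * geo (z ^ s) (suc m))
        ≈⟨ *-congʳ (inverse-^ p c) ⟩
      1# * (z̄ ^ c * geo (z ^ s) (suc m))
        ≈⟨ *-identityˡ _ ⟩
      z̄ ^ c * geo (z ^ s) (suc m) ∎

    module OneModulo (π : Carrier) where
      infix 4 _≡1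
      _≡1 : Carrier → Set
      x ≡1 = ∃ λ y → x + - 1# ≈ π * y

      1≡1 : 1# ≡1
      1≡1 = 0# , trans (-‿inverseʳ 1#) (sym (zeroʳ π))

      *-≡1 : ∀ {x y} → x ≡1 → y ≡1 → x * y ≡1
      *-≡1 {x} {y} (a , p) (b , q) = a * y + b , (begin
        x * y + - 1#                        ≈⟨ solve 2 (λ x y → x :* y :+ :- con (+ 1) := (x :+ :- con (+ 1)) :* y :+ (y :+ :- con (+ 1))) refl x y ⟩
        (x + - 1#) * y + (y + - 1#)         ≈⟨ +-cong (*-congʳ p) q ⟩
        π * a * y + π * b                   ≈⟨ solve 4 (λ π a y b → π :* a :* y :+ π :* b := π :* (a :* y :+ b)) refl π a y b ⟩
        π * (a * y + b)                     ∎)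

      ^-≡1 : ∀ {x} k → x ≡1 → x ^ k ≡1
      ^-≡1 zero    p = 1≡1
      ^-≡1 (suc k) p = *-≡1 p (^-≡1 k p)

      -- Each term x z^i is 1 modulo π, so the sum is congruent to the number of its terms.
      count-geo : ∀ x z m → x ≡1 → z ≡1 → ∃ λ y → count m + - (x * geo z m) ≈ π * y
      count-geo x z zero    p q = 0# , solve 2 (λ x π → con (+ 0) :+ :- (x :* con (+ 0)) := π :* con (+ 0)) refl x π
      count-geo x z (suc m) p q = combine (count-geo x z m p q) (*-≡1 p (^-≡1 m q))
        where
        combine : (∃ λ y → count m + - (x * geo z m) ≈ π * y) → x * z ^ m ≡1 → ∃ λ y → count (suc m) + - (x * geo z (suc m)) ≈ π * y
        combine (a , e) (b , f) = a + - b , (begin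
          1# + count m + - (x * (z ^ m + geo z m))
            ≈⟨ solve 4 (λ n x w g → con (+ 1) :+ n :+ :- (x :* (w :+ g)) := (n :+ :- (x :* g)) :+ :- (x :* w :+ :- con (+ 1))) refl (count m) x (z ^ m) (geo z m) ⟩
          (count m + - (x * geo z m)) + - (x * z ^ m + - 1#)
            ≈⟨ +-cong e (-‿cong f) ⟩
          π * a + - (π * b)
            ≈⟨ solve 3 (λ π a b → π :* a :+ :- (π :* b) := π :* (a :+ :- b)) refl π a b ⟩
          π * (a + - b) ∎)

  module _ {A B : CRing} (h : Hom A B) where
    open Hom h
    open CommutativeRing B
    private
      module GA = GeometricSums A
      module GB = GeometricSums B

    hom-^ : ∀ x k → fun (x GA.^ k) ≈ fun x GB.^ k
    hom-^ x zero    = 1-homo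
    hom-^ x (suc k) = trans (*-homo _ _) (*-congˡ (hom-^ x k))

    hom-geo : ∀ z m → fun (GA.geo z m) ≈ GB.geo (fun z) m
    hom-geo z zero    = 0-homo
    hom-geo z (suc m) = trans (+-homo _ _) (+-cong (hom-^ z m) (hom-geo z m))

    hom-count : ∀ m → fun (GA.count m) ≈ GB.count m
    hom-count zero    = 0-homo
    hom-count (suc m) = trans (+-homo _ _) (+-cong 1-homo (hom-count m))

  QuadraticRelation : (A : CRing) → CommutativeRing.Carrier A → CommutativeRing.Carrier A → Set
  QuadraticRelation A r ϖ = ϖ * ϖ ≈ r * ϖ + - r
    where open CommutativeRing A

  module QuadraticCollapse {R A : CRing} (ev : Hom R A) (ρ : CommutativeRing.Carrier R) (ϖ : CommutativeRing.Carrier A)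
    (relation : QuadraticRelation A (Hom.fun ev ρ) ϖ) where
    open CommutativeRing A
    private
      module ev = Hom ev
      module Q = Quadratic R ρ
    open Solver A using (solve; _:=_; _:+_; _:*_; :-_; con)
    open import Relation.Binary.Reasoning.Setoid setoid

    -- The universal property of the extension: π may be sent to any root of its defining quadratic.
    collapse : Hom Q.extension A
    collapse = record
      { fun = λ (a , b) → ev.fun a + ev.fun b * ϖ
      ; cong = λ (p , q) → +-cong (ev.cong p) (*-congʳ (ev.cong q))
      ; +-homo = λ (a , b) (c , d) → trans (+-cong (ev.+-homo a c) (*-congʳ (ev.+-homo b d)))
          (solve 5 (λ a b c d w → (a :+ c) :+ (b :+ d) :* w := (a :+ b :* w) :+ (c :+ d :* w)) refl (ev.fun a) (ev.fun b) (ev.fun c) (ev.fun d) ϖ)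
      ; *-homo = λ (a , b) (c , d) → product a b c d
      ; 1-homo = trans (+-cong ev.1-homo (trans (*-congʳ ev.0-homo) (zeroˡ ϖ))) (+-identityʳ _) }
      where
      product : ∀ a b c d → ev.fun (proj₁ ((a , b) Q.· (c , d))) + ev.fun (proj₂ ((a , b) Q.· (c , d))) * ϖ ≈ (ev.fun a + ev.fun b * ϖ) * (ev.fun c + ev.fun d * ϖ)
      product a b c d = begin
        ev.fun (proj₁ ((a , b) Q.· (c , d))) + ev.fun (proj₂ ((a , b) Q.· (c , d))) * ϖ
          ≈⟨ +-cong (trans (ev.-‿homo₂ _ _) (+-cong (ev.*-homo a c) (-‿cong ρbd)))
               (*-congʳ (trans (ev.+-homo _ _) (+-cong (trans (ev.+-homo _ _) (+-cong (ev.*-homo a d) (ev.*-homo b c))) ρbd))) ⟩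
        (α * γ + - (r * (β * ε))) + (α * ε + β * γ + r * (β * ε)) * ϖ
          ≈⟨ solve 6 (λ a b c d r w → (a :* c :+ :- (r :* (b :* d))) :+ (a :* d :+ b :* c :+ r :* (b :* d)) :* w :=
               (a :* c :+ (a :* d :+ b :* c) :* w) :+ b :* d :* (r :* w :+ :- r)) refl α β γ ε r ϖ ⟩
        (α * γ + (α * ε + β * γ) * ϖ) + β * ε * (r * ϖ + - r)
          ≈⟨ +-congˡ (*-congˡ relation) ⟨
        (α * γ + (α * ε + β * γ) * ϖ) + β * ε * (ϖ * ϖ)
          ≈⟨ solve 5 (λ a b c d w → (a :* c :+ (a :* d :+ b :* c) :* w) :+ b :* d :* (w :* w) := (a :+ b :* w) :* (c :+ d :* w)) refl α β γ ε ϖ ⟩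
        (α + β * ϖ) * (γ + ε * ϖ) ∎
        where
        α = ev.fun a
        β = ev.fun b
        γ = ev.fun c
        ε = ev.fun d
        r = ev.fun ρ
        ρbd : ev.fun (CommutativeRing._*_ R ρ (CommutativeRing._*_ R b d)) ≈ r * (β * ε)
        ρbd = trans (ev.*-homo _ _) (*-congˡ (ev.*-homo b d))

-- The coefficients over the free ring: reality, division by ρ, and residues

module Laurent where
  open RingPreliminaries
  open PowerSeries
  open Determinant
  open Hermitian
  open Pencil
  open Rings
  open Residue
  open CoreHom
  open LowCoeffs
  open import Data.Product.Base using (_×_)

  -- ⌈ k / 2 ⌉
  level : ℕ → ℕ
  level zero          = 0
  level (suc zero)    = 1
  level (suc (suc k)) = suc (level k)

  -- Proved over an abstract ring, so that normalisation does not unfold the multiplication of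
  -- pairs.
  module RingIdentities (A : CRing) where
    open CommutativeRing A
    open Solver A using (solve; _:=_; _:+_; _:*_; :-_; con)

    split-difference : ∀ x y → x ≈ (x + - y) + y
    split-difference = solve 2 (λ x y → x := (x :+ :- y) :+ y) refl

    *-distrib-difference : ∀ p x y → p * (x + - y) ≈ p * x + - (p * y)
    *-distrib-difference = solve 3 (λ p x y → p :* (x :+ :- y) := p :* x :+ :- (p :* y)) refl

    regroup-square : ∀ p q y → p * (p * q) * y ≈ (p * p) * (q * y)
    regroup-square = solve 3 (λ p q y → p :* (p :* q) :* y := (p :* p) :* (q :* y)) refl

    regroup : ∀ r z q y → r * z * (q * y) ≈ r * (q * (z * y))
    regroup = solve 4 (λ r z q y → r :* z :* (q :* y) := r :* (q :* (z :* y))) refl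

    *-swap : ∀ x p b → x * p * b ≈ p * (x * b)
    *-swap = solve 3 (λ x p b → x :* p :* b := p :* (x :* b)) refl

    distrib₃ : ∀ p a t b d → p * (a * t + b + - d) ≈ (p * a) * t + p * b + - (p * d)
    distrib₃ = solve 5 (λ p a t b d → p :* (a :* t :+ b :+ :- d) := (p :* a) :* t :+ p :* b :+ :- (p :* d)) refl

    telescope : ∀ a t d → (a + - 1#) * t + (t + - 1#) + - (d + - 1#) ≈ a * t + - d
    telescope = solve 3 (λ a t d → (a :+ :- con (+ 1)) :* t :+ (t :+ :- con (+ 1)) :+ :- (d :+ :- con (+ 1)) := a :* t :+ :- d) refl

  module LaurentRing (R : CRing) (ρ : CommutativeRing.Carrier R) where
    open Quadratic R ρ public
    module R = CommutativeRing R
    module U = CommutativeRing extension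
    open Hom conjugate using () renaming (fun to conj)

    record Unitary (n : ℕ) : Set where
      field
        T     : Fin n → Fin n → U.Carrier
        diag  : ∀ i → T i i U.≈ U.1#
        unit  : ∀ i j → T i j U.* T j i U.≈ U.1#
        herm  : ∀ i j → conj (T i j) U.≈ T j i
        quot  : Fin n → Fin n → U.Carrier
        quot-π : ∀ i j → T i j U.+ U.- U.1# U.≈ π U.* quot i j

  module Coefficients (R : CRing) (ρ : CommutativeRing.Carrier R)
    (ρ-cancel : Regular R ρ) (2-cancel : TwoTorsionFree R)
    (F : CRing) (h₀ : Hom R F) (h₀-ρ : IsZero F (Hom.fun h₀ ρ)) (two : IsZero F (CommutativeRing._+_ F (CommutativeRing.1# F) (CommutativeRing.1# F))) where
    open LaurentRing R ρ
    module F = CommutativeRing F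
    open Hom conjugate using () renaming (fun to conj; cong to conj-cong; *-homo to conj-*)
    open import Algebra.Properties.Semiring.Exp U.semiring using (_^_)
    open import Algebra.Properties.Semiring.Exp R.semiring using () renaming (_^_ to _^ᴿ_)
    open Squares.CharacteristicTwo F two public
    private
      module SR = Solver R
      module SU = RingIdentities extension
      module SF = Solver F
      module C = CharacteristicSeries extension
      module h₀ = Hom h₀

    F-neg : ∀ x → F.- x F.≈ x
    F-neg x = F.trans (F.sym (F.+-identityˡ _)) (F.trans (F.+-congʳ (F.sym (double≈0 x)))
      (SF.solve 1 (λ x → (x SF.:+ x) SF.:+ (SF.:- x) SF.:= x) F.refl x))

    π-cancel : ∀ x → π U.* x U.≈ U.0# → x U.≈ U.0#
    π-cancel (a , b) (p , q) = a≈0 , b≈0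
      where
      b≈0 : b R.≈ R.0#
      b≈0 = ρ-cancel b (R.trans (SR.solve 3 (λ r a b → r SR.:* b SR.:= SR.:- (SR.con (+ 0) SR.:* a SR.:+ (SR.:- (r SR.:* (SR.con (+ 1) SR.:* b))))) R.refl ρ a b)
        (R.trans (R.-‿cong p) (SR.solve 0 (SR.:- SR.con (+ 0) SR.:= SR.con (+ 0)) R.refl)))
      a≈0 : a R.≈ R.0#
      a≈0 = R.trans (R.trans (SR.solve 3 (λ r a b → a SR.:= (SR.con (+ 0) SR.:* b SR.:+ SR.con (+ 1) SR.:* a SR.:+ r SR.:* (SR.con (+ 1) SR.:* b)) SR.:+ (SR.:- (r SR.:* b))) R.refl ρ a b)
        (R.+-cong q (R.-‿cong (R.trans (R.*-congˡ b≈0) (R.zeroʳ ρ))))) (SR.solve 0 (SR.con (+ 0) SR.:+ (SR.:- SR.con (+ 0)) SR.:= SR.con (+ 0)) R.refl)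

    π-cancel₂ : ∀ {x y} → π U.* x U.≈ π U.* y → x U.≈ y
    π-cancel₂ {x} {y} p = U.trans (SU.split-difference x y)
      (U.trans (U.+-congʳ {y} (π-cancel (x U.+ U.- y) (U.trans (SU.*-distrib-difference π x y)
        (U.trans (U.+-congʳ {U.- (π U.* y)} p) (U.-‿inverseʳ (π U.* y)))))) (U.+-identityˡ y))

    -- 1 - ζ̄ = -ζ̄ (1 - ζ); this is the factor by which B fails to be Hermitian.
    conj-π : conj π U.≈ (U.- ζ̄) U.* π
    conj-π = SR.solve 1 (λ r → SR.con (+ 0) SR.:+ r SR.:* SR.con (+ 1) SR.:=
               (SR.:- (SR.con (+ 1) SR.:+ (SR.:- r))) SR.:* SR.con (+ 0) SR.:+ (SR.:- (r SR.:* ((SR.:- SR.con (+ 1)) SR.:* SR.con (+ 1))))) R.refl ρ ,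
             SR.solve 1 (λ r → SR.:- SR.con (+ 1) SR.:=
               (SR.:- (SR.con (+ 1) SR.:+ (SR.:- r))) SR.:* SR.con (+ 1) SR.:+ (SR.:- SR.con (+ 1)) SR.:* SR.con (+ 0) SR.:+ r SR.:* ((SR.:- SR.con (+ 1)) SR.:* SR.con (+ 1))) R.refl ρ

    -- A fixed element has -b = b, and there is no 2-torsion.
    real⇒proj₂≈0 : ∀ x → conj x U.≈ x → proj₂ x R.≈ R.0#
    real⇒proj₂≈0 (a , b) (_ , q) = 2-cancel b (R.trans (R.+-congʳ (R.sym q)) (R.-‿inverseˡ b))

    -- At ρ = 0 the extension becomes the dual numbers F[π]/(π²). In characteristic 2 the map π ↦ -π
    -- is the identity, so conjugation becomes trivial, and -ζ̄ becomes 1 + π.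
    module QF = Quadratic F F.0#
    V : CRing
    V = QF.extension
    module V = CommutativeRing V

    h : Hom extension V
    h = QuadraticHom.extensionHom h₀ ρ F.0# h₀-ρ
    module h = Hom h

    h-conj : ∀ x → h.fun (conj x) V.≈ h.fun x
    h-conj (a , b) = F.trans (h₀.+-homo _ _) (F.trans (F.+-congˡ (F.trans (h₀.*-homo ρ b) (F.trans (F.*-congʳ h₀-ρ) (F.zeroˡ _)))) (F.+-identityʳ _)) ,
      F.trans (h₀.neg-homo b) (F-neg _)

    proj₁-· : ∀ x y → proj₁ (x V.* y) F.≈ proj₁ x F.* proj₁ y
    proj₁-· (a , b) (c , d) = F.trans (F.+-congˡ (F.trans (F-neg _) (F.zeroˡ _))) (F.+-identityʳ _)

    proj₂-· : ∀ x y → proj₂ (x V.* y) F.≈ proj₁ x F.* proj₂ y F.+ proj₂ x F.* proj₁ y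
    proj₂-· (a , b) (c , d) = F.trans (F.+-congˡ (F.zeroˡ _)) (F.+-identityʳ _)

    𝔪 : V.Carrier → Set
    𝔪 x = proj₁ x F.≈ F.0#

    𝔪-ideal : IsIdeal V 𝔪
    𝔪-ideal = record
      { resp = λ (p , _) m → F.trans (F.sym p) m
      ; +-mem = λ m m′ → F.trans (F.+-cong m m′) (F.+-identityˡ _)
      ; *-mem = λ x {y} m → F.trans (proj₁-· x y) (F.trans (F.*-congˡ m) (F.zeroʳ _)) }

    𝔪² : ∀ {x y} → 𝔪 x → 𝔪 y → x V.* y V.≈ V.0#
    𝔪² {x} {y} m m′ = F.trans (proj₁-· x y) (F.trans (F.*-congʳ m) (F.zeroˡ _)) ,
      F.trans (proj₂-· x y) (F.trans (F.+-cong (F.trans (F.*-congʳ m) (F.zeroˡ _)) (F.trans (F.*-congˡ m′) (F.zeroʳ _))) (F.+-identityˡ _))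

    c : V.Carrier
    c = h.fun (U.- ζ̄)

    c₁ : proj₁ c F.≈ F.1#
    c₁ = F.trans (h₀.neg-homo _) (F.trans (F-neg _) (F.trans (h₀.-‿homo₂ _ _) (F.trans (F.+-cong h₀.1-homo (F.trans (F-neg _) h₀-ρ)) (F.+-identityʳ _))))

    c₂ : proj₂ c F.≈ F.1#
    c₂ = F.trans (h₀.neg-homo _) (F.trans (F-neg _) h₀.1-homo)

    residueStructure : ResidueStructure V
    residueStructure = record
      { 𝔪 = 𝔪 ; 𝔪-ideal = 𝔪-ideal ; 𝔪²≈0 = λ {x} {y} → 𝔪² {x} {y} ; 2∈𝔪 = two ; c = c ; c~1 = F.trans (F.+-cong c₁ (F-neg _)) two }

    module RV = ResidueRing V residueStructure

    private
      -- (1 - ζ)² = -ζ (1 - ζ)(1 - ζ⁻¹): two factors π make one ρ up to a unit, whence ⌈k/2⌉.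
      π²-factor : π U.* π U.≈ embed ρ U.* (U.- ζ)
      π²-factor =
        SR.solve 1 (λ r → SR.con (+ 0) SR.:* SR.con (+ 0) SR.:+ (SR.:- (r SR.:* (SR.con (+ 1) SR.:* SR.con (+ 1)))) SR.:=
          r SR.:* (SR.:- SR.con (+ 1)) SR.:+ (SR.:- (r SR.:* (SR.con (+ 0) SR.:* (SR.:- (SR.:- SR.con (+ 1))))))) R.refl ρ ,
        SR.solve 1 (λ r → SR.con (+ 0) SR.:* SR.con (+ 1) SR.:+ SR.con (+ 1) SR.:* SR.con (+ 0) SR.:+ r SR.:* (SR.con (+ 1) SR.:* SR.con (+ 1)) SR.:=
          r SR.:* (SR.:- (SR.:- SR.con (+ 1))) SR.:+ SR.con (+ 0) SR.:* (SR.:- SR.con (+ 1)) SR.:+ r SR.:* (SR.con (+ 0) SR.:* (SR.:- (SR.:- SR.con (+ 1))))) R.refl ρ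

      embed-* : ∀ x → embed ρ U.* x U.≈ (ρ R.* proj₁ x , ρ R.* proj₂ x)
      embed-* (a , b) =
        SR.solve 3 (λ r a b → r SR.:* a SR.:+ (SR.:- (r SR.:* (SR.con (+ 0) SR.:* b))) SR.:= r SR.:* a) R.refl ρ a b ,
        SR.solve 3 (λ r a b → r SR.:* b SR.:+ SR.con (+ 0) SR.:* a SR.:+ r SR.:* (SR.con (+ 0) SR.:* b) SR.:= r SR.:* b) R.refl ρ a b

      π-* : ∀ x → π U.* x U.≈ (R.- (ρ R.* proj₂ x) , proj₁ x R.+ ρ R.* proj₂ x)
      π-* (a , b) =
        SR.solve 3 (λ r a b → SR.con (+ 0) SR.:* a SR.:+ (SR.:- (r SR.:* (SR.con (+ 1) SR.:* b))) SR.:= SR.:- (r SR.:* b)) R.refl ρ a b ,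
        SR.solve 3 (λ r a b → SR.con (+ 0) SR.:* b SR.:+ SR.con (+ 1) SR.:* a SR.:+ r SR.:* (SR.con (+ 1) SR.:* b) SR.:= a SR.:+ r SR.:* b) R.refl ρ a b

    -- how the residue of z is read off from Y when π ^ k Y = ρ ^ level k z
    ResidueOf : ℕ → U.Carrier → R.Carrier → Set
    ResidueOf zero          Y z = h₀.fun z F.≈ proj₁ (h.fun Y)
    ResidueOf (suc zero)    Y z = proj₁ (h.fun Y) F.≈ F.0# × h₀.fun z F.≈ proj₂ (h.fun Y)
    ResidueOf (suc (suc k)) Y z = ResidueOf k Y z

    private
      h-ζ* : ∀ Y → proj₁ (h.fun ((U.- ζ) U.* Y)) F.≈ proj₁ (h.fun Y) × proj₂ (h.fun ((U.- ζ) U.* Y)) F.≈ proj₁ (h.fun Y) F.+ proj₂ (h.fun Y)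
      h-ζ* Y = F.trans (proj₁ (h.*-homo (U.- ζ) Y)) (F.trans (proj₁-· (h.fun (U.- ζ)) (h.fun Y)) (F.trans (F.*-congʳ ζ₁) (F.*-identityˡ _))) ,
        F.trans (proj₂ (h.*-homo (U.- ζ) Y)) (F.trans (proj₂-· (h.fun (U.- ζ)) (h.fun Y))
          (F.trans (F.+-cong (F.trans (F.*-congʳ ζ₁) (F.*-identityˡ _)) (F.trans (F.*-congʳ ζ₂) (F.*-identityˡ _))) (F.+-comm _ _)))
        where
        ζ₁ : h₀.fun (R.- R.1#) F.≈ F.1#
        ζ₁ = F.trans (h₀.neg-homo _) (F.trans (F-neg _) h₀.1-homo)
        ζ₂ : h₀.fun (R.- (R.- R.1#)) F.≈ F.1#
        ζ₂ = F.trans (h₀.neg-homo _) (F.trans (F-neg _) ζ₁)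

      -- Modulo 2 one has -ζ = 1 + π. It keeps the first coordinate and adds it to the second, and
      -- the second is consulted only when the first is 0.
      residue-ζ : ∀ k Y z → ResidueOf k ((U.- ζ) U.* Y) z → ResidueOf k Y z
      residue-ζ zero          Y z p = F.trans p (proj₁ (h-ζ* Y))
      residue-ζ (suc zero)    Y z (p , q) = Y₁ , F.trans q (F.trans (proj₂ (h-ζ* Y)) (F.trans (F.+-congʳ Y₁) (F.+-identityˡ _)))
        where
        Y₁ : proj₁ (h.fun Y) F.≈ F.0#
        Y₁ = F.trans (F.sym (proj₁ (h-ζ* Y))) p
      residue-ζ (suc (suc k)) Y z p = residue-ζ k Y z p

    -- Factors π are traded in pairs for ρ, the unit -ζ moving into Y. For a single factor, π (c + d
    -- π) = -ρ d + (c + ρ d) π is real only if c = -ρ d, and its value is then ρ times -d.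
    divide-real : ∀ k Y → proj₂ (π ^ k U.* Y) R.≈ R.0# → ∃ λ z → proj₁ (π ^ k U.* Y) R.≈ ρ ^ᴿ level k R.* z × ResidueOf k Y z
    divide-real zero Y p = proj₁ Y , R.trans (proj₁ (U.*-identityˡ Y)) (R.sym (R.*-identityˡ _)) , F.refl
    divide-real (suc zero) Y p = R.- proj₂ Y ,
      R.trans (proj₁ πY) (SR.solve 2 (λ r d → SR.:- (r SR.:* d) SR.:= r SR.:* SR.con (+ 1) SR.:* (SR.:- d)) R.refl ρ (proj₂ Y)) ,
      F.trans (h₀.cong c≈) (F.trans (h₀.neg-homo _) (F.trans (F-neg _) (F.trans (h₀.*-homo ρ _) (F.trans (F.*-congʳ h₀-ρ) (F.zeroˡ _))))) ,
      F.trans (h₀.neg-homo _) (F-neg _)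
      where
      πY : π ^ 1 U.* Y U.≈ (R.- (ρ R.* proj₂ Y) , proj₁ Y R.+ ρ R.* proj₂ Y)
      πY = U.trans (U.*-congʳ {Y} (U.*-identityʳ π)) (π-* Y)
      c≈ : proj₁ Y R.≈ R.- (ρ R.* proj₂ Y)
      c≈ = R.trans (SR.solve 2 (λ c x → c SR.:= (c SR.:+ x) SR.:+ (SR.:- x)) R.refl (proj₁ Y) (ρ R.* proj₂ Y))
        (R.trans (R.+-congʳ (R.trans (R.sym (proj₂ πY)) p)) (R.+-identityˡ _))
    divide-real (suc (suc k)) Y p = finish (divide-real k Y′ (ρ-cancel _ (R.trans (R.sym (proj₂ step)) p)))
      where
      Y′ : U.Carrier
      Y′ = (U.- ζ) U.* Y
      step : π ^ suc (suc k) U.* Y U.≈ (ρ R.* proj₁ (π ^ k U.* Y′) , ρ R.* proj₂ (π ^ k U.* Y′))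
      step = U.trans (SU.regroup-square π (π ^ k) Y)
        (U.trans (U.*-congʳ {π ^ k U.* Y} π²-factor)
        (U.trans (SU.regroup (embed ρ) (U.- ζ) (π ^ k) Y) (embed-* (π ^ k U.* Y′))))
      finish : (∃ λ z → proj₁ (π ^ k U.* Y′) R.≈ ρ ^ᴿ level k R.* z × ResidueOf k Y′ z) →
        ∃ λ z → proj₁ (π ^ suc (suc k) U.* Y) R.≈ ρ ^ᴿ suc (level k) R.* z × ResidueOf k Y z
      finish (z , eq , res) = z , R.trans (proj₁ step) (R.trans (R.*-congˡ eq) (R.sym (R.*-assoc ρ _ z))) , residue-ζ k Y z res

    module Matrix {n : ℕ} (M : Unitary (suc n)) where
      open Unitary M

      B : Fin n → Fin n → U.Carrier
      B i j = quot (suc i) zero U.* T zero (suc j) U.+ quot zero (suc j) U.+ U.- quot (suc i) (suc j)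

      πB : ∀ i j → π U.* B i j U.≈ T (suc i) zero U.* T zero (suc j) U.+ U.- T (suc i) (suc j)
      πB i j = U.trans (SU.distrib₃ π (quot (suc i) zero) (T zero (suc j)) (quot zero (suc j)) (quot (suc i) (suc j)))
        (U.trans (U.+-cong (U.+-cong (U.*-congʳ {T zero (suc j)} (U.sym (quot-π _ _))) (U.sym (quot-π _ _))) (U.-‿cong (U.sym (quot-π _ _))))
          (SU.telescope (T (suc i) zero) (T zero (suc j)) (T (suc i) (suc j))))

      open C.Reduction π n T B (diag zero) πB public using (quotient; charSeries-coeff; coreDet; borderedDet)

      a : ℕ → U.Carrier
      a = C.charSeries (suc n) T

      a-low : ∀ k → k ≤ 2 → a k U.≈ LowDegree.low extension (suc n) U.0# k
      a-low = LowDegree.charSeries-low extension (suc n) T diag (λ i j _ → unit i j)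

      private
        module DS = DeterminantTheory (PS.series extension)

        δ-sym : ∀ {n} (i j : Fin n) → Kronecker.δ extension i j U.≈ Kronecker.δ extension j i
        δ-sym zero    zero    = U.refl
        δ-sym zero    (suc j) = U.refl
        δ-sym (suc i) zero    = U.refl
        δ-sym (suc i) (suc j) = δ-sym i j

        -- Conjugation turns T into its transpose, and the determinant is unchanged by
        -- transposition.
        a-real : ∀ k → conj (a k) U.≈ a k
        a-real k = U.trans (hom-charSeries conjugate (suc n) T k) (U.trans
          (DS.det-cong (suc n) (λ i j → C.lin-cong (δ-sym i j) (U.-‿cong (herm i j))) k)
          (DS.det-transpose (suc n) (λ i j → PS.lin extension (Kronecker.δ extension i j) (U.- T i j)) k))

      a-proj₂ : ∀ k → proj₂ (a k) R.≈ R.0#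
      a-proj₂ k = real⇒proj₂≈0 (a k) (a-real k)

      private
        divided : ∀ k → ∃ λ z → proj₁ (π ^ k U.* quotient k) R.≈ ρ ^ᴿ level k R.* z × ResidueOf k (quotient k) z
        divided k = divide-real k (quotient k) (R.trans (R.sym (proj₂ (charSeries-coeff k))) (a-proj₂ (suc k)))

      z : ℕ → R.Carrier
      z k = proj₁ (divided k)

      a-z : ∀ k → proj₁ (a (suc k)) R.≈ ρ ^ᴿ level k R.* z k
      a-z k = R.trans (proj₁ (charSeries-coeff k)) (proj₁ (proj₂ (divided k)))

      z-residue : ∀ k → ResidueOf k (quotient k) (z k)
      z-residue k = proj₂ (proj₂ (divided k))

      private
        hT-sym : ∀ i j → h.fun (T i j) V.≈ h.fun (T j i)
        hT-sym i j = V.trans (V.sym (h-conj (T i j))) (h.cong (herm i j))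

        hT~1 : ∀ i j → 𝔪 (h.fun (T i j) V.+ V.- V.1#)
        hT~1 i j = F.trans (F.+-congˡ (F.-‿cong (F.sym h₀.1-homo))) (F.trans (F.sym (h₀.-‿homo₂ _ _)) (F.trans (proj₁ (h.cong (quot-π i j)))
          (F.trans (proj₁ (h.*-homo π (quot i j))) (F.trans (proj₁-· _ _) (F.trans (F.*-congʳ h₀.0-homo) (F.zeroˡ _))))))

        -- Conjugating π B gives the transposed right-hand side. Cancelling π leaves the quotient
        -- π̄/π.
        B-herm : ∀ i j → B j i U.≈ (U.- ζ̄) U.* conj (B i j)
        B-herm i j = π-cancel₂ (U.trans (πB j i) (U.trans (U.sym conj-side)
          (SU.*-swap (U.- ζ̄) π (conj (B i j)))))
          where
          conj-side : (U.- ζ̄) U.* π U.* conj (B i j) U.≈ T (suc j) zero U.* T zero (suc i) U.+ U.- T (suc j) (suc i)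
          conj-side = U.trans (U.*-congʳ {conj (B i j)} (U.sym conj-π)) (U.trans (U.sym (conj-* π (B i j))) (U.trans (conj-cong (πB i j))
            (U.trans (Hom.-‿homo₂ conjugate (T (suc i) zero U.* T zero (suc j)) (T (suc i) (suc j)))
              (U.+-cong (U.trans (conj-* (T (suc i) zero) (T zero (suc j))) (U.trans (U.*-cong (herm _ _) (herm _ _)) (U.*-comm (T zero (suc i)) (T (suc j) zero)))) (U.-‿cong (herm _ _))))))

        hB-herm : ∀ i j → c V.* h.fun (B i j) V.≈ h.fun (B j i)
        hB-herm i j = V.trans (V.*-congˡ {c} (V.sym (h-conj (B i j)))) (V.trans (V.sym (h.*-homo (U.- ζ̄) (conj (B i j)))) (h.cong (U.sym (B-herm i j))))

        B-diag : ∀ i → B i i U.≈ U.0#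
        B-diag i = π-cancel (B i i) (U.trans (πB i i) (U.trans (U.+-cong (unit (suc i) zero) (U.-‿cong (diag (suc i)))) (U.-‿inverseʳ U.1#)))

      module W = RV.Seidel n (λ i j → h.fun (T i j)) (λ i j → h.fun (B i j)) hT-sym hT~1
        (λ i → V.trans (V.sym (h.*-homo _ _)) (V.trans (h.cong (unit (suc i) zero)) h.1-homo))
        hB-herm (λ i → V.trans (h.cong (B-diag i)) h.0-homo)

      private
        hE : ∀ k → h.fun (coreDet k) V.≈ W.coreDet k
        hE = hom-coreDet h n T B

        hβ : ∀ k → h.fun (borderedDet k) V.≈ W.borderedDet k
        hβ = hom-borderedDet h n T B

        hπ* : ∀ x → proj₁ (h.fun (π U.* x)) F.≈ F.0# × proj₂ (h.fun (π U.* x)) F.≈ proj₁ (h.fun x)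
        hπ* x = F.trans (proj₁ (h.*-homo π x)) (F.trans (proj₁-· _ _) (F.trans (F.*-congʳ h₀.0-homo) (F.zeroˡ _))) ,
          F.trans (proj₂ (h.*-homo π x)) (F.trans (proj₂-· _ _) (F.trans (F.+-cong (F.trans (F.*-congʳ h₀.0-homo) (F.zeroˡ _)) (F.trans (F.*-congʳ h₀.1-homo) (F.*-identityˡ _))) (F.+-identityˡ _)))

        h-quotient : ∀ k → h.fun (quotient k) V.≈ h.fun (π U.* coreDet (suc k)) V.+ V.- h.fun (coreDet k) V.+ h.fun (π U.* borderedDet (suc k))
        h-quotient k = V.trans (h.+-homo _ _) (V.+-congʳ {h.fun (π U.* borderedDet (suc k))} (h.-‿homo₂ (π U.* coreDet (suc k)) (coreDet k)))

      quotient₁ : ∀ k → proj₁ (h.fun (quotient k)) F.≈ proj₁ (W.coreDet k)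
      quotient₁ k = F.trans (proj₁ (h-quotient k)) (F.trans (F.+-cong (F.+-cong (proj₁ (hπ* _)) (F.trans (F-neg _) (proj₁ (hE k)))) (proj₁ (hπ* _)))
        (SF.solve 1 (λ x → SF.con (+ 0) SF.:+ x SF.:+ SF.con (+ 0) SF.:= x) F.refl _))

      -- In the dual numbers multiplication by π moves the first coordinate to the second. So
      -- E_(k+1) and β_(k+1) enter with their first coordinates and E_k with its second.
      quotient₂ : ∀ k → proj₂ (h.fun (quotient k)) F.≈ proj₁ (W.coreDet (suc k)) F.+ proj₂ (W.coreDet k) F.+ proj₁ (W.borderedDet (suc k))
      quotient₂ k = F.trans (proj₂ (h-quotient k)) (F.+-cong (F.+-cong (F.trans (proj₂ (hπ* _)) (proj₁ (hE (suc k)))) (F.trans (F-neg _) (proj₂ (hE k))))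
        (F.trans (proj₂ (hπ* _)) (proj₁ (hβ (suc k)))))

    private
      module PF = PS F
      module PV = PS V
      open import Algebra.Properties.Semiring.Exp V.semiring using () renaming (_^_ to _^ⱽ_)

    a-low-unique : ∀ {n} (M M′ : Unitary (suc n)) k → k ≤ 2 → Matrix.a M k U.≈ Matrix.a M′ k
    a-low-unique M M′ k p = U.trans (Matrix.a-low M k p) (U.sym (Matrix.a-low M′ k p))

    residue-even : ∀ j {Y z} → ResidueOf (double j) Y z → h₀.fun z F.≈ proj₁ (h.fun Y)
    residue-even zero    p = p
    residue-even (suc j) p = residue-even j p

    residue-odd : ∀ j {Y z} → ResidueOf (suc (double j)) Y z → h₀.fun z F.≈ proj₂ (h.fun Y)
    residue-odd zero    p = proj₂ p
    residue-odd (suc j) p = residue-odd j p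

    residue-evenOrder : ∀ {m} (M : Unitary (suc (suc (double m)))) j → h₀.fun (Matrix.z M (double j)) F.≈ F.0#
    residue-evenOrder {m} M j = F.trans (residue-even j (z-residue (double j)))
      (F.trans (quotient₁ (double j)) (RV.H.det-odd m W.core-even (double j)))
      where open Matrix M

    parity : ℕ → F.Carrier
    parity zero    = F.0#
    parity (suc k) = parity k F.+ F.1#

    parity-odd : ∀ j → parity (suc (double j)) F.≈ F.1#
    parity-odd zero    = F.+-identityˡ _
    parity-odd (suc j) = F.trans (F.+-assoc (parity (suc (double j))) F.1# F.1#) (F.trans (F.+-cong (parity-odd j) two) (F.+-identityʳ _))

    -- the derivation u d/du
    derive : PF.Series → PF.Series
    derive f k = parity k F.* f k

    private
      pr₁ : Hom V F
      pr₁ = record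
        { fun = proj₁ ; cong = proj₁ ; +-homo = λ _ _ → F.refl ; *-homo = proj₁-· ; 1-homo = F.refl }

      proj₂-⊛ : ∀ P Q k → proj₂ ((P PV.⊛ Q) k) F.≈
        ((λ i → proj₁ (P i)) PF.⊛ (λ i → proj₂ (Q i))) k F.+ ((λ i → proj₂ (P i)) PF.⊛ (λ i → proj₁ (Q i))) k
      proj₂-⊛ P Q zero    = proj₂-· (P 0) (Q 0)
      proj₂-⊛ P Q (suc k) = F.trans (F.+-cong (proj₂-· (P 0) (Q (suc k))) (proj₂-⊛ (λ i → P (suc i)) Q k))
        (SF.solve 4 (λ a b x y → (a SF.:+ b) SF.:+ (x SF.:+ y) SF.:= (a SF.:+ x) SF.:+ (b SF.:+ y)) F.refl _ _ _ _)

      c^₁ : ∀ k → proj₁ (c ^ⱽ k) F.≈ F.1#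
      c^₁ zero    = F.refl
      c^₁ (suc k) = F.trans (proj₁-· c (c ^ⱽ k)) (F.trans (F.*-cong c₁ (c^₁ k)) (F.*-identityˡ _))

      -- (1 + π)^k = 1 + k π, as π² = 0; this is how the derivative enters τ.
      c^₂ : ∀ k → proj₂ (c ^ⱽ k) F.≈ parity k
      c^₂ zero    = F.refl
      c^₂ (suc k) = F.trans (proj₂-· c (c ^ⱽ k)) (F.+-cong (F.trans (F.*-cong c₁ (c^₂ k)) (F.*-identityˡ _)) (F.trans (F.*-cong c₂ (c^₁ k)) (F.*-identityˡ _)))

      sign≈1 : ∀ m → alternatingSign V m V.≈ V.1#
      sign≈1 zero    = V.refl
      sign≈1 (suc m) = F.trans (F-neg _) (proj₁ (sign≈1 m)) , F.trans (F-neg _) (proj₂ (sign≈1 m))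

    module OddOrder {m : ℕ} (M : Unitary (suc (double m))) where
      open Matrix M
      private
        root : ∃ λ P → RV.H._~1 P × W.coreDet PV.≋ RV.H.sign m PV.⊛ (P PV.⊛ PS.Rescale.rescale V c P)
        root = RV.H.det-even m W.core-even

        P Q : PV.Series
        P = proj₁ root
        Q = PS.Rescale.rescale V c P

        t : PF.Series
        t k = proj₂ (P k)

      s : PF.Series
      s k = proj₁ (P k)

      s₀ : s 0 F.≈ F.1#
      s₀ = F.trans (SF.solve 1 (λ x → x SF.:= (x SF.:+ (SF.:- SF.con (+ 1))) SF.:+ SF.con (+ 1)) F.refl (s 0))
        (F.trans (F.+-congʳ (proj₁ (proj₂ root))) (F.+-identityˡ _))

      private
        Q₁ : ∀ k → proj₁ (Q k) F.≈ s k
        Q₁ k = F.trans (proj₁-· (c ^ⱽ k) (P k)) (F.trans (F.*-congʳ (c^₁ k)) (F.*-identityˡ _))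

        Q₂ : ∀ k → proj₂ (Q k) F.≈ t k F.+ derive s k
        Q₂ k = F.trans (proj₂-· (c ^ⱽ k) (P k)) (F.+-cong (F.trans (F.*-congʳ (c^₁ k)) (F.*-identityˡ _)) (F.*-congʳ (c^₂ k)))

        E≈ : ∀ k → W.coreDet k V.≈ (P PV.⊛ Q) k
        E≈ k = V.trans (proj₂ (proj₂ root) k) (V.trans (RV.sign-⊛ m (P PV.⊛ Q) k)
          (V.trans (V.*-congʳ {(P PV.⊛ Q) k} (sign≈1 m)) (V.*-identityˡ ((P PV.⊛ Q) k))))

        E₁ : ∀ k → proj₁ (W.coreDet k) F.≈ (s PF.⊛ s) k
        E₁ k = F.trans (proj₁ (E≈ k)) (F.trans (SeriesHom.map-⊛ pr₁ P Q k) (PF.⊛-cong {s} {s} (λ _ → F.refl) Q₁ k))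

        -- For P = s + t π one has τ(P) = s + (t + `derive s`) π. In P τ(P) the two products of s
        -- and t cancel in characteristic 2, so the unknown t disappears.
        E₂ : ∀ k → proj₂ (W.coreDet k) F.≈ (s PF.⊛ derive s) k
        E₂ k = F.trans (proj₂ (E≈ k)) (F.trans (proj₂-⊛ P Q k) (F.trans
          (F.+-cong (F.trans (PF.⊛-cong {s} {s} (λ _ → F.refl) Q₂ k) (PF.⊛-distribˡ s t (derive s) k))
            (F.trans (PF.⊛-cong {t} {t} (λ _ → F.refl) Q₁ k) (PF.⊛-comm t s k)))
          (F.trans (SF.solve 2 (λ x y → (x SF.:+ y) SF.:+ x SF.:= y SF.:+ (x SF.:+ x)) F.refl _ _)
            (F.trans (F.+-congˡ (double≈0 _)) (F.+-identityʳ _)))))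

      z-even : ∀ j → h₀.fun (z (double j)) F.≈ s j F.* s j
      z-even j = F.trans (residue-even j (z-residue (double j))) (F.trans (quotient₁ (double j)) (F.trans (E₁ (double j))
        (F.trans (F.reflexive (≡.cong (s PF.⊛ s) (double-+ j))) (⊛-square-diagonal s j))))
        where
        double-+ : ∀ j → double j ≡ j ℕ.+ j
        double-+ zero    = ≡.refl
        double-+ (suc j) = ≡.cong suc (≡.trans (≡.cong suc (double-+ j)) (≡.sym (ℕₚ.+-suc j j)))

      -- The bordered determinant drops out: its matrix has odd size, so its first coordinate is 0.
      z-odd : ∀ j → h₀.fun (z (suc (double j))) F.≈ (s PF.⊛ s) (suc (suc (double j))) F.+ (s PF.⊛ derive s) (suc (double j))
      z-odd j = F.trans (residue-odd j (z-residue (suc (double j)))) (F.trans (quotient₂ (suc (double j)))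
        (F.trans (F.+-cong (F.+-cong (E₁ _) (E₂ _)) (RV.H.det-odd m W.bordered-even _)) (F.+-identityʳ _)))

    -- In the coefficient of odd degree j of s · derive s, the top coefficient s j occurs only once, as parity 0 = 0 and parity j = 1.
    determine-odd : ∀ (s s′ : PF.Series) i → s 0 F.≈ F.1# → s′ 0 F.≈ F.1# → let j = suc (double (suc i)) in
      (∀ l → l < j → s l F.≈ s′ l) →
      (s PF.⊛ s) (suc j) F.+ (s PF.⊛ derive s) j F.≈ (s′ PF.⊛ s′) (suc j) F.+ (s′ PF.⊛ derive s′) j → s j F.≈ s′ j
    determine-odd s s′ i s₀ s₀′ lower eq = F.trans (F.sym (top s s₀)) (F.trans (∙-cancelʳ _ _ _ tails) (top s′ s₀′))
      where
      open import Algebra.Properties.AbelianGroup F.+-abelianGroup using (∙-cancelʳ; ∙-cancelˡ)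
      j : ℕ
      j = suc (double (suc i))
      top : ∀ f → f 0 F.≈ F.1# → f 0 F.* derive f j F.≈ f j
      top f f₀ = F.trans (F.*-cong f₀ (F.trans (F.*-congʳ (parity-odd (suc i))) (F.*-identityˡ _))) (F.*-identityˡ _)
      -- 2 l = j + 1 gives l < j only from j = 3 on. For j = 1 the square contributes s₁² and the
      -- equation carries no information, hence the index starts at 3.
      half< : ∀ l → l ℕ.+ l ≡ suc j → l < j
      half< l@(suc (suc _)) e = ℕₚ.≤-pred (≡.subst (suc (suc l) ≤_) e (ℕₚ.+-monoˡ-≤ l (s≤s (s≤s z≤n))))
      half< (suc zero) ()
      squares : (s PF.⊛ s) (suc j) F.≈ (s′ PF.⊛ s′) (suc j)
      squares = ⊛-square-determined (suc j) s s′ (λ l e → lower l (half< l e))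
      products : (s PF.⊛ derive s) j F.≈ (s′ PF.⊛ derive s′) j
      products = ∙-cancelˡ _ _ _ (F.trans eq (F.+-congʳ (F.sym squares)))
      rest : ((λ k → s (suc k)) PF.⊛ derive s) (double (suc i)) F.≈ ((λ k → s′ (suc k)) PF.⊛ derive s′) (double (suc i))
      rest = PF.⊛-congₖ {λ k → s (suc k)} {λ k → s′ (suc k)} {derive s} {derive s′} (double (suc i)) term
        where
        term : ∀ a b → a ℕ.+ b ≡ double (suc i) → s (suc a) F.* derive s b F.≈ s′ (suc a) F.* derive s′ b
        term a zero    e = F.trans (vanish (s (suc a)) (s 0)) (F.sym (vanish (s′ (suc a)) (s′ 0)))
          where
          vanish : ∀ x y → x F.* (F.0# F.* y) F.≈ F.0#
          vanish x y = F.trans (F.*-congˡ (F.zeroˡ y)) (F.zeroʳ x)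
        term a (suc b) e = F.*-cong
          (lower (suc a) (s≤s (≡.subst (suc a ≤_) (≡.trans (≡.sym (ℕₚ.+-suc a b)) e) (s≤s (ℕₚ.m≤m+n a b)))))
          (F.*-congˡ (lower (suc b) (s≤s (≡.subst (suc b ≤_) e (ℕₚ.m≤n+m (suc b) a)))))
      tails : s 0 F.* derive s j F.+ ((λ k → s (suc k)) PF.⊛ derive s) (double (suc i)) F.≈ s′ 0 F.* derive s′ j F.+ ((λ k → s (suc k)) PF.⊛ derive s) (double (suc i))
      tails = F.trans products (F.+-congˡ (F.sym rest))

-- Lifting matrices of roots of unity; p as a multiple of ρ

module LaurentUnits where
  open RingPreliminaries
  open Rings
  open Pencil using (module Kronecker)
  open Geometric
  open Laurent
  open import Data.Product.Base using (_×_)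

  module Units (R : CRing) (ρ : CommutativeRing.Carrier R) where
    open LaurentRing R ρ
    open GeometricSums extension using (_^_; inverse-^; geo; count; balanced; module OneModulo)
    open OneModulo π
    open Hom conjugate using () renaming (fun to conj; cong to conj-cong; *-homo to conj-*; 1-homo to conj-1; -‿homo₂ to conj-difference)
    private module SR = Solver R
    open SR using (_:=_; _:+_; _:*_; :-_; con)

    ζζ̄ : ζ U.* ζ̄ U.≈ U.1#
    ζζ̄ = SR.solve 1 (λ r → con (+ 1) :* (con (+ 1) :+ :- r) :+ :- (r :* (:- con (+ 1) :* con (+ 1))) := con (+ 1)) R.refl ρ ,
      SR.solve 1 (λ r → con (+ 1) :* con (+ 1) :+ :- con (+ 1) :* (con (+ 1) :+ :- r) :+ r :* (:- con (+ 1) :* con (+ 1)) := con (+ 0)) R.refl ρ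

    conj-ζ : conj ζ U.≈ ζ̄
    conj-ζ = SR.solve 1 (λ r → con (+ 1) :+ r :* :- con (+ 1) := con (+ 1) :+ :- r) R.refl ρ ,
      SR.solve 0 (:- (:- con (+ 1)) := con (+ 1)) R.refl

    conj-ζ̄ : conj ζ̄ U.≈ ζ
    conj-ζ̄ = SR.solve 1 (λ r → (con (+ 1) :+ :- r) :+ r :* con (+ 1) := con (+ 1)) R.refl ρ , R.refl

    ζ≡1 : ζ ≡1
    ζ≡1 = (R.- R.1# , R.0#) ,
      SR.solve 1 (λ r → con (+ 1) :+ :- con (+ 1) := con (+ 0) :* :- con (+ 1) :+ :- (r :* (con (+ 1) :* con (+ 0)))) R.refl ρ ,
      SR.solve 1 (λ r → :- con (+ 1) :+ :- con (+ 0) := con (+ 0) :* con (+ 0) :+ con (+ 1) :* :- con (+ 1) :+ r :* (con (+ 1) :* con (+ 0))) R.refl ρ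

    ζ̄≡1 : ζ̄ ≡1
    ζ̄≡1 = ζ̄ ,
      SR.solve 1 (λ r → (con (+ 1) :+ :- r) :+ :- con (+ 1) := con (+ 0) :* (con (+ 1) :+ :- r) :+ :- (r :* (con (+ 1) :* con (+ 1)))) R.refl ρ ,
      SR.solve 1 (λ r → con (+ 1) :+ :- con (+ 0) := con (+ 0) :* con (+ 1) :+ con (+ 1) :* (con (+ 1) :+ :- r) :+ r :* (con (+ 1) :* con (+ 1))) R.refl ρ

    conj-ζ^ : ∀ k → conj (ζ ^ k) U.≈ ζ̄ ^ k
    conj-ζ^ k = U.trans (hom-^ conjugate ζ k) (GeometricSums.^-congˡ extension k conj-ζ)

    conj-ζ̄^ : ∀ k → conj (ζ̄ ^ k) U.≈ ζ ^ k
    conj-ζ̄^ k = U.trans (hom-^ conjugate ζ̄ k) (GeometricSums.^-congˡ extension k conj-ζ̄)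

    -- Only exponents above the diagonal are read, and the inverse powers stand below it. The lift
    -- is therefore Hermitian identically in ζ, not merely modulo the relations of a particular root
    -- of unity.
    power : ∀ {n} → (Fin n → Fin n → ℕ) → Fin n → Fin n → U.Carrier
    power k zero    zero    = U.1#
    power k zero    (suc j) = ζ ^ k zero (suc j)
    power k (suc i) zero    = ζ̄ ^ k zero (suc i)
    power k (suc i) (suc j) = power (λ a b → k (suc a) (suc b)) i j

    power-diag : ∀ {n} (k : Fin n → Fin n → ℕ) i → power k i i U.≈ U.1#
    power-diag k zero    = U.refl
    power-diag k (suc i) = power-diag _ i

    power-unit : ∀ {n} (k : Fin n → Fin n → ℕ) i j → power k i j U.* power k j i U.≈ U.1#
    power-unit k zero    zero    = U.*-identityˡ U.1#
    power-unit k zero    (suc j) = inverse-^ {ζ} {ζ̄} ζζ̄ (k zero (suc j))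
    power-unit k (suc i) zero    = inverse-^ {ζ̄} {ζ} (U.trans (U.*-comm ζ̄ ζ) ζζ̄) (k zero (suc i))
    power-unit k (suc i) (suc j) = power-unit _ i j

    power-herm : ∀ {n} (k : Fin n → Fin n → ℕ) i j → conj (power k i j) U.≈ power k j i
    power-herm k zero    zero    = conj-1
    power-herm k zero    (suc j) = conj-ζ^ (k zero (suc j))
    power-herm k (suc i) zero    = conj-ζ̄^ (k zero (suc i))
    power-herm k (suc i) (suc j) = power-herm _ i j

    power-≡1 : ∀ {n} (k : Fin n → Fin n → ℕ) i j → power k i j ≡1
    power-≡1 k zero    zero    = 1≡1
    power-≡1 k zero    (suc j) = ^-≡1 (k zero (suc j)) ζ≡1
    power-≡1 k (suc i) zero    = ^-≡1 (k zero (suc i)) ζ̄≡1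
    power-≡1 k (suc i) (suc j) = power-≡1 _ i j

    unitary : ∀ {n} → (Fin n → Fin n → ℕ) → Unitary n
    unitary k = record
      { T = power k ; diag = power-diag k ; unit = power-unit k ; herm = power-herm k
      ; quot = λ i j → proj₁ (power-≡1 k i j) ; quot-π = λ i j → proj₂ (power-≡1 k i j) }

    module _ {A : CRing} (φ : Hom extension A) where
      private
        module A = CommutativeRing A
        module φ = Hom φ
        module GA = GeometricSums A

      hom-power : ∀ {n} (k : Fin n → Fin n → ℕ) (mat : Fin n → Fin n → A.Carrier) →
        (∀ i → mat i i A.≈ A.0#) → (∀ i j → i ≢ j → mat i j A.≈ φ.fun ζ GA.^ k i j) → (∀ i j → i ≢ j → mat j i A.≈ φ.fun ζ̄ GA.^ k i j) →
        ∀ i j → φ.fun (power k i j) A.≈ mat i j A.+ Kronecker.δ A i j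
      hom-power k mat d u l zero    zero    = A.trans φ.1-homo (A.sym (A.trans (A.+-congʳ (d zero)) (A.+-identityˡ _)))
      hom-power k mat d u l zero    (suc j) = A.trans (hom-^ φ ζ (k zero (suc j))) (A.trans (A.sym (u zero (suc j) (λ ()))) (A.sym (A.+-identityʳ _)))
      hom-power k mat d u l (suc i) zero    = A.trans (hom-^ φ ζ̄ (k zero (suc i))) (A.trans (A.sym (l zero (suc i) (λ ()))) (A.sym (A.+-identityʳ _)))
      hom-power k mat d u l (suc i) (suc j) = hom-power (λ a b → k (suc a) (suc b)) (λ a b → mat (suc a) (suc b)) (λ i → d (suc i))
        (λ i j ne → u (suc i) (suc j) (λ { ≡.refl → ne ≡.refl })) (λ i j ne → l (suc i) (suc j) (λ { ≡.refl → ne ≡.refl })) i j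

  module PrimeMultiple (R : CRing) (ρ : CommutativeRing.Carrier R)
    (ρ-cancel : Regular R ρ) (2-cancel : TwoTorsionFree R)
    (F : CRing) (h₀ : Hom R F) (h₀-ρ : IsZero F (Hom.fun h₀ ρ)) (two : IsZero F (CommutativeRing._+_ F (CommutativeRing.1# F) (CommutativeRing.1# F))) where
    open LaurentRing R ρ
    open Units R ρ
    open Coefficients R ρ ρ-cancel 2-cancel F h₀ h₀-ρ two using (real⇒proj₂≈0; divide-real)
    open GeometricSums extension using (_^_; geo; count; balanced; module OneModulo)
    open OneModulo π
    open Hom conjugate using () renaming (fun to conj; cong to conj-cong; *-homo to conj-*; -‿homo₂ to conj-difference)

    -- A real element divisible by π is divisible by ρ.
    prime-multiple : ∀ s m c → c ℕ.+ c ≡ s ℕ.* m →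
      ∃ λ w → count (suc m) U.+ U.- (ζ̄ ^ c U.* geo (ζ ^ s) (suc m)) U.≈ embed (ρ R.* w)
    prime-multiple s m c eq = build (count-geo (ζ̄ ^ c) (ζ ^ s) (suc m) (^-≡1 c ζ̄≡1) (^-≡1 s ζ≡1))
      where
      Ψ x : U.Carrier
      Ψ = ζ̄ ^ c U.* geo (ζ ^ s) (suc m)
      x = count (suc m) U.+ U.- Ψ
      real-Ψ : conj Ψ U.≈ Ψ
      real-Ψ = U.trans (conj-* (ζ̄ ^ c) (geo (ζ ^ s) (suc m))) (U.trans
        (U.*-cong (conj-ζ̄^ c) (U.trans (hom-geo conjugate (ζ ^ s) (suc m)) (GeometricSums.geo-cong extension {conj (ζ ^ s)} {ζ̄ ^ s} (suc m) (conj-ζ^ s))))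
        (balanced {ζ} {ζ̄} ζζ̄ s m c eq))
      real-x : conj x U.≈ x
      real-x = U.trans (conj-difference (count (suc m)) Ψ) (U.+-cong (hom-count conjugate (suc m)) (U.-‿cong real-Ψ))
      build : (∃ λ y → x U.≈ π U.* y) → ∃ λ w → x U.≈ embed (ρ R.* w)
      build (y , e) = finish (divide-real 1 y (R.trans (R.sym (proj₂ e′)) x₂))
        where
        x₂ : proj₂ x R.≈ R.0#
        x₂ = real⇒proj₂≈0 x real-x
        e′ : x U.≈ π ^ 1 U.* y
        e′ = U.trans e (U.*-congʳ {y} (U.sym (U.*-identityʳ π)))
        finish : (∃ λ z → proj₁ (π ^ 1 U.* y) R.≈ _ × _) → _
        finish (z , p , _) = z , R.trans (proj₁ e′) (R.trans p (R.*-congʳ (R.*-identityʳ ρ))) , x₂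

-- Specialising the indeterminate to a root of unity; base-ρ digits

module Specialise where
  open RingPreliminaries
  open PowerSeries
  open Determinant
  open Pencil
  open Rings
  open CoreHom
  open CharPoly
  open Horner
  open LowCoeffs
  open Counting
  open IntDigits
  open Geometric
  open Laurent
  open LaurentUnits
  open import Data.Integer.DivMod using (_/ℕ_)
  open import Data.List.Base using (List; []; _∷_)

  module ℤ[x] = Polynomials ℤ-ring

  ℤ[ρ] : CRing
  ℤ[ρ] = ℤ[x].poly

  ρᵤ : List ℤ
  ρᵤ = ℤ[x].X

  private
    module ℤS = PS ℤ-ring

  coeff-ρ* : ∀ a k → ℤ[x].coeff (ρᵤ ℤ[x].*P a) k ≡ ℤ[x].coeff (+ 0 ∷ a) k
  coeff-ρ* a zero    = ≡.trans (ℤ[x].coeff-* ρᵤ a 0) (ℤₚ.*-zeroˡ (ℤ[x].coeff a 0))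
  coeff-ρ* a (suc k) = ≡.trans (ℤ[x].coeff-* ρᵤ a (suc k)) (≡.trans
    (≡.cong₂ ℤ._+_ (ℤₚ.*-zeroˡ (ℤ[x].coeff a (suc k))) (≡.trans (ℤS.⊛-cong ℤ[x].coeff-1 (λ _ → ≡.refl) k) (ℤS.⊛-identityˡ (ℤ[x].coeff a) k)))
    (ℤₚ.+-identityˡ (ℤ[x].coeff a k)))

  ρ-cancel : ∀ a → (∀ k → ℤ[x].coeff (ρᵤ ℤ[x].*P a) k ≡ + 0) → ∀ k → ℤ[x].coeff a k ≡ + 0
  ρ-cancel a p k = ≡.trans (≡.sym (coeff-ρ* a (suc k))) (p (suc k))

  2-cancel : ∀ a → (∀ k → ℤ[x].coeff (a ℤ[x].+P a) k ≡ + 0) → ∀ k → ℤ[x].coeff a k ≡ + 0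
  2-cancel a p k = zero-double (ℤ[x].coeff a k) (≡.trans (≡.sym (ℤ[x].coeff-+ a a k)) (p k))
    where
    zero-double : ∀ x → x ℤ.+ x ≡ + 0 → x ≡ + 0
    zero-double (+ zero)  _ = ≡.refl
    zero-double (+ suc n) ()
    zero-double -[1+ n ]  ()

  F₂ : CRing
  F₂ = Mod.quotient 2

  constant : Hom ℤ[ρ] F₂
  constant = ℤ[x].Eval.evalHom (Mod.project 2) (+ 0)

  constant-coeff : ∀ a → Mod._~_ 2 (Hom.fun constant a) (ℤ[x].coeff a 0)
  constant-coeff []      = CommutativeRing.refl F₂
  constant-coeff (x ∷ a) = Mod.≈⇒~ 2 (≡.trans (≡.cong (λ t → x ℤ.+ t) (ℤₚ.*-zeroˡ (Hom.fun constant a))) (ℤₚ.+-identityʳ x))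

  module K = Coefficients ℤ[ρ] ρᵤ ρ-cancel 2-cancel F₂ constant (congruent (+ 0) ≡.refl) (congruent (+ 1) ≡.refl)
  module PM = PrimeMultiple ℤ[ρ] ρᵤ ρ-cancel 2-cancel F₂ constant (congruent (+ 0) ≡.refl) (congruent (+ 1) ≡.refl)
  module N = Units ℤ[ρ] ρᵤ
  module LR = LaurentRing ℤ[ρ] ρᵤ

  drop₁ : List ℤ → List ℤ
  drop₁ []      = []
  drop₁ (_ ∷ a) = a

  -- In the application p = m + 1 and s = p^(f-1), so that `geo≈0` is Φ(ζ) = 0. The number c, half
  -- of s m, centres the geometric sum so that it becomes real.
  module Specialisation (A : CRing) (ι : Hom ℤ-ring A) (ζ ζ⁻¹ : CommutativeRing.Carrier A) (ζζ⁻¹ : MutuallyInverse A ζ ζ⁻¹)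
    (s m c : ℕ) (2c : c ℕ.+ c ≡ s ℕ.* m) (geo≈0 : IsZero A (GeometricSums.geo A (GeometricSums._^_ A ζ s) (suc m))) where
    open CommutativeRing A hiding (zero)
    open GeometricSums A
    open Solver A using (solve; _:=_; _:+_; _:*_; :-_; con)
    open import Relation.Binary.Reasoning.Setoid setoid
    open import Algebra.Properties.Ring ring using (-‿distribʳ-*)
    private module ι = Hom ι

    ϖ ρ : Carrier
    ϖ = 1# + - ζ
    ρ = (1# + - ζ) * (1# + - ζ⁻¹)

    ev : Hom ℤ[ρ] A
    ev = ℤ[x].Eval.evalHom ι ρ
    module ev = Hom ev

    ev-ρ : ev.fun ρᵤ ≈ ρ
    ev-ρ = trans (+-cong ι.0-homo (*-congˡ (trans (+-cong ι.1-homo (zeroʳ ρ)) (+-identityʳ _)))) (trans (+-identityˡ _) (*-identityʳ _))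

    private
      ρ-sum : ρ ≈ (1# + 1#) + - ζ + - ζ⁻¹
      ρ-sum = trans (solve 2 (λ x y → (con (+ 1) :+ :- x) :* (con (+ 1) :+ :- y) := con (+ 1) :+ :- x :+ :- y :+ x :* y) refl ζ ζ⁻¹)
        (trans (+-congˡ ζζ⁻¹) (solve 2 (λ x y → con (+ 1) :+ :- x :+ :- y :+ con (+ 1) := (con (+ 1) :+ con (+ 1)) :+ :- x :+ :- y) refl ζ ζ⁻¹))

      relation : ϖ * ϖ ≈ ev.fun ρᵤ * ϖ + - ev.fun ρᵤ
      relation = begin
        ϖ * ϖ                                             ≈⟨ solve 2 (λ x y → (con (+ 1) :+ :- x) :* (con (+ 1) :+ :- x) :=
                                                               ((con (+ 1) :+ con (+ 1)) :+ :- x :+ :- y) :* (con (+ 1) :+ :- x) :+ :- ((con (+ 1) :+ :- x) :* (con (+ 1) :+ :- y))) refl ζ ζ⁻¹ ⟩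
        ((1# + 1#) + - ζ + - ζ⁻¹) * ϖ + - ρ               ≈⟨ +-congʳ (*-congʳ ρ-sum) ⟨
        ρ * ϖ + - ρ                                       ≈⟨ +-cong (*-congʳ ev-ρ) (-‿cong ev-ρ) ⟨
        ev.fun ρᵤ * ϖ + - ev.fun ρᵤ                       ∎

    φ : Hom LR.extension A
    φ = QuadraticCollapse.collapse ev ρᵤ ϖ relation
    module φ = Hom φ

    private
      ev-neg1 : ev.fun (CommutativeRing.-_ ℤ[ρ] (CommutativeRing.1# ℤ[ρ])) ≈ - 1#
      ev-neg1 = trans (ev.neg-homo (CommutativeRing.1# ℤ[ρ])) (-‿cong ev.1-homo)

    φ-ζ : φ.fun LR.ζ ≈ ζ
    φ-ζ = trans (+-cong ev.1-homo (*-congʳ ev-neg1)) (solve 1 (λ x → con (+ 1) :+ :- con (+ 1) :* (con (+ 1) :+ :- x) := x) refl ζ)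

    φ-ζ̄ : φ.fun LR.ζ̄ ≈ ζ⁻¹
    φ-ζ̄ = trans (+-cong (trans (ev.-‿homo₂ (CommutativeRing.1# ℤ[ρ]) ρᵤ) (+-cong ev.1-homo (-‿cong (trans ev-ρ ρ-sum)))) (*-congʳ ev.1-homo))
      (solve 2 (λ x y → (con (+ 1) :+ :- ((con (+ 1) :+ con (+ 1)) :+ :- x :+ :- y)) :+ con (+ 1) :* (con (+ 1) :+ :- x) := y) refl ζ ζ⁻¹)

    φ-embed : ∀ x → φ.fun (LR.embed x) ≈ ev.fun x
    φ-embed x = trans (+-congˡ (trans (*-congʳ ev.0-homo) (zeroˡ ϖ))) (+-identityʳ _)

    private
      module UU = CommutativeRing LR.extension
      module GU = GeometricSums LR.extension

      Ψ : LR.Pair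
      Ψ = (LR.ζ̄ GU.^ c) UU.* GU.geo (LR.ζ GU.^ s) (suc m)

      multiple : ∃ λ w → GU.count (suc m) UU.+ UU.- Ψ UU.≈ LR.embed (ρᵤ ℤ[x].*P w)
      multiple = PM.prime-multiple s m c 2c

    w : List ℤ
    w = proj₁ multiple

    private
      ι-count : ∀ k → ι.fun (+ k) ≈ count k
      ι-count zero    = ι.0-homo
      ι-count (suc k) = trans (ι.+-homo (+ 1) (+ k)) (+-cong ι.1-homo (ι-count k))

      φ-Ψ : φ.fun Ψ ≈ 0#
      φ-Ψ = trans (φ.*-homo (LR.ζ̄ GU.^ c) (GU.geo (LR.ζ GU.^ s) (suc m))) (trans (*-congˡ (trans (hom-geo φ (LR.ζ GU.^ s) (suc m))
        (trans (geo-cong {φ.fun (LR.ζ GU.^ s)} {ζ ^ s} (suc m) (trans (hom-^ φ LR.ζ s) (^-congˡ s φ-ζ))) geo≈0))) (zeroʳ _))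

    -- The centred geometric sum is zero in `A`, while over the free ring it differs from p by a
    -- multiple of ρ.
    ι-p : ι.fun (+ suc m) ≈ ρ * ev.fun w
    ι-p = begin
      ι.fun (+ suc m)                                 ≈⟨ ι-count (suc m) ⟩
      count (suc m)                                   ≈⟨ hom-count φ (suc m) ⟨
      φ.fun (GU.count (suc m))                        ≈⟨ trans (+-congˡ (trans (-‿cong φ-Ψ) (solve 0 (:- con (+ 0) := con (+ 0)) refl))) (+-identityʳ _) ⟨
      φ.fun (GU.count (suc m)) + - φ.fun Ψ            ≈⟨ φ.-‿homo₂ (GU.count (suc m)) Ψ ⟨
      φ.fun (GU.count (suc m) UU.+ UU.- Ψ)            ≈⟨ φ.cong {GU.count (suc m) UU.+ UU.- Ψ} {LR.embed (ρᵤ ℤ[x].*P w)} (proj₂ multiple) ⟩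
      φ.fun (LR.embed (ρᵤ ℤ[x].*P w))                 ≈⟨ φ-embed (ρᵤ ℤ[x].*P w) ⟩
      ev.fun (ρᵤ ℤ[x].*P w)                           ≈⟨ ev.*-homo ρᵤ w ⟩
      ev.fun ρᵤ * ev.fun w                            ≈⟨ *-congʳ ev-ρ ⟩
      ρ * ev.fun w                                    ∎

    InIdeal : ℕ → Carrier → Set
    InIdeal e x = ∃ λ d → x ≈ ρ ^ e * ev.fun d

    InIdeal-resp : ∀ {e x y} → x ≈ y → InIdeal e x → InIdeal e y
    InIdeal-resp p (d , q) = d , trans (sym p) q

    InIdeal-0 : ∀ {e} → InIdeal e 0#
    InIdeal-0 = [] , sym (zeroʳ _)

    InIdeal-+ : ∀ {e x y} → InIdeal e x → InIdeal e y → InIdeal e (x + y)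
    InIdeal-+ {e} (d , p) (d′ , q) = d ℤ[x].+P d′ , trans (+-cong p q) (trans (sym (distribˡ (ρ ^ e) _ _)) (*-congˡ (sym (ev.+-homo d d′))))

    private
      digit : List ℤ → Fin (suc m)
      digit a = digitℤ (suc m) (ℤ[x].coeff a 0)

      carry : List ℤ → ℤ
      carry a = ℤ[x].coeff a 0 /ℕ suc m

      -- Division by ρ after the digit is removed: what remains of the constant coefficient is p ·
      -- `carry` = ρ · `w` · `carry`, and all other terms lose one factor ρ.
      next : List ℤ → List ℤ
      next a = ((carry a ∷ []) ℤ[x].*P w) ℤ[x].+P drop₁ a

      ev-drop : ∀ a → ev.fun a ≈ ι.fun (ℤ[x].coeff a 0) + ρ * ev.fun (drop₁ a)
      ev-drop []      = sym (trans (+-cong ι.0-homo (zeroʳ ρ)) (+-identityˡ _))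
      ev-drop (x ∷ a) = refl

      ev-digit : ∀ a → ev.fun a ≈ ι.fun (+ toℕ (digit a)) + ρ * ev.fun (next a)
      ev-digit a = begin
        ev.fun a
          ≈⟨ ev-drop a ⟩
        ι.fun (ℤ[x].coeff a 0) + ρ * ev.fun (drop₁ a)
          ≈⟨ +-congʳ (trans (ι.cong (digitℤ-/ (suc m) (ℤ[x].coeff a 0))) (trans (ι.+-homo _ _) (+-congˡ (trans (ι.*-homo _ _) (*-congʳ ι-p))))) ⟩
        (ι.fun (+ toℕ (digit a)) + ρ * ev.fun w * ι.fun (carry a)) + ρ * ev.fun (drop₁ a)
          ≈⟨ solve 5 (λ d r w q t → (d :+ r :* w :* q) :+ r :* t := d :+ r :* (q :* w :+ t)) refl (ι.fun (+ toℕ (digit a))) ρ (ev.fun w) (ι.fun (carry a)) (ev.fun (drop₁ a)) ⟩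
        ι.fun (+ toℕ (digit a)) + ρ * (ι.fun (carry a) * ev.fun w + ev.fun (drop₁ a))
          ≈⟨ +-congˡ (*-congˡ (trans (ev.+-homo ((carry a ∷ []) ℤ[x].*P w) (drop₁ a)) (+-congʳ (trans (ev.*-homo (carry a ∷ []) w) (*-congʳ (trans (+-congˡ (zeroʳ ρ)) (+-identityʳ _))))))) ⟨
        ι.fun (+ toℕ (digit a)) + ρ * ev.fun (next a) ∎

      step : ∀ s x y → digit x ≡ digit y → InIdeal s (ev.fun (next x) + - ev.fun (next y)) → InIdeal (suc s) (ev.fun x + - ev.fun y)
      step s x y eq (d , p) = d , (begin
        ev.fun x + - ev.fun y
          ≈⟨ +-cong (ev-digit x) (-‿cong (trans (ev-digit y) (+-congʳ (ι.cong (≡.cong (λ t → + toℕ t) (≡.sym eq)))))) ⟩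
        (ι.fun (+ toℕ (digit x)) + ρ * ev.fun (next x)) + - (ι.fun (+ toℕ (digit x)) + ρ * ev.fun (next y))
          ≈⟨ solve 4 (λ t r a b → (t :+ r :* a) :+ :- (t :+ r :* b) := r :* (a :+ :- b)) refl (ι.fun (+ toℕ (digit x))) ρ (ev.fun (next x)) (ev.fun (next y)) ⟩
        ρ * (ev.fun (next x) + - ev.fun (next y))
          ≈⟨ trans (*-congˡ p) (sym (*-assoc ρ (ρ ^ s) (ev.fun d))) ⟩
        ρ ^ suc s * ev.fun d ∎)

    open Digits digit next (λ s x y → InIdeal s (ev.fun x + - ev.fun y)) (λ x y → x ℤ[x].+P ℤ[x].negP y , sym (trans (*-identityˡ _) (ev.-‿homo₂ x y))) step
      public using (digits; digits-agree)

    record SeidelMatrix (n : ℕ) : Set where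
      field
        mat      : Fin n → Fin n → Carrier
        diag     : ∀ i → mat i i ≈ 0#
        exponent : Fin n → Fin n → ℕ
        upper    : ∀ i j → i ≢ j → mat i j ≈ ζ ^ exponent i j
        lower    : ∀ i j → i ≢ j → mat j i ≈ ζ⁻¹ ^ exponent i j

    open Polynomials A using (Pol; _+P_; _*P_; negP; coeff)
    open CharacteristicPolynomial A using (entry; charPoly-coeff)
    open CharacteristicSeries A using (charSeries; lin-cong)
    open Homogenisation A using (horner-mem; horner-diff)
    private
      module L = Det {Pol} [] (1# ∷ []) _+P_ _*P_ negP
      module DS = DeterminantTheory (PS.series A)
      δ : ∀ {n} → Fin n → Fin n → Carrier
      δ = Kronecker.δ A

    charPoly : ∀ {n} → SeidelMatrix n → Pol
    charPoly {n} S = L.det n (entry (SeidelMatrix.mat S))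

    lift : ∀ {n} → SeidelMatrix n → LR.Unitary n
    lift S = N.unitary (SeidelMatrix.exponent S)

    z : ∀ {n} → SeidelMatrix (suc n) → ℕ → List ℤ
    z S = K.Matrix.z (lift S)

    private
      a : ∀ {n} → SeidelMatrix n → ℕ → Carrier
      a {n} S = charSeries n (λ i j → SeidelMatrix.mat S i j + δ i j)

      aᵤ : ∀ {n} → SeidelMatrix (suc n) → ℕ → LR.Pair
      aᵤ S = K.Matrix.a (lift S)

      φ-a : ∀ {n} (S : SeidelMatrix (suc n)) k → φ.fun (aᵤ S k) ≈ a S k
      φ-a {n} S k = trans (hom-charSeries φ (suc n) (N.power exponent) k) (DS.det-cong (suc n) (λ i j → lin-cong refl (-‿cong
        (N.hom-power φ exponent mat diag (λ i j ne → trans (upper i j ne) (^-congˡ (exponent i j) (sym φ-ζ)))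
          (λ i j ne → trans (lower i j ne) (^-congˡ (exponent i j) (sym φ-ζ̄))) i j))) k)
        where open SeidelMatrix S

      -- The lifted coefficient is real, so its π-coordinate contributes nothing under `φ`.
      ev-a : ∀ {n} (S : SeidelMatrix (suc n)) k → ev.fun (proj₁ (aᵤ S k)) ≈ a S k
      ev-a S k = trans (sym (trans (+-congˡ (trans (*-congʳ (trans (ev.cong {proj₂ (aᵤ S k)} {[]} (K.Matrix.a-proj₂ (lift S) k)) ev.0-homo)) (zeroˡ ϖ))) (+-identityʳ _))) (φ-a S k)

      a-z : ∀ {n} (S : SeidelMatrix (suc n)) k → a S (suc k) ≈ ρ ^ level k * ev.fun (z S k)
      a-z S k = trans (sym (ev-a S (suc k))) (trans (ev.cong {proj₁ (aᵤ S (suc k))} {(GeometricSums._^_ ℤ[ρ] ρᵤ (level k)) ℤ[x].*P z S k} (K.Matrix.a-z (lift S) k)) (trans (ev.*-homo (GeometricSums._^_ ℤ[ρ] ρᵤ (level k)) (z S k))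
        (*-congʳ (trans (hom-^ ev ρᵤ (level k)) (^-congˡ (level k) ev-ρ)))))

      a-low : ∀ {n} (S S′ : SeidelMatrix (suc n)) k → k ≤ 2 → a S k ≈ a S′ k
      a-low S S′ k p = trans (sym (φ-a S k)) (trans (φ.cong {aᵤ S k} {aᵤ S′ k} (K.a-low-unique (lift S) (lift S′) k p)) (φ-a S′ k))

      ev-ρ^ : ∀ r d → ρ ^ r * ev.fun d ≈ ev.fun ((GeometricSums._^_ ℤ[ρ] ρᵤ r) ℤ[x].*P d)
      ev-ρ^ r d = sym (trans (ev.*-homo (GeometricSums._^_ ℤ[ρ] ρᵤ r) d) (*-congʳ (trans (hom-^ ev ρᵤ r) (^-congˡ r ev-ρ))))

    module _ {n : ℕ} (e : ℕ) (S S′ : SeidelMatrix (suc n))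
      (agree : ∀ k i → i < e ∸ level (2 ℕ.+ k) → digits (z S (2 ℕ.+ k)) i ≡ digits (z S′ (2 ℕ.+ k)) i) where
      private
        low : ∀ k → k ≤ 2 → InIdeal e (a S k + - a S′ k)
        low k k≤2 = InIdeal-resp {e} (sym (trans (+-congʳ (a-low S S′ k k≤2)) (-‿inverseʳ _))) (InIdeal-0 {e})

        high : ∀ k → InIdeal e (a S (suc (suc (suc k))) + - a S′ (suc (suc (suc k))))
        high k = lift-ideal (digits-agree (e ∸ l) (z S (2 ℕ.+ k)) (z S′ (2 ℕ.+ k)) (agree k))
          where
          l r : ℕ
          l = level (2 ℕ.+ k)
          r = (l ℕ.+ (e ∸ l)) ∸ e
          lift-ideal : InIdeal (e ∸ l) (ev.fun (z S (2 ℕ.+ k)) + - ev.fun (z S′ (2 ℕ.+ k))) → InIdeal e (a S (suc (suc (suc k))) + - a S′ (suc (suc (suc k))))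
          lift-ideal (d , p) = (GeometricSums._^_ ℤ[ρ] ρᵤ r) ℤ[x].*P d , (begin
            a S (suc (suc (suc k))) + - a S′ (suc (suc (suc k)))
              ≈⟨ +-cong (a-z S (2 ℕ.+ k)) (-‿cong (a-z S′ (2 ℕ.+ k))) ⟩
            ρ ^ l * ev.fun (z S (2 ℕ.+ k)) + - (ρ ^ l * ev.fun (z S′ (2 ℕ.+ k)))
              ≈⟨ trans (distribˡ _ _ _) (+-congˡ (sym (-‿distribʳ-* _ _))) ⟨
            ρ ^ l * (ev.fun (z S (2 ℕ.+ k)) + - ev.fun (z S′ (2 ℕ.+ k)))
              ≈⟨ *-congˡ p ⟩
            ρ ^ l * (ρ ^ (e ∸ l) * ev.fun d)
              ≈⟨ trans (sym (*-assoc _ _ _)) (*-congʳ (sym (^-homo-* ρ l (e ∸ l)))) ⟩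
            ρ ^ (l ℕ.+ (e ∸ l)) * ev.fun d
              ≈⟨ *-congʳ (trans (reflexive (≡.cong (ρ ^_) (≡.sym (ℕₚ.m+[n∸m]≡n (ℕₚ.m≤n+m∸n e l))))) (^-homo-* ρ e r)) ⟩
            ρ ^ e * ρ ^ r * ev.fun d
              ≈⟨ trans (*-assoc _ _ _) (*-congˡ (ev-ρ^ r d)) ⟩
            ρ ^ e * ev.fun ((GeometricSums._^_ ℤ[ρ] ρᵤ r) ℤ[x].*P d) ∎)

        a-congruent : ∀ k → InIdeal e (a S k + - a S′ k)
        a-congruent 0 = low 0 z≤n
        a-congruent 1 = low 1 (s≤s z≤n)
        a-congruent 2 = low 2 (s≤s (s≤s z≤n))
        a-congruent (suc (suc (suc k))) = high k

      charPoly-congruent : ∀ k → InIdeal e (coeff (charPoly S) k + - coeff (charPoly S′) k)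
      charPoly-congruent k = InIdeal-resp {e}
        (trans (horner-diff (suc n) (a S) (a S′) k) (+-cong (sym (charPoly-coeff (SeidelMatrix.mat S) k)) (-‿cong (sym (charPoly-coeff (SeidelMatrix.mat S′) k)))))
        (horner-mem (InIdeal e) (InIdeal-resp {e}) (InIdeal-0 {e}) (InIdeal-+ {e}) (suc n) (λ k → a S k + - a S′ k) a-congruent k)

-- Digit counts for cyclotomic roots of unity

module CyclotomicBound where
  open RingPreliminaries
  open Hermitian using (double)
  open Rings
  open Counting
  open IntDigits
  open Geometric
  open Laurent
  open Specialise
  open RealBound using (<∸⇒+<; +<⇒<∸)
  open RealSeries using (square-~₂)
  open import Data.Nat.Base using (_^_)
  open import Data.List.Base using (List)
  open import Data.Integer.DivMod using (_/ℕ_)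
  open ≡ using (refl; sym; trans; cong; subst)

  private
    module Z₂ = CommutativeRing F₂
    _~₂_ : ℤ → ℤ → Set
    _~₂_ = Mod._~_ 2

  -- Confines the positions that still have digits left to the first 2 t, so that finitely many
  -- coefficients are recorded.
  level<⇒<double : ∀ k t → level k < t → k < double t
  level<⇒<double zero          (suc t) _       = s≤s z≤n
  level<⇒<double (suc zero)    (suc t) _       = s≤s (s≤s z≤n)
  level<⇒<double (suc (suc k)) (suc t) (s≤s p) = s≤s (s≤s (level<⇒<double k t p))

  level-double : ∀ j → level (double j) ≡ j
  level-double zero    = refl
  level-double (suc j) = cong suc (level-double j)

  level-suc-double : ∀ j → level (suc (double j)) ≡ suc j
  level-suc-double zero    = refl
  level-suc-double (suc j) = cong suc (level-suc-double j)

  evenOrOdd : ∀ n → (∃ λ i → n ≡ double i) ⊎ (∃ λ i → n ≡ suc (double i))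
  evenOrOdd zero = inj₁ (zero , refl)
  evenOrOdd (suc n) with evenOrOdd n
  ... | inj₁ (i , refl) = inj₂ (i , refl)
  ... | inj₂ (i , refl) = inj₁ (suc i , refl)

  -- Position k refers to z (2 + k), which comes from coefficient 3 + k. The value 1 marks a lowest digit that
  -- the recorded digits determine.
  skipEven skip₄ skipOdd : ℕ → ℕ
  skipEven zero          = 1
  skipEven (suc zero)    = 0
  skipEven (suc (suc k)) = skipEven k

  skip₄ 0 = 1
  skip₄ 1 = 0
  skip₄ 2 = 0
  skip₄ 3 = 0
  skip₄ (suc (suc (suc (suc k)))) = skip₄ k

  skipOdd 0 = 0
  skipOdd 1 = 0
  skipOdd 2 = 0
  skipOdd 3 = 0
  skipOdd (suc (suc (suc (suc k)))) = skip₄ k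

  private
    -- level (2 + k) = 1 + level k; the shift by 2 comes from the coefficients already fixed by the
    -- order.
    digit-position : ∀ e k i → i < e ∸ level (2 ℕ.+ k) → i < (e ∸ 1) ∸ level k
    digit-position e k i = subst (i <_) (sym (ℕₚ.∸-+-assoc e 1 (level k)))

    ∸-positive : ∀ i n l → i < n ∸ l → l < n
    ∸-positive i n l p = ℕₚ.≤-<-trans (ℕₚ.m≤n+m l i) (<∸⇒+< i n l p)

  module Bounds (A : CRing) (ι : Hom ℤ-ring A) (ζ ζ⁻¹ : CommutativeRing.Carrier A)
    (ζζ⁻¹ : MutuallyInverse A ζ ζ⁻¹) where
    private
      module A = CommutativeRing A
      module G = GeometricSums A

    module _ (s m c : ℕ) (2c : c ℕ.+ c ≡ s ℕ.* m) (geo≈0 : G.geo (ζ G.^ s) (suc m) A.≈ A.0#) where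
      open Specialisation A ι ζ ζ⁻¹ ζζ⁻¹ s m c 2c geo≈0
      open Polynomials A using (coeff)

      CharPolyCongruent : ∀ {n} → ℕ → SeidelMatrix n → SeidelMatrix n → Set
      CharPolyCongruent e S S′ = ∀ k → InIdeal e (coeff (charPoly S) k A.+ A.- coeff (charPoly S′) k)

      card-any : ∀ n e M (S : Fin M → SeidelMatrix (suc n)) → (∀ i j → i ≢ j → ¬ CharPolyCongruent e (S i) (S j)) →
        M ≤ suc m ^ total (double (e ∸ 1)) (λ k → (e ∸ 1) ∸ level k)
      card-any n e = family-bound (suc m) (λ S k i → digits (z S (2 ℕ.+ k)) i) (double (e ∸ 1)) (λ k → (e ∸ 1) ∸ level k) (CharPolyCongruent e)
        (λ S S′ agree → charPoly-congruent e S S′ (λ k i p → agree k i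
          (level<⇒<double k (e ∸ 1) (∸-positive i (e ∸ 1) (level k) (digit-position e k i p))) (digit-position e k i p)))

    module _ (s c : ℕ) (2c : c ℕ.+ c ≡ s ℕ.* 1) (geo≈0 : G.geo (ζ G.^ s) 2 A.≈ A.0#) where
      open Specialisation A ι ζ ζ⁻¹ ζζ⁻¹ s 1 c 2c geo≈0
      open Polynomials A using (coeff)
      private
        h₀ : List ℤ → ℤ
        h₀ = Hom.fun constant

        digit-residue : ∀ x y → h₀ x ~₂ h₀ y → digits x 0 ≡ digits y 0
        digit-residue x y p = digitℤ-cong₂ (ℤ[x].coeff x 0) (ℤ[x].coeff y 0) (Z₂.trans (Z₂.sym (constant-coeff x)) (Z₂.trans p (constant-coeff y)))

        residue-digit : ∀ x y → digits x 0 ≡ digits y 0 → h₀ x ~₂ h₀ y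
        residue-digit x y p = Z₂.trans (constant-coeff x) (Z₂.trans
          (congruent (ℤ[x].coeff x 0 /ℕ 2 ℤ.+ ℤ.- (ℤ[x].coeff y 0 /ℕ 2)) (digitℤ-congruent 2 (ℤ[x].coeff x 0) (ℤ[x].coeff y 0) p)) (Z₂.sym (constant-coeff y)))

        Recorded : ∀ {n} → (ℕ → ℕ) → ℕ → SeidelMatrix (suc n) → SeidelMatrix (suc n) → Set
        Recorded skip e S S′ = ∀ k i → k < double (e ∸ 1) → i < (e ∸ 1) ∸ level k ∸ skip k →
          digits (z S (2 ℕ.+ k)) (skip k ℕ.+ i) ≡ digits (z S′ (2 ℕ.+ k)) (skip k ℕ.+ i)

        complete : ∀ {n} (skip : ℕ → ℕ) (e : ℕ) (S S′ : SeidelMatrix (suc n)) → Recorded skip e S S′ →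
          (∀ k → skip k ≡ 0 ⊎ skip k ≡ 1) →
          (∀ k → skip k ≡ 1 → level k < e ∸ 1 → digits (z S (2 ℕ.+ k)) 0 ≡ digits (z S′ (2 ℕ.+ k)) 0) →
          ∀ k i → i < e ∸ level (2 ℕ.+ k) → digits (z S (2 ℕ.+ k)) i ≡ digits (z S′ (2 ℕ.+ k)) i
        complete skip e S S′ rec bit zeroth k i p = go (bit k) i (digit-position e k i p)
          where
          go : skip k ≡ 0 ⊎ skip k ≡ 1 → ∀ i → i < (e ∸ 1) ∸ level k → digits (z S (2 ℕ.+ k)) i ≡ digits (z S′ (2 ℕ.+ k)) i
          go (inj₁ eq) i p = subst (λ t → digits (z S (2 ℕ.+ k)) (t ℕ.+ i) ≡ digits (z S′ (2 ℕ.+ k)) (t ℕ.+ i)) eq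
            (rec k i (level<⇒<double k (e ∸ 1) (∸-positive i (e ∸ 1) (level k) p)) (subst (λ t → i < (e ∸ 1) ∸ level k ∸ t) (sym eq) p))
          go (inj₂ eq) zero p = zeroth k eq (∸-positive 0 (e ∸ 1) (level k) p)
          go (inj₂ eq) (suc i) p = subst (λ t → digits (z S (2 ℕ.+ k)) (t ℕ.+ i) ≡ digits (z S′ (2 ℕ.+ k)) (t ℕ.+ i)) eq
            (rec k i (level<⇒<double k (e ∸ 1) (∸-positive (suc i) (e ∸ 1) (level k) p))
              (subst (λ t → i < (e ∸ 1) ∸ level k ∸ t) (sym eq) (+<⇒<∸ i 1 (subst (_< (e ∸ 1) ∸ level k) (ℕₚ.+-comm 1 i) p))))

        bound : ∀ n e (skip : ℕ → ℕ) → (∀ (S S′ : SeidelMatrix (suc n)) → Recorded skip e S S′ → CharPolyCongruent s 1 c 2c geo≈0 e S S′) →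
          ∀ M (S : Fin M → SeidelMatrix (suc n)) → (∀ i j → i ≢ j → ¬ CharPolyCongruent s 1 c 2c geo≈0 e (S i) (S j)) →
          M ≤ 2 ^ total (double (e ∸ 1)) (λ k → (e ∸ 1) ∸ level k ∸ skip k)
        bound n e skip = family-bound 2 (λ S k i → digits (z S (2 ℕ.+ k)) (skip k ℕ.+ i)) (double (e ∸ 1)) (λ k → (e ∸ 1) ∸ level k ∸ skip k) (CharPolyCongruent s 1 c 2c geo≈0 e)

        skipEven-bit : ∀ k → skipEven k ≡ 0 ⊎ skipEven k ≡ 1
        skipEven-bit zero          = inj₂ refl
        skipEven-bit (suc zero)    = inj₁ refl
        skipEven-bit (suc (suc k)) = skipEven-bit k

        skip₄-bit : ∀ k → skip₄ k ≡ 0 ⊎ skip₄ k ≡ 1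
        skip₄-bit 0 = inj₂ refl
        skip₄-bit 1 = inj₁ refl
        skip₄-bit 2 = inj₁ refl
        skip₄-bit 3 = inj₁ refl
        skip₄-bit (suc (suc (suc (suc k)))) = skip₄-bit k

        skipOdd-bit : ∀ k → skipOdd k ≡ 0 ⊎ skipOdd k ≡ 1
        skipOdd-bit 0 = inj₁ refl
        skipOdd-bit 1 = inj₁ refl
        skipOdd-bit 2 = inj₁ refl
        skipOdd-bit 3 = inj₁ refl
        skipOdd-bit (suc (suc (suc (suc k)))) = skip₄-bit k

        skipEven-odd : ∀ i → skipEven (suc (double i)) ≡ 0
        skipEven-odd zero    = refl
        skipEven-odd (suc i) = skipEven-odd i

        skip₄-odd : ∀ i → skip₄ (suc (double i)) ≡ 0
        skip₄-odd zero          = refl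
        skip₄-odd (suc zero)    = refl
        skip₄-odd (suc (suc i)) = skip₄-odd i

        skipOdd-odd : ∀ i → skipOdd (suc (double i)) ≡ 0
        skipOdd-odd zero          = refl
        skipOdd-odd (suc zero)    = refl
        skipOdd-odd (suc (suc i)) = skip₄-odd i

        skip₄-2mod4 : ∀ i → skip₄ (double (suc (double i))) ≡ 0
        skip₄-2mod4 zero    = refl
        skip₄-2mod4 (suc i) = skip₄-2mod4 i

        skipOdd-2mod4 : ∀ i → skipOdd (double (suc (double i))) ≡ 0
        skipOdd-2mod4 zero    = refl
        skipOdd-2mod4 (suc i) = skip₄-2mod4 i

        0≢1 : ∀ {n : ℕ} → n ≡ 0 → n ≡ 1 → ∀ {X : Set} → X
        0≢1 refl ()

      -- At an even index the residue is the first coordinate of a determinant of odd size, hence 0.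
      -- At an odd index it is a second coordinate, to which this argument does not apply; so one
      -- digit is saved at every other position.
      card-evenOrder : ∀ m e M (S : Fin M → SeidelMatrix (suc (suc (double m)))) → (∀ i j → i ≢ j → ¬ CharPolyCongruent s 1 c 2c geo≈0 e (S i) (S j)) →
        M ≤ 2 ^ total (double (e ∸ 1)) (λ k → (e ∸ 1) ∸ level k ∸ skipEven k)
      card-evenOrder m e = bound (suc (double m)) e skipEven (λ S S′ rec → charPoly-congruent e S S′
        (complete skipEven e S S′ rec skipEven-bit (λ k eq _ → zeroth S S′ k eq (evenOrOdd k))))
        where
        zeroth : ∀ (S S′ : SeidelMatrix (suc (suc (double m)))) k → skipEven k ≡ 1 → (∃ λ i → k ≡ double i) ⊎ (∃ λ i → k ≡ suc (double i)) →
          digits (z S (2 ℕ.+ k)) 0 ≡ digits (z S′ (2 ℕ.+ k)) 0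
        zeroth S S′ _ _  (inj₁ (i , refl)) = digit-residue (z S (double (suc i))) (z S′ (double (suc i)))
          (Z₂.trans (K.residue-evenOrder (lift S) (suc i)) (Z₂.sym (K.residue-evenOrder (lift S′) (suc i))))
        zeroth S S′ _ eq (inj₂ (i , refl)) = 0≢1 (skipEven-odd i) eq

      -- Omitted are the lowest digits of z(2j) for odd j ≥ 3. They equal s_j², and s_j is already
      -- determined by the lowest digit of z(j) together with the smaller coefficients of s.
      card-oddOrder : ∀ m e M (S : Fin M → SeidelMatrix (suc (double m))) → (∀ i j → i ≢ j → ¬ CharPolyCongruent s 1 c 2c geo≈0 e (S i) (S j)) →
        M ≤ 2 ^ total (double (e ∸ 1)) (λ k → (e ∸ 1) ∸ level k ∸ skipOdd k)
      card-oddOrder m e = bound (double m) e skipOdd (λ S S′ rec → charPoly-congruent e S S′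
        (complete skipOdd e S S′ rec skipOdd-bit (λ k eq l<t → Pair.zeroth S S′ rec k eq l<t (evenOrOdd k))))
        where
        module Pair (S S′ : SeidelMatrix (suc (double m))) (rec : Recorded skipOdd e S S′) where
          module O = K.OddOrder {m} (lift S)
          module O′ = K.OddOrder {m} (lift S′)
          t : ℕ
          t = e ∸ 1

          known : ∀ k → skipOdd k ≡ 0 → level k < t → h₀ (z S (2 ℕ.+ k)) ~₂ h₀ (z S′ (2 ℕ.+ k))
          known k eq l<t = residue-digit (z S (2 ℕ.+ k)) (z S′ (2 ℕ.+ k)) (subst (λ x → digits (z S (2 ℕ.+ k)) (x ℕ.+ 0) ≡ digits (z S′ (2 ℕ.+ k)) (x ℕ.+ 0)) eq
            (rec k 0 (level<⇒<double k t l<t) (subst (λ x → 0 < t ∸ level k ∸ x) (sym eq) (+<⇒<∸ 0 (level k) l<t))))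

          -- Squaring is the identity on F₂, so the square stored in z(2j) gives s_j itself.
          from-square : ∀ j → h₀ (z S (double j)) ~₂ h₀ (z S′ (double j)) → O.s j ~₂ O′.s j
          from-square j p = Z₂.trans (Z₂.sym (square-~₂ (O.s j))) (Z₂.trans (Z₂.trans (Z₂.sym (O.z-even j)) (Z₂.trans p (O′.z-even j))) (square-~₂ (O′.s j)))

          -- Strong induction, bounded by b. For j = 1 and for even j ≥ 2 the lowest digit of z(2j)
          -- is recorded; odd j ≥ 3 goes through `determine-odd`, since `derive` kills even degrees
          -- and keeps odd ones.
          s-agree : ∀ b j → j < b → j ≤ t → O.s j ~₂ O′.s j
          s-agree-≥2 : ∀ b i → suc (suc i) ≤ b → suc (suc i) ≤ t → (∃ λ l → i ≡ double l) ⊎ (∃ λ l → i ≡ suc (double l)) →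
            O.s (suc (suc i)) ~₂ O′.s (suc (suc i))

          s-agree (suc b) zero          _        _   = Z₂.trans O.s₀ (Z₂.sym O′.s₀)
          s-agree (suc b) (suc zero)    _        1≤t = from-square 1 (known 0 refl 1≤t)
          s-agree (suc b) (suc (suc i)) (s≤s j≤b) j≤t = s-agree-≥2 b i j≤b j≤t (evenOrOdd i)

          s-agree-≥2 b _ j≤b j≤t (inj₁ (l , refl)) = from-square (double (suc l))
            (known (double (suc (double l))) (skipOdd-2mod4 l) (subst (_< t) (sym (level-double (suc (double l)))) j≤t))
          s-agree-≥2 b _ j≤b j≤t (inj₂ (l , refl)) = K.determine-odd O.s O′.s l O.s₀ O′.s₀
            (λ i i<j → s-agree b i (ℕₚ.<-≤-trans i<j j≤b) (ℕₚ.≤-trans (ℕₚ.<⇒≤ i<j) j≤t))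
            (Z₂.trans (Z₂.sym (O.z-odd (suc l))) (Z₂.trans
              (known (suc (double l)) (skipOdd-odd l) (subst (_< t) (sym (level-suc-double l)) (ℕₚ.<-≤-trans (l<double l) j≤t)))
              (O′.z-odd (suc l))))
            where
            l<double : ∀ l → suc l < suc (suc (suc (double l)))
            l<double zero    = s≤s (s≤s z≤n)
            l<double (suc l) = s≤s (ℕₚ.m≤n⇒m≤1+n (l<double l))

          zeroth : ∀ k → skipOdd k ≡ 1 → level k < t → (∃ λ i → k ≡ double i) ⊎ (∃ λ i → k ≡ suc (double i)) →
            digits (z S (2 ℕ.+ k)) 0 ≡ digits (z S′ (2 ℕ.+ k)) 0
          zeroth _ _  l<t (inj₁ (i , refl)) = digit-residue (z S (double (suc i))) (z S′ (double (suc i)))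
            (Z₂.trans (O.z-even (suc i)) (Z₂.trans (Z₂.*-cong same same) (Z₂.sym (O′.z-even (suc i)))))
            where
            same : O.s (suc i) ~₂ O′.s (suc i)
            same = s-agree (suc (suc i)) (suc i) ℕₚ.≤-refl (subst (_< t) (level-double i) l<t)
          zeroth _ eq l<t (inj₂ (i , refl)) = 0≢1 (skipOdd-odd i) eq

-- The ring ℤ[y]/(Φ) and its conjugation

module CyclotomicQuotient where
  open RingPreliminaries
  open Rings
  open IntDigits
  open Geometric
  open Specialise
  open import Data.Nat.Base using (_^_)
  open import Data.List.Base using (List; []; _∷_)

  constHom : Hom ℤ-ring ℤ[ρ]
  constHom = record
    { fun = λ x → x ∷ []
    ; cong = λ { ≡.refl k → ≡.refl }
    ; +-homo = λ x y k → ≡.refl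
    ; *-homo = λ { x y zero → ≡.sym (ℤₚ.+-identityʳ (x ℤ.* y)) ; x y (suc k) → ≡.refl }
    ; 1-homo = λ k → ≡.refl }

  module Monomials (P : CRing) where
    open CommutativeRing P hiding (zero)
    open GeometricSums P renaming (_^_ to _^ᴾ_)

    IsPowers : Carrier → (ℕ → Carrier) → Set
    IsPowers x mon = (k : ℕ) → mon k ≈ x ^ᴾ k

    isPowers : ∀ x mon → mon 0 ≈ 1# → (∀ k → mon (suc k) ≈ x * mon k) → IsPowers x mon
    isPowers x mon mon-0 mon-suc zero    = mon-0
    isPowers x mon mon-0 mon-suc (suc k) = trans (mon-suc k) (*-congˡ (isPowers x mon mon-0 mon-suc k))

    powers-geo : ∀ x mon → IsPowers x mon → (sums : ℕ → ℕ → Carrier) → (∀ s → sums 0 s ≈ 0#) → (∀ m s → sums (suc m) s ≈ mon (m ℕ.* s) + sums m s) →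
      ∀ m s → sums m s ≈ geo (x ^ᴾ s) m
    powers-geo x mon mon-^ sums sums-0 sums-suc zero    s = sums-0 s
    powers-geo x mon mon-^ sums sums-0 sums-suc (suc m) s = trans (sums-suc m s) (+-cong
      (trans (mon-^ (m ℕ.* s)) (trans (reflexive (≡.cong (x ^ᴾ_) (ℕₚ.*-comm m s))) (sym (^-assocʳ x s m)))) (powers-geo x mon mon-^ sums sums-0 sums-suc m s))

  mono-^ : ∀ k → CommutativeRing._≈_ ℤ[ρ] (mono k) (GeometricSums._^_ ℤ[ρ] (mono 1) k)
  mono-^ = Monomials.isPowers ℤ[ρ] (mono 1) mono (λ _ → ≡.refl) (λ k j → ≡.sym (coeff-ρ* (mono k) j))

  sumMonos-geo : ∀ m s → CommutativeRing._≈_ ℤ[ρ] (sumMonos m s) (GeometricSums.geo ℤ[ρ] (GeometricSums._^_ ℤ[ρ] (mono 1) s) m)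
  sumMonos-geo = Monomials.powers-geo ℤ[ρ] (mono 1) mono mono-^ sumMonos (λ _ _ → ≡.refl) (λ _ _ _ → ≡.refl)

  module RingLemmas (A : CRing) where
    open CommutativeRing A

    difference-zero : ∀ {x y} → x + - y ≈ 0# → x ≈ y
    difference-zero {x} {y} p = trans (solve 2 (λ x y → x := (x :+ :- y) :+ y) refl x y) (trans (+-congʳ p) (+-identityˡ y))
      where open Solver A using (solve; _:=_; _:+_; :-_)

  -- ρ = 2 - (ζ + ζ⁻¹)
  module Theta (A : CRing) (ι : Hom ℤ-ring A) (ζ ζ⁻¹ : CommutativeRing.Carrier A) (ζζ⁻¹ : MutuallyInverse A ζ ζ⁻¹) where
    open CommutativeRing A hiding (zero)
    open Solver A using (solve; _:=_; _:+_; _:*_; :-_; con)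
    private module ι = Hom ι

    ρ : Carrier
    ρ = (1# + - ζ) * (1# + - ζ⁻¹)

    evρ evθ : Hom ℤ[ρ] A
    evρ = ℤ[x].Eval.evalHom ι ρ
    evθ = ℤ[x].Eval.evalHom ι (ζ + ζ⁻¹)
    private
      module evρ = Hom evρ
      module evθ = Hom evθ

      evθ-const : ∀ x → evθ.fun (x ∷ []) ≈ ι.fun x
      evθ-const x = trans (+-congˡ (zeroʳ _)) (+-identityʳ _)

      2-θ : List ℤ
      2-θ = + 2 ∷ -[1+ 0 ] ∷ []

      evθ-ρ : evθ.fun 2-θ ≈ ρ
      evθ-ρ = trans (+-cong (trans (ι.+-homo (+ 1) (+ 1)) (+-cong ι.1-homo ι.1-homo)) (*-congˡ (trans (evθ-const -[1+ 0 ]) (trans (ι.neg-homo (+ 1)) (-‿cong ι.1-homo)))))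
        (sym (trans (solve 2 (λ x y → (con (+ 1) :+ :- x) :* (con (+ 1) :+ :- y) := con (+ 1) :+ :- x :+ :- y :+ x :* y) refl ζ ζ⁻¹)
          (trans (+-congˡ ζζ⁻¹) (solve 2 (λ x y → con (+ 1) :+ :- x :+ :- y :+ con (+ 1) := (con (+ 1) :+ con (+ 1)) :+ (x :+ y) :* :- con (+ 1)) refl ζ ζ⁻¹))))

    evρ⇒evθ : ∀ d → ∃ λ c → evρ.fun d ≈ evθ.fun c
    evρ⇒evθ []      = [] , refl
    evρ⇒evθ (x ∷ d) = (x ∷ []) ℤ[x].+P (2-θ ℤ[x].*P c) ,
      sym (trans (evθ.+-homo (x ∷ []) (2-θ ℤ[x].*P c)) (+-cong (evθ-const x) (trans (evθ.*-homo 2-θ c) (*-cong evθ-ρ (sym (proj₂ (evρ⇒evθ d)))))))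
      where
      c : List ℤ
      c = proj₁ (evρ⇒evθ d)

  module RootOfUnity (P : CRing) (Φ ζ ζ⁻¹ : CommutativeRing.Carrier P) (m s q′ : ℕ)
    (Φ-geo : CommutativeRing._≈_ P Φ (GeometricSums.geo P (GeometricSums._^_ P ζ s) (suc m)))
    (q≡ : suc q′ ≡ s ℕ.* suc m) (ζ⁻¹-power : CommutativeRing._≈_ P ζ⁻¹ (GeometricSums._^_ P ζ q′)) where
    private
      module P = CommutativeRing P
      module GP = GeometricSums P
    open Quotient P Φ
    open CommutativeRing quotient hiding (zero)
    open GeometricSums quotient using (inverse-^; geo; geo-cong; geo-telescope; geo-reverse; ^-assocʳ; ^-congˡ) renaming (_^_ to _^ᴬ_)
    private module AR = RingLemmas quotient

    Φ≈0 : Φ ≈ 0#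
    Φ≈0 = congruent P.1# (P.trans (P.+-congˡ -0#≈0#) (P.trans (P.+-identityʳ Φ) (P.sym (P.*-identityʳ Φ))))
      where open import Algebra.Properties.Ring P.ring using (-0#≈0#)

    geo≈0 : geo (ζ ^ᴬ s) (suc m) ≈ 0#
    geo≈0 = trans (geo-cong (suc m) (sym (hom-^ project ζ s)))
      (trans (sym (hom-geo project (ζ GP.^ s) (suc m))) (trans (sym (≈⇒~ Φ-geo)) Φ≈0))

    -- The product is ζ^q, and ζ^q - 1 = (ζ^s - 1) Φ(ζ) = 0.
    ζζ⁻¹ : ζ * ζ⁻¹ ≈ 1#
    ζζ⁻¹ = trans (*-congˡ (trans (≈⇒~ ζ⁻¹-power) (hom-^ project ζ q′)))
      (trans (reflexive (≡.cong (ζ ^ᴬ_) q≡)) (trans (sym (^-assocʳ ζ s (suc m)))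
        (AR.difference-zero (trans (sym (geo-telescope (ζ ^ᴬ s) (suc m))) (trans (*-congˡ geo≈0) (zeroʳ _))))))

    module Conjugation (conj : Hom P quotient) (conj-ζ : Hom.fun conj ζ ≈ ζ⁻¹) where
      private module conj = Hom conj

      conj-^ : ∀ k → conj.fun (ζ GP.^ k) ≈ ζ⁻¹ ^ᴬ k
      conj-^ k = trans (hom-^ conj ζ k) (^-congˡ k conj-ζ)

      -- The conjugate is the geometric sum read backwards, hence a power of ζ⁻¹ times zero. This is
      -- what makes conjugation well defined on classes.
      conj-Φ : conj.fun Φ ≈ 0#
      conj-Φ = trans (conj.cong Φ-geo) (trans (hom-geo conj (ζ GP.^ s) (suc m)) (trans (geo-cong (suc m) (conj-^ s))
        (trans (sym (geo-reverse (inverse-^ ζζ⁻¹ s) m)) (trans (*-congʳ geo≈0) (zeroˡ _)))))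

      conj-cong : ∀ {a b} → a ≈ b → conj.fun a ≈ conj.fun b
      conj-cong {a} {b} (congruent d p) = AR.difference-zero (trans (sym (conj.-‿homo₂ a b)) (trans (conj.cong p)
        (trans (conj.*-homo Φ d) (trans (*-congʳ conj-Φ) (zeroˡ _)))))

  module CyclotomicRing (Φ : List ℤ) where
    open Quotient ℤ[ρ] Φ
    open CommutativeRing quotient hiding (zero)
    open GeometricSums quotient using () renaming (_^_ to _^ᴬ_)

    ι : Hom ℤ-ring quotient
    ι = record
      { fun = λ x → x ∷ [] ; cong = λ p → ≈⇒~ (Hom.cong constHom p)
      ; +-homo = λ x y → ≈⇒~ (Hom.+-homo constHom x y) ; *-homo = λ x y → ≈⇒~ (Hom.*-homo constHom x y) ; 1-homo = refl }

    evalZ-eval : ∀ t c → evalZ c t ≡ Hom.fun (ℤ[x].Eval.evalHom ι t) c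
    evalZ-eval t = ℤ[x].Eval.eval-unique ι t (λ c → evalZ c t) ≡.refl (λ _ _ → ≡.refl)

    powZ-^ : ∀ a e → powZ a e ≡ a ^ᴬ e
    powZ-^ a = GeometricSums.^-unique quotient a (powZ a) ≡.refl (λ _ → ≡.refl)

    eval-mono₁ : ∀ t → Hom.fun (ℤ[x].Eval.evalHom ι t) (mono 1) ≈ t
    eval-mono₁ t = trans (+-congʳ {t * eval.fun (+ 1 ∷ [])} (Hom.0-homo ι)) (trans (+-identityˡ _) (trans (*-congˡ {t} eval.1-homo) (*-identityʳ t)))
      where module eval = Hom (ℤ[x].Eval.evalHom ι t)

-- From the Seidel matrices of the definitions to the abstract ones

module PrimePowerOrder where
  open RingPreliminaries
  open Rings
  open Counting
  open Geometric
  open Specialise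
  open CyclotomicBound
  open CyclotomicQuotient
  open import Data.Nat.Base using (_^_)
  open import Data.List.Base using (List; []; _∷_)

  module PrimePower (m f : ℕ) where
    module C = Cyclotomic (suc m) (suc f)

    s q′ : ℕ
    s  = suc m ^ f
    q′ = C.q ∸ 1

    private
      q≡ : suc q′ ≡ s ℕ.* suc m
      q≡ = ≡.trans (ℕₚ.suc-pred C.q {{ℕ.>-nonZero (ℕₚ.m^n>0 (suc m) (suc f))}}) (ℕₚ.*-comm (suc m) s)

    A : CRing
    A = Quotient.quotient ℤ[ρ] C.Φ
    open CommutativeRing A hiding (zero)

    open RootOfUnity ℤ[ρ] C.Φ (mono 1) C.ζ⁻¹ m s q′ (sumMonos-geo (suc m) s) q≡ (mono-^ q′) public using (ζζ⁻¹; geo≈0; module Conjugation)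
    open CyclotomicRing C.Φ
    open Conjugation (ℤ[x].Eval.evalHom ι C.ζ⁻¹) (eval-mono₁ C.ζ⁻¹)

    private
      to : ∀ {a b} → a C.≈ζ b → a ≈ b
      to (d , p) = congruent d p

      from : ∀ {a b} → a ≈ b → a C.≈ζ b
      from (congruent d p) = d , p

      mono≈ : ∀ k → mono k ≈ GeometricSums._^_ A (mono 1) k
      mono≈ k = trans (Quotient.≈⇒~ ℤ[ρ] C.Φ (mono-^ k)) (hom-^ (Quotient.project ℤ[ρ] C.Φ) (mono 1) k)

      conj-power : ∀ a k → a C.≈ζ mono k → C.conj a ≈ GeometricSums._^_ A C.ζ⁻¹ k
      conj-power a k p = trans (reflexive (evalZ-eval C.ζ⁻¹ a)) (trans (conj-cong {a} {mono k} (to {a} {mono k} p))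
        (trans (Hom.cong (ℤ[x].Eval.evalHom ι C.ζ⁻¹) {mono k} {GeometricSums._^_ ℤ[ρ] (mono 1) k} (mono-^ k)) (conj-^ k)))

    module _ (c : ℕ) (2c : c ℕ.+ c ≡ s ℕ.* m) where
      open Specialisation A ι (mono 1) C.ζ⁻¹ ζζ⁻¹ s m c 2c geo≈0 using (SeidelMatrix; InIdeal)
      private
        CharPolyCongruent : ∀ {n} → ℕ → SeidelMatrix n → SeidelMatrix n → Set
        CharPolyCongruent = Bounds.CharPolyCongruent A ι (mono 1) C.ζ⁻¹ ζζ⁻¹ s m c 2c geo≈0

      convert : ∀ {n} → C.Seidel n → SeidelMatrix n
      convert S = record
        { mat = mat
        ; diag = λ i → to (diag i)
        ; exponent = λ i j → proj₁ (power i j (i ≟ j))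
        ; upper = λ i j ne → trans (to (proj₂ (power i j (i ≟ j)) ne)) (mono≈ _)
        ; lower = λ i j ne → trans (to (herm i j)) (conj-power (mat i j) _ (proj₂ (power i j (i ≟ j)) ne)) }
        where
        open C.Seidel S
        power : ∀ i j → Dec (i ≡ j) → ∃ λ k → i ≢ j → mat i j C.≈ζ mono k
        -- The exponent 0 on the diagonal is a placeholder; the property is claimed only for i ≠ j.
        power i j (yes i≡j) = 0 , λ ne → ⊥-elim (ne i≡j)
        power i j (no i≢j)  = proj₁ (offdiag i j i≢j) , λ _ → proj₂ (offdiag i j i≢j)

      private
        -- The digits produce polynomials in ρ, the definition asks for polynomials in θ = ζ + ζ⁻¹;
        -- ρ = 2 - θ converts one into the other.
        ideal : ∀ e x → InIdeal e x → C.InRhoIdeal e x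
        ideal e x (d , p) = proj₁ θ , from (trans p (trans (*-congˡ {GeometricSums._^_ A C.ρ e} (proj₂ θ))
          (reflexive (≡.cong₂ ZP._*P_ (≡.sym (powZ-^ C.ρ e)) (≡.sym (evalZ-eval C.θ (proj₁ θ)))))))
          where
          θ : ∃ λ c → Hom.fun (Theta.evρ A ι (mono 1) C.ζ⁻¹ ζζ⁻¹) d ≈ Hom.fun (Theta.evθ A ι (mono 1) C.ζ⁻¹ ζζ⁻¹) c
          θ = Theta.evρ⇒evθ A ι (mono 1) C.ζ⁻¹ ζζ⁻¹ d

        congruent-charPoly : ∀ {n} e (S S′ : C.Seidel n) → CharPolyCongruent e (convert S) (convert S′) → C.CongMod e (C.charPoly S) (C.charPoly S′)
        congruent-charPoly e S S′ p k = ideal e _ (p k)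

      -- Order 0 is treated apart because the reduction splits off a row; here every characteristic
      -- polynomial is 1.
      transfer₀ : ∀ e → C.CardX'≤ 0 e 1
      transfer₀ e = family-bound 1 (λ _ _ _ → zero) 0 (λ _ → 0) _ (λ S S′ _ → congruent-charPoly e S S′ (λ k → [] , trans (-‿inverseʳ (Polynomials.coeff A (1# ∷ []) k)) (sym (zeroʳ (GeometricSums._^_ A C.ρ e)))))

      transfer : ∀ n e B → (∀ M (S : Fin M → SeidelMatrix n) → (∀ i j → i ≢ j → ¬ CharPolyCongruent e (S i) (S j)) → M ≤ B) → C.CardX'≤ n e B
      transfer n e B bound M S distinct = bound M (λ i → convert (S i)) (λ i j ne p → distinct i j ne (congruent-charPoly e (S i) (S j) p))

-- Evaluating the exponents, and the five cases

module ExponentBounds where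
  open Counting
  open Hermitian using (double)
  open Laurent using (level)
  open RealBound
  open CyclotomicBound
  open CyclotomicQuotient using (module CyclotomicRing)
  open PrimePowerOrder
  open import Data.Nat using (ℕ; zero; suc; _≤_; _<_; _^_; _*_; _+_; _∸_; _/_; z≤n; s≤s)
  open import Data.Nat.DivMod using (m*n/n≡m; m<n*o⇒m/o<n)
  open import Data.Nat.Divisibility using (_∣_; divides; ∣m+n∣m⇒∣n; ∣1⇒≡1)
  open import Data.Nat.Primality using (Prime)
  open import Data.Nat.Solver using (module +-*-Solver)
  open import Data.Integer as ℤ using (+_; ∣_∣)
  open import Data.List.Base using ([]; _∷_)
  open import Data.Product using (_×_; _,_)
  open ≡ using (refl; sym; trans; cong; cong₂; subst)

  open +-*-Solver using (solve; _:=_; _:+_; _:*_; con)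

  2∣double : ∀ m → 2 ∣ double m
  2∣double zero    = divides 0 refl
  2∣double (suc m) with 2∣double m
  ... | divides q eq = divides (suc q) (cong (λ x → suc (suc x)) eq)

  2∤suc-double : ∀ m → ¬ (2 ∣ suc (double m))
  2∤suc-double m d with ∣1⇒≡1 (∣m+n∣m⇒∣n {2} {double m} (subst (2 ∣_) (ℕₚ.+-comm 1 (double m)) d) (2∣double m))
  ... | ()

  double≡+ : ∀ m → double m ≡ m + m
  double≡+ zero    = refl
  double≡+ (suc m) = cong suc (trans (cong suc (double≡+ m)) (sym (ℕₚ.+-suc m m)))

  triangle : ℕ → ℕ
  triangle zero    = 0
  triangle (suc t) = suc t + triangle t

  triangle-*2 : ∀ t → triangle t * 2 ≡ suc t * t
  triangle-*2 zero    = refl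
  triangle-*2 (suc t) = trans (solve 2 (λ t x → (con 1 :+ t :+ x) :* con 2 := (con 1 :+ t) :* con 2 :+ x :* con 2) refl t (triangle t))
    (trans (cong (λ x → suc t * 2 + x) (triangle-*2 t)) (solve 1 (λ t → (con 1 :+ t) :* con 2 :+ (con 1 :+ t) :* t := (con 2 :+ t) :* (con 1 :+ t)) refl t))

  total-0 : ∀ K ℓ → (∀ k → ℓ k ≡ 0) → total K ℓ ≡ 0
  total-0 zero    ℓ p = refl
  total-0 (suc K) ℓ p = cong₂ _+_ (p 0) (total-0 K (λ k → ℓ (suc k)) (λ k → p (suc k)))

  total-staircase : ∀ K t → total K (λ k → t ∸ k) ≤ triangle t
  total-staircase zero    t       = z≤n
  total-staircase (suc K) zero    = ℕₚ.≤-reflexive (total-0 (suc K) (λ k → 0 ∸ k) ℕₚ.0∸n≡0)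
  total-staircase (suc K) (suc t) = ℕₚ.+-monoʳ-≤ (suc t) (total-staircase K t)

  bound-a : ∀ e → total (e ∸ 3) (λ k → e ∸ 3 ∸ k) ≤ ∣ (+ e ℤ.- + 2) ℤ.* (+ e ℤ.- + 3) ∣ / 2
  bound-a 0 = z≤n
  bound-a 1 = z≤n
  bound-a 2 = z≤n
  bound-a (suc (suc (suc t))) = ℕₚ.≤-trans (total-staircase t t) (ℕₚ.≤-reflexive (sym (trans
    (cong (_/ 2) (trans (ℤₚ.abs-* (+ suc t) (+ t)) (sym (triangle-*2 t)))) (m*n/n≡m (triangle t) 2))))

  bound-b : ∀ e → total (suc (e ∸ 3)) (oddLengths e) ≤ (e * e + 8 ∸ 5 * e) / 2
  bound-b 0 = z≤n
  bound-b 1 = z≤n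
  bound-b 2 = z≤n
  bound-b e@(suc (suc (suc t))) = ℕₚ.≤-trans (lengths t) (ℕₚ.≤-reflexive (sym (trans
    (cong (_/ 2) (trans (cong (λ x → x ∸ 5 * e) square) (ℕₚ.m+n∸n≡m (suc (triangle t) * 2) (5 * e)))) (m*n/n≡m (suc (triangle t)) 2))))
    where
    lengths : ∀ t → suc t + total t (λ k → t ∸ suc k) ≤ suc (triangle t)
    lengths zero    = s≤s z≤n
    lengths (suc t) = s≤s (ℕₚ.+-monoʳ-≤ (suc t) (total-staircase (suc t) t))
    -- With e = t + 3 the truncated difference is exact: e² + 8 - 5 e = t² + t + 2, twice the
    -- triangular number plus 2.
    square : e * e + 8 ≡ suc (triangle t) * 2 + 5 * e
    square = trans (solve 1 (λ t → (con 3 :+ t) :* (con 3 :+ t) :+ con 8 := (con 2 :+ (con 1 :+ t) :* t) :+ con 5 :* (con 3 :+ t)) refl t)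
      (cong (λ x → 2 + x + 5 * e) (sym (triangle-*2 t)))

  -- The level rises once every two positions, so passing from t to t + 1 adds (t + 1) + t, the next
  -- odd number.
  total-square : ∀ t → total (double t) (λ k → t ∸ level k) ≡ t * t
  total-square zero    = refl
  total-square (suc t) = trans (cong (λ x → suc t + (t + x)) (total-square t))
    (solve 1 (λ t → con 1 :+ t :+ (t :+ t :* t) := (con 1 :+ t) :* (con 1 :+ t)) refl t)

  bound-c : ∀ e → total (double (e ∸ 1)) (λ k → (e ∸ 1) ∸ level k) ≤ ∣ (+ e ℤ.- + 1) ℤ.* (+ e ℤ.- + 1) ∣
  bound-c zero    = z≤n
  bound-c (suc t) = ℕₚ.≤-reflexive (trans (total-square t) (sym (ℤₚ.abs-* (+ t) (+ t))))

  -- With a digit saved at every even position the counts come in equal pairs: 2 (u + ... + 1) = (u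
  -- + 1) u.
  total-evenOrder : ∀ u → total (double (suc u)) (λ k → suc u ∸ level k ∸ skipEven k) ≡ suc u * u
  total-evenOrder zero    = refl
  total-evenOrder (suc u) = trans (cong (λ x → suc u + (suc u + x)) (total-evenOrder u))
    (solve 1 (λ u → con 1 :+ u :+ (con 1 :+ u :+ (con 1 :+ u) :* u) := (con 2 :+ u) :* (con 1 :+ u)) refl u)

  bound-d : ∀ e → total (double (e ∸ 1)) (λ k → (e ∸ 1) ∸ level k ∸ skipEven k) ≤ ∣ (+ e ℤ.- + 1) ℤ.* (+ e ℤ.- + 2) ∣
  bound-d 0 = z≤n
  bound-d 1 = z≤n
  bound-d (suc (suc u)) = ℕₚ.≤-reflexive (trans (total-evenOrder u) (sym (ℤₚ.abs-* (+ suc u) (+ u))))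

  -- ⌈t/2⌉ is the number of multiples of 4 with level below t, that is, of digits saved.
  total-skip₄ : ∀ t → total (double t) (λ k → t ∸ level k ∸ skip₄ k) + level t ≡ t * t
  total-skip₄ 0 = refl
  total-skip₄ 1 = refl
  total-skip₄ (suc (suc u)) = trans
    (solve 3 (λ u g l → (con 1 :+ u :+ (con 1 :+ u :+ (con 1 :+ u :+ (u :+ g)))) :+ (con 1 :+ l) := (g :+ l) :+ (con 4 :+ con 4 :* u)) refl
      u (total (double u) (λ k → u ∸ level k ∸ skip₄ k)) (level u))
    (trans (cong (λ x → x + (4 + 4 * u)) (total-skip₄ u)) (solve 1 (λ u → u :* u :+ (con 4 :+ con 4 :* u) := (con 2 :+ u) :* (con 2 :+ u)) refl u))

  -- `skipOdd` postpones the first saving from position 0 to position 4, so the first four positions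
  -- are split off and t = u + 2.
  total-oddOrder : ∀ u → total (double (2 + u)) (λ k → (2 + u) ∸ level k ∸ skipOdd k) + level u ≡ (2 + u) * (2 + u)
  total-oddOrder u = trans
    (solve 3 (λ u g l → (con 2 :+ u :+ (con 1 :+ u :+ (con 1 :+ u :+ (u :+ g)))) :+ l := (g :+ l) :+ (con 4 :+ con 4 :* u)) refl
      u (total (double u) (λ k → u ∸ level k ∸ skip₄ k)) (level u))
    (trans (cong (λ x → x + (4 + 4 * u)) (total-skip₄ u)) (solve 1 (λ u → u :* u :+ (con 4 :+ con 4 :* u) := (con 2 :+ u) :* (con 2 :+ u)) refl u))

  -- For e = u + 3 the saving obtained is ⌈(e - 3)/2⌉, and this is at least ⌊e/4⌋.
  quarter≤level : ∀ u → (3 + u) / 4 ≤ level u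
  quarter≤level u = ℕₚ.≤-pred (m<n*o⇒m/o<n (s≤s (ℕₚ.≤-trans (ℕₚ.+-monoʳ-≤ 3 (u≤ u))
    (ℕₚ.≤-reflexive refl))))
    where
    u≤ : ∀ u → u ≤ level u * 4
    u≤ 0 = z≤n
    u≤ 1 = s≤s z≤n
    u≤ (suc (suc u)) = s≤s (s≤s (ℕₚ.≤-trans (u≤ u) (ℕₚ.m≤n+m (level u * 4) 2)))

  bound-e : ∀ e → total (double (e ∸ 1)) (λ k → (e ∸ 1) ∸ level k ∸ skipOdd k) ≤ ∣ (+ e ℤ.- + 1) ℤ.* (+ e ℤ.- + 1) ℤ.- + (e / 4) ∣
  bound-e 0 = z≤n
  bound-e 1 = z≤n
  bound-e 2 = s≤s z≤n
  bound-e e@(suc t@(suc (suc u))) = subst (T ≤_) (sym abs) (subst (_≤ t * t ∸ e / 4) (ℕₚ.m+n∸n≡m T (level u))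
    (subst (λ x → x ∸ level u ≤ t * t ∸ e / 4) (sym (total-oddOrder u)) (ℕₚ.∸-monoʳ-≤ (t * t) (quarter≤level u))))
    where
    T : ℕ
    T = total (double t) (λ k → t ∸ level k ∸ skipOdd k)
    e/4≤ : e / 4 ≤ t * t
    e/4≤ = ℕₚ.≤-trans (quarter≤level u) (subst (level u ≤_) (total-oddOrder u) (ℕₚ.m≤n+m (level u) T))
    abs : ∣ (+ e ℤ.- + 1) ℤ.* (+ e ℤ.- + 1) ℤ.- + (e / 4) ∣ ≡ t * t ∸ e / 4
    abs = trans (cong (λ x → ∣ x ℤ.- + (e / 4) ∣) (sym (ℤₚ.pos-* t t))) (cong ∣_∣ (trans (ℤₚ.m-n≡m⊖n (t * t) (e / 4)) (ℤₚ.⊖-≥ e/4≤)))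

  weaken : ∀ {M B B′} p → B ≤ B′ → M ≤ suc p ^ B → M ≤ suc p ^ B′
  weaken p B≤B′ M≤ = ℕₚ.≤-trans M≤ (ℕₚ.^-monoʳ-≤ (suc p) B≤B′)

  one≤ : ∀ p B → 1 ≤ suc p ^ B
  one≤ p B = ℕₚ.m^n>0 (suc p) B

  real₀ : ∀ e → Two.CardX'≤ 0 e 1
  real₀ e = family-bound 1 (λ _ _ _ → zero) 0 (λ _ → 0) _ (λ S S′ _ k → divides 0 (cong ∣_∣ (ℤₚ.+-inverseʳ (ZP.coeff (+ 1 ∷ []) k))))

  case-a : ∀ n e → 2 ∣ n → Two.CardX'≤ n e (2 ^ (∣ (+ e ℤ.- + 2) ℤ.* (+ e ℤ.- + 3) ∣ / 2))
  case-a zero e _ M S distinct = ℕₚ.≤-trans (real₀ e M S distinct) (one≤ 1 (∣ (+ e ℤ.- + 2) ℤ.* (+ e ℤ.- + 3) ∣ / 2))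
  case-a (suc n) e 2∣n with evenOrOdd n
  ... | inj₁ (m , refl) = ⊥-elim (2∤suc-double m 2∣n)
  ... | inj₂ (m , refl) = λ M S distinct → weaken 1 (bound-a e) (card-even m e M S distinct)

  case-b : ∀ n e → ¬ (2 ∣ n) → Two.CardX'≤ n e (2 ^ ((e * e + 8 ∸ 5 * e) / 2))
  case-b zero e 2∤n = ⊥-elim (2∤n (divides 0 refl))
  case-b (suc n) e 2∤n with evenOrOdd n
  ... | inj₁ (m , refl) = λ M S distinct → weaken 1 (bound-b e) (card-odd m e M S distinct)
  ... | inj₂ (m , refl) = ⊥-elim (2∤n (2∣double (suc m)))

  -- The half c exists for odd p because m = p - 1 is even.
  module Halves (m f c : ℕ) (2c : c + c ≡ suc m ^ f * m) where
    open PrimePower m f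
    open Bounds A (CyclotomicRing.ι C.Φ) (mono 1) C.ζ⁻¹ ζζ⁻¹

    any-order : ∀ n e → C.CardX'≤ n e (suc m ^ ∣ (+ e ℤ.- + 1) ℤ.* (+ e ℤ.- + 1) ∣)
    any-order zero e M S distinct = ℕₚ.≤-trans (transfer₀ c 2c e M S distinct) (one≤ m ∣ (+ e ℤ.- + 1) ℤ.* (+ e ℤ.- + 1) ∣)
    any-order (suc n) e = transfer c 2c (suc n) e _ (λ M S distinct → weaken m (bound-c e) (card-any s m c 2c geo≈0 n e M S distinct))

  case-c : ∀ n e p f → ¬ (2 ∣ p) → 1 ≤ f → Cyclotomic.CardX'≤ p f n e (p ^ ∣ (+ e ℤ.- + 1) ℤ.* (+ e ℤ.- + 1) ∣)
  case-c n e zero f 2∤p _ = ⊥-elim (2∤p (divides 0 refl))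
  case-c n e (suc m) (suc f) 2∤p _ with evenOrOdd m
  ... | inj₁ (j , refl) = Halves.any-order (double j) f (suc (double j) ^ f * j)
    (trans (sym (ℕₚ.*-distribˡ-+ (suc (double j) ^ f) j j)) (cong (λ x → suc (double j) ^ f * x) (sym (double≡+ j)))) n e
  ... | inj₂ (j , refl) = ⊥-elim (2∤p (2∣double (suc j)))

  -- Here q = 2^(f+2) and m = 1, so s = 2^(f+1) itself has to be even, with half c = 2^f. This is
  -- where an exponent greater than 1 is required.
  module PowerOfTwo (f : ℕ) where
    open PrimePower 1 (suc f)
    open Bounds A (CyclotomicRing.ι C.Φ) (mono 1) C.ζ⁻¹ ζζ⁻¹
    c : ℕ
    c = 2 ^ f
    2c : c + c ≡ 2 ^ suc f * 1
    2c = solve 1 (λ x → x :+ x := (x :+ (x :+ con 0)) :* con 1) refl c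

    case-d : ∀ n e → 2 ∣ n → C.CardX'≤ n e (2 ^ ∣ (+ e ℤ.- + 1) ℤ.* (+ e ℤ.- + 2) ∣)
    case-d zero e _ M S distinct = ℕₚ.≤-trans (transfer₀ c 2c e M S distinct) (one≤ 1 ∣ (+ e ℤ.- + 1) ℤ.* (+ e ℤ.- + 2) ∣)
    case-d (suc n) e 2∣n with evenOrOdd n
    ... | inj₁ (m , refl) = ⊥-elim (2∤suc-double m 2∣n)
    ... | inj₂ (m , refl) = transfer c 2c (suc (suc (double m))) e _ (λ M S distinct → weaken 1 (bound-d e) (card-evenOrder s c 2c geo≈0 m e M S distinct))

    case-e : ∀ n e → ¬ (2 ∣ n) → C.CardX'≤ n e (2 ^ ∣ (+ e ℤ.- + 1) ℤ.* (+ e ℤ.- + 1) ℤ.- + (e / 4) ∣)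
    case-e zero e 2∤n = ⊥-elim (2∤n (divides 0 refl))
    case-e (suc n) e 2∤n with evenOrOdd n
    ... | inj₁ (m , refl) = transfer c 2c (suc (double m)) e _ (λ M S distinct → weaken 1 (bound-e e) (card-oddOrder s c 2c geo≈0 m e M S distinct))
    ... | inj₂ (m , refl) = ⊥-elim (2∤n (2∣double (suc m)))

open ExponentBounds
open import Data.Nat using (ℕ; _≤_; _<_; _^_; _*_; _+_; _∸_; _/_)
open import Data.Nat.Divisibility using (_∣_)
open import Data.Nat.Primality using (Prime)
open import Data.Integer as ℤ using (+_; ∣_∣)
open import Data.Product using (_×_)
open import Relation.Nullary using (¬_)

theorem1p2 : ∀ (n e : ℕ) →
    (2 ∣ n → Two.CardX'≤ n e (2 ^ (∣ (+ e ℤ.- + 2) ℤ.* (+ e ℤ.- + 3) ∣ / 2)))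
    × (¬ (2 ∣ n) → Two.CardX'≤ n e (2 ^ ((e * e + 8 ∸ 5 * e) / 2)))
    × (∀ (p f : ℕ) → Prime p → ¬ (2 ∣ p) → 1 ≤ f →
    Cyclotomic.CardX'≤ p f n e (p ^ ∣ (+ e ℤ.- + 1) ℤ.* (+ e ℤ.- + 1) ∣))
    × (∀ (f : ℕ) → 1 < f → 2 ∣ n →
    Cyclotomic.CardX'≤ 2 f n e (2 ^ ∣ (+ e ℤ.- + 1) ℤ.* (+ e ℤ.- + 2) ∣))
    × (∀ (f : ℕ) → 1 < f → ¬ (2 ∣ n) →
    Cyclotomic.CardX'≤ 2 f n e (2 ^ ∣ (+ e ℤ.- + 1) ℤ.* (+ e ℤ.- + 1) ℤ.- + (e / 4) ∣))
theorem1p2 n e = case-a n e , case-b n e , (λ p f _ → case-c n e p f) ,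
  (λ { (suc (suc f)) _ → PowerOfTwo.case-d f n e ; (suc zero) (s≤s ()) }) ,
  (λ { (suc (suc f)) _ → PowerOfTwo.case-e f n e ; (suc zero) (s≤s ()) })
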